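{- Let $\mathcal{X}$ be a hereditary graph class that is small and weakly sparse. Then $\mathcal{X}$ admits an $O(\log n)$-bit adjacency labeling scheme.
   Context: A class of graphs is a set of graphs closed under isomorphism; it is hereditary if closed under taking induced subgraphs. $\mathcal{X}_n$ denotes the set of graphs in $\mathcal{X}$ with vertex set $[n]$. A hereditary class $\mathcal{X}$ is small if there is a constant $c$ with $|\mathcal{X}_n|\le n!\cdot c^n$ for all $n$. It is weakly sparse if for some integer $t$, $K_{t,t}$ is not a subgraph of any graph in the class. For a function $b:\mathbb{N}\to\mathbb{N}$, a $b(n)$-bit adjacency labeling scheme for $\mathcal{X}$ is a pair (encoder, decoder) where for every $G\in\mathcal{X}_n$ the encoder assigns to each vertex a binary string (label) of length $b(n)$ such that the decoder, which depends only on $\mathcal{X}$ and not on $G$, determines whether two vertices are adjacent from their two labels alone. -}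

module Defs where

open import Data.Nat using (ℕ; _!; _*_; _^_; _≤_; _≥_)
open import Data.Nat.Logarithm using (⌈log₂_⌉)
open import Data.Bool using (Bool; true; false)
open import Data.Fin using (Fin)
open import Data.List using (List; length)
open import Data.Product using (Σ; ∃; ∃-syntax; _×_; _,_; proj₁)
open import Function.Bundles using (_⇔_)
open import Function.Definitions using (Injective)
open import Relation.Binary.PropositionalEquality using (_≡_)
open import Relation.Nullary using (¬_)

record Graph (n : ℕ) : Set where
  field
    adj    : Fin n → Fin n → Bool
    adj-sym    : ∀ u v → adj u v ≡ adj v u
    adj-irrefl : ∀ u → adj u u ≡ false
open Graph public

SameGraph : {n : ℕ} → Graph n → Graph n → Set
SameGraph G H = ∀ u v → adj G u v ≡ adj H u v

-- The subgraph of G induced by the image of an injective map ι : [m] → [n],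
-- with its vertices relabelled by [m].
induced : {m n : ℕ} → Graph n → (Fin m → Fin n) → Graph m
induced G ι = record
  { adj = λ u v → adj G (ι u) (ι v)
  ; adj-sym = λ u v → adj-sym G (ι u) (ι v)
  ; adj-irrefl = λ u → adj-irrefl G (ι u) }

GraphFamily : Set₁
GraphFamily = (n : ℕ) → Graph n → Set

record Iso {n m : ℕ} (G : Graph n) (H : Graph m) : Set where
  field
    to   : Fin m → Fin n
    from : Fin n → Fin m
    to-from : ∀ x → to (from x) ≡ x
    from-to : ∀ y → from (to y) ≡ y
    preserves : ∀ u v → adj H u v ≡ adj G (to u) (to v)

IsoClosed : GraphFamily → Set
IsoClosed X = ∀ {n m} (G : Graph n) (H : Graph m) → Iso G H → X n G → X m H

Hereditary : GraphFamily → Set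
Hereditary X = ∀ {n m} (G : Graph n) (ι : Fin m → Fin n) →
  Injective _≡_ _≡_ ι → X n G → X m (induced G ι)

-- |X_n| ≤ N, stated as: X_n (graphs counted up to equality of edge sets)
-- injects into Fin N.
CardX≤ : GraphFamily → ℕ → ℕ → Set
CardX≤ X n N = Σ (Σ (Graph n) (X n) → Fin N) λ f →
  ∀ p q → f p ≡ f q → SameGraph (proj₁ p) (proj₁ q)

Small : GraphFamily → Set
Small X = ∃[ c ] ∀ n → CardX≤ X n (n ! * c ^ n)

ContainsKtt : {n : ℕ} → ℕ → Graph n → Set
ContainsKtt {n} t G = Σ (Fin t → Fin n) λ a → Σ (Fin t → Fin n) λ b →
  (Injective _≡_ _≡_ a × Injective _≡_ _≡_ b ×
   (∀ (i j : Fin t) → adj G (a i) (b j) ≡ true))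

WeaklySparse : GraphFamily → Set
WeaklySparse X = ∃[ t ] ∀ n (G : Graph n) → X n G → ¬ ContainsKtt t G

LabelingScheme : GraphFamily → (ℕ → ℕ) → Set₁
LabelingScheme X b = Σ (List Bool → List Bool → Set) λ D →
  ∀ n (G : Graph n) → X n G →
    Σ (Fin n → List Bool) λ ℓ → ((∀ (u : Fin n) → length (ℓ u) ≡ b n) ×
            (∀ u v → (adj G u v ≡ true) ⇔ D (ℓ u) (ℓ v)))

BigOLog : (ℕ → ℕ) → Set
BigOLog b = ∃[ C ] ∃[ N ] ∀ n → n ≥ N → b n ≤ C * ⌈log₂ n ⌉

HasLogLabeling : GraphFamily → Set₁
HasLogLabeling X = Σ (ℕ → ℕ) λ b → BigOLog b × LabelingScheme X b

{-# OPTIONS --safe #-}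
-- The graphs of X have bounded degeneracy; a vertex is then labelled by its name and the names of its boundedly many
-- out-neighbours in an orientation. To bound the degeneracy, let S be a minimal set of vertices of a graph G in X
-- with large average degree ρ.
--
-- If all degrees in G[S] are at most D, with log D much smaller than ρ, there is a set R of few vertices such that R
-- induces a connected graph and all other vertices have t neighbours in R. Add to R an arbitrary set of m other
-- vertices. An embedding of the resulting graph H into G has at most D options for each vertex of R, along a
-- spanning tree, and then fewer than t options for every other vertex, as G has no K_{t,t}. So few of the (1/ε)^m
-- choices give isomorphic graphs, and X contains more labelled graphs than n! c^n.
--
-- Otherwise most edges join a small set Q of vertices of huge degree to a much larger set B. Let as many vertices of
-- B as possible choose distinct pairs of non-adjacent neighbours in Q. A vertex that finds no new pair sees a clique
-- in a sparse graph on Q; if there are many of them, the pigeonhole principle yields K_{t,t}. If there are few, a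
-- random thinning leaves an induced 1-subdivision of a dense graph F on a part of Q, and by deleting subdividing
-- vertices X contains the subdivisions of all subgraphs of F.
--
-- For a dense graph F whose edges are replaced by chunks of L vertices the same dichotomy applies. If its degrees
-- are bounded, count the graphs consisting of a spanning tree and m further edges. Otherwise the matching of B to
-- pairs in Q gives a much denser graph on fewer vertices whose edges are replaced by chunks of 2L+1 vertices, and
-- one concludes by induction on the number of vertices: the density needed for chunks of size L grows like
-- 2^{O(L^2)}, while the density gained is exponential in a power of that of F.
module Submission where

open import Defs
import Data.Nat.Properties
open import Algebra.Properties.Semiring.Sum Data.Nat.Properties.+-*-semiring using (sum; sum-cong-≗; ∑-distrib-+; ∑-comm; *-distribˡ-sum)
open import Data.Bool using (_∧_; _∨_; Bool; false; if_then_else_; not; true)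
open import Data.Bool.Properties using (∧-assoc; ∧-comm; ∨-comm)
open import Data.Empty using (⊥; ⊥-elim)
open import Data.Fin using (_↑ʳ_; _↑ˡ_; combine; Fin; finToFun; fromℕ; fromℕ<; funToFin; inject₁; inject≤; join; punchIn; remQuot; splitAt; suc; toℕ; zero)
open import Data.Fin.Permutation using (_⟨$⟩ʳ_; _⟨$⟩ˡ_; insert; insert-punchIn; inverseʳ; inverseˡ; Permutation′)
open import Data.Fin.Properties using (all?; any?; combine-injective; combine-remQuot; finToFun-funToFin; funToFin-finToFin; injective⇒≤; inject₁-injective; inject≤-injective; join-splitAt; punchIn-injective; remQuot-combine; splitAt-join; splitAt-↑ʳ; splitAt-↑ˡ; toℕ-fromℕ<; toℕ-injective; toℕ-inject₁; toℕ<n) renaming (_≟_ to _≟ᶠ_)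
open import Data.List using (length; List)
open import Data.Maybe using (is-just; just; Maybe; nothing)
open import Data.Maybe.Properties using (just-injective)
open import Data.Nat using (>-nonZero; >-nonZero⁻¹; _!; _*_; _+_; _<_; _^_; _∸_; _≤_; nonZero; NonZero; suc; s≤s; zero; z≤n; ℕ; ⌈_/2⌉)
open import Data.Nat.Induction using (<-rec)
open import Data.Nat.Logarithm using (⌈log₂2^n⌉≡n; ⌈log₂_⌉; ⌈log₂⌈n/2⌉⌉≡⌈log₂n⌉∸1; ⌈log₂⌉-mono-≤)
open import Data.Nat.Properties
open import Data.Nat.Tactic.RingSolver using (solve-∀)
open import Data.Product using (_,_; _×_; proj₁; proj₂; uncurry; Σ; ∃; ∃₂)
open import Data.Product.Properties using (,-injective)
open import Data.Sum using ([_,_]′; _⊎_; inj₁; inj₂)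
open import Data.Unit using (tt; ⊤)
open import Data.Vec using ([]; _∷_; concat; lookup; tabulate; toList; Vec)
open import Data.Vec.Functional using () renaming (_∷_ to _◂_)
open import Data.Vec.Properties using (++-injective; length-toList; lookup∘tabulate; toList-injective)
open import Function using (_∘_; case_of_)
open import Function.Bundles using (_⇔_; mk⇔)
open import Function.Definitions using (Injective)
open import Relation.Binary.Definitions using (tri<; tri>; tri≈)
open import Relation.Binary.PropositionalEquality using (_≡_; _≢_; cong; cong₂; module ≡-Reasoning; refl; subst; sym; trans)
open import Relation.Nullary using (Dec; does; no; yes; ¬_)

-- Finite sums and subsets

-- Smallness enters in a single way: many choices of an induced subgraph are exhibited, and an
-- isomorphic copy is shown to be described by few bits. An embedding of a tree costs log D bits per
-- tree vertex. This is paid for by attaching `q` optional pieces per tree vertex, where 2 ^ q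
-- exceeds D, so a density polynomial in log D is enough when degrees are at most D. The graphs of
-- matched pairs are not subgraphs of G, so the absence of K_{t,t} says nothing about them. Their
-- bicliques are excluded by counting again: a biclique on 2 s vertices has degrees at most 2 s, and
-- its density of order s is far above log s. The induction passes from chunks of size L to size 2 L
-- + 1 without bound on L, so thresholds for all L have to be fixed at once, each depending on a
-- later one. This is consistent: the ratio `y` between S and Q must exceed a power of the threshold
-- for 2 L + 1, but the threshold for L has to dominate only log y, in which that later threshold
-- appears through its logarithm.

Subset : ℕ → Set
Subset N = Fin N → Bool

infix 4 _∈_ _⊆_
_∈_ : ∀ {N} → Fin N → Subset N → Set
v ∈ S = S v ≡ true

_⊆_ : ∀ {N} → Subset N → Subset N → Set
S ⊆ T = ∀ v → v ∈ S → v ∈ T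

infixr 6 _∩_ _∖_ _∪_
_∩_ _∖_ _∪_ : ∀ {N} → Subset N → Subset N → Subset N
(S ∩ T) v = S v ∧ T v
(S ∖ T) v = S v ∧ not (T v)
(S ∪ T) v = S v ∨ T v

∧-intro : ∀ {a b} → a ≡ true → b ≡ true → a ∧ b ≡ true
∧-intro refl refl = refl

∧-elimˡ : ∀ {a b} → a ∧ b ≡ true → a ≡ true
∧-elimˡ {true} _ = refl

∧-elimʳ : ∀ {a b} → a ∧ b ≡ true → b ≡ true
∧-elimʳ {true} p = p

not-intro : ∀ {a} → ¬ (a ≡ true) → not a ≡ true
not-intro {true}  p = ⊥-elim (p refl)
not-intro {false} _ = refl

not-elim : ∀ {a} → not a ≡ true → ¬ (a ≡ true)
not-elim {false} _ ()

¬true⇒false : ∀ {a} → ¬ (a ≡ true) → a ≡ false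
¬true⇒false {true}  p = ⊥-elim (p refl)
¬true⇒false {false} _ = refl

true≢false : ∀ {a} → a ≡ true → a ≡ false → ⊥
true≢false refl ()

does-true : ∀ {p} {P : Set p} (d : Dec P) → P → does d ≡ true
does-true (yes _) _ = refl
does-true (no ¬p) p = ⊥-elim (¬p p)

does-elim : ∀ {p} {P : Set p} (d : Dec P) → does d ≡ true → P
does-elim (yes p) _ = p

_∈?_ : ∀ {N} (v : Fin N) (S : Subset N) → Dec (v ∈ S)
v ∈? S = S v ≟ᵇ true
  where open import Data.Bool.Properties using () renaming (_≟_ to _≟ᵇ_)

bit : Bool → ℕ
bit true  = 1
bit false = 0

bit-∧ : ∀ a b → bit (a ∧ b) ≡ bit a * bit b
bit-∧ true  b = sym (+-identityʳ (bit b))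
bit-∧ false b = refl

bit-mono : ∀ {a b} → (a ≡ true → b ≡ true) → bit a ≤ bit b
bit-mono {false} _ = z≤n
bit-mono {true} {b} p rewrite p refl = ≤-refl

bit-split : ∀ a b → bit a ≡ bit (a ∧ b) + bit (a ∧ not b)
bit-split false b     = refl
bit-split true  true  = refl
bit-split true  false = refl

# : ∀ {N} → Subset N → ℕ
# S = sum (bit ∘ S)

sum-mono : ∀ {n} {f g : Fin n → ℕ} → (∀ i → f i ≤ g i) → sum f ≤ sum g
sum-mono {zero}  _ = z≤n
sum-mono {suc n} p = +-mono-≤ (p zero) (sum-mono (p ∘ suc))

sum-mono-< : ∀ {n} {f g : Fin n → ℕ} → (∀ i → f i ≤ g i) → ∀ i → f i < g i → sum f < sum g
sum-mono-< p zero    q = +-mono-<-≤ q (sum-mono (p ∘ suc))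
sum-mono-< p (suc i) q = +-mono-≤-< (p zero) (sum-mono-< (p ∘ suc) i q)

sum-0 : ∀ {n} {f : Fin n → ℕ} → (∀ i → f i ≡ 0) → sum f ≡ 0
sum-0 {zero}  _ = refl
sum-0 {suc n} p = cong₂ _+_ (p zero) (sum-0 (p ∘ suc))

term≤sum : ∀ {n} (f : Fin n → ℕ) i → f i ≤ sum f
term≤sum f zero    = m≤m+n _ _
term≤sum f (suc i) = ≤-trans (term≤sum (f ∘ suc) i) (m≤n+m _ (f zero))

sum-const : ∀ n k → sum {n} (λ _ → k) ≡ n * k
sum-const zero    k = refl
sum-const (suc n) k = cong (k +_) (sum-const n k)

sum-*ˡ : ∀ {n} k (f : Fin n → ℕ) → sum (λ i → k * f i) ≡ k * sum f
sum-*ˡ k f = sym (*-distribˡ-sum k f)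

sum-*ʳ : ∀ {n} k (f : Fin n → ℕ) → sum (λ i → f i * k) ≡ sum f * k
sum-*ʳ k f = trans (sum-cong-≗ (λ i → *-comm (f i) k)) (trans (sum-*ˡ k f) (*-comm k _))

δ : ∀ {N} → Fin N → Subset N
δ v u = does (v ≟ᶠ u)

∈δ : ∀ {N} (v : Fin N) → v ∈ δ v
∈δ v = does-true (v ≟ᶠ v) refl

∈δ⇒≡ : ∀ {N} {v u : Fin N} → u ∈ δ v → v ≡ u
∈δ⇒≡ {v = v} {u} = does-elim (v ≟ᶠ u)

δ-suc : ∀ {N} (v u : Fin N) → δ (suc v) (suc u) ≡ δ v u
δ-suc v u with v ≟ᶠ u
... | yes _ = refl
... | no _  = refl

sum-δ : ∀ {N} (v : Fin N) (f : Fin N → ℕ) → sum (λ u → bit (δ v u) * f u) ≡ f v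
sum-δ zero    f = trans (cong₂ _+_ (+-identityʳ (f zero)) (sum-0 {f = λ u → bit (δ zero (suc u)) * f (suc u)} (λ _ → refl))) (+-identityʳ _)
sum-δ (suc v) f = trans (sum-cong-≗ (λ u → cong (λ b → bit b * f (suc u)) (δ-suc v u))) (sum-δ v (f ∘ suc))

#-mono : ∀ {N} {S T : Subset N} → S ⊆ T → # S ≤ # T
#-mono p = sum-mono (λ v → bit-mono (p v))

#-cong : ∀ {N} {S T : Subset N} → (∀ v → S v ≡ T v) → # S ≡ # T
#-cong p = sum-cong-≗ (λ v → cong bit (p v))

#-mono-< : ∀ {N} {S T : Subset N} → S ⊆ T → ∀ v → v ∈ T → ¬ (v ∈ S) → # S < # T
#-mono-< {S = S} {T} p v v∈T v∉S = sum-mono-< (λ u → bit-mono (p u)) v lt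
  where lt : bit (S v) < bit (T v)
        lt rewrite v∈T | ¬true⇒false v∉S = ≤-refl

#-pos : ∀ {N} (S : Subset N) v → v ∈ S → 0 < # S
#-pos S v v∈S = ≤-trans (≤-reflexive (sym (cong bit v∈S))) (term≤sum (bit ∘ S) v)

#-δ : ∀ {N} (v : Fin N) → # (δ v) ≡ 1
#-δ v = trans (sum-cong-≗ (λ u → sym (*-identityʳ (bit (δ v u))))) (sum-δ v (λ _ → 1))

#-split : ∀ {N} (S Q : Subset N) → # S ≡ # (S ∩ Q) + # (S ∖ Q)
#-split S Q = trans (sum-cong-≗ (λ v → bit-split (S v) (Q v))) (∑-distrib-+ (bit ∘ (S ∩ Q)) (bit ∘ (S ∖ Q)))

⊆-∪ˡ : ∀ {N} (S T : Subset N) → S ⊆ (S ∪ T)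
⊆-∪ˡ S T v p = cong (_∨ T v) p

⊆-∪ʳ : ∀ {N} (S T : Subset N) → T ⊆ (S ∪ T)
⊆-∪ʳ S T v p = trans (∨-comm (S v) (T v)) (cong (_∨ S v) p)

∪-elim : ∀ {N} (S T : Subset N) {v} → v ∈ (S ∪ T) → v ∈ S ⊎ v ∈ T
∪-elim S T {v} p with S v
... | true  = inj₁ refl
... | false = inj₂ p

#-∪ : ∀ {N} (S T : Subset N) → # (S ∪ T) ≤ # S + # T
#-∪ S T = ≤-trans (sum-mono λ v → or (S v) (T v)) (≤-reflexive (∑-distrib-+ (bit ∘ S) (bit ∘ T)))
  where or : ∀ a b → bit (a ∨ b) ≤ bit a + bit b
        or true  b = s≤s z≤n
        or false b = ≤-refl

pick : ∀ {n} (f : Fin n → ℕ) → Fin (sum f) → Σ (Fin n) (Fin ∘ f)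
pick {suc n} f i with splitAt (f zero) i
... | inj₁ j = zero , j
... | inj₂ j = suc (proj₁ (pick (f ∘ suc) j)) , proj₂ (pick (f ∘ suc) j)

splitAt-injective : ∀ m {n} {i j : Fin (m + n)} → splitAt m i ≡ splitAt m j → i ≡ j
splitAt-injective m {n} {i} {j} eq = trans (sym (join-splitAt m n i)) (trans (cong (join m n) eq) (join-splitAt m n j))

pick-injective : ∀ {n} (f : Fin n → ℕ) → Injective _≡_ _≡_ (pick f)
pick-injective {suc n} f {i} {j} eq with splitAt (f zero) i in ei | splitAt (f zero) j in ej
pick-injective {suc n} f {i} {j} refl | inj₁ a | inj₁ .a = splitAt-injective (f zero) (trans ei (sym ej))
... | inj₂ a | inj₂ b = splitAt-injective (f zero) (trans ei (trans (cong inj₂ (pick-injective (f ∘ suc) (down eq))) (sym ej)))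
  where down : ∀ {x y : Σ (Fin n) (Fin ∘ f ∘ suc)} → _≡_ {A = Σ (Fin (suc n)) (Fin ∘ f)} (suc (proj₁ x) , proj₂ x) (suc (proj₁ y) , proj₂ y) → x ≡ y
        down refl = refl

Fin-bit : ∀ {b} → Fin (bit b) → b ≡ true
Fin-bit {true} _ = refl

Fin-bit-unique : ∀ {b} (x y : Fin (bit b)) → x ≡ y
Fin-bit-unique {true} zero zero = refl

enum : ∀ {N} (S : Subset N) → Fin (# S) → Fin N
enum S i = proj₁ (pick (bit ∘ S) i)

enum-∈ : ∀ {N} (S : Subset N) i → enum S i ∈ S
enum-∈ S i = Fin-bit (proj₂ (pick (bit ∘ S) i))

enum-injective : ∀ {N} (S : Subset N) → Injective _≡_ _≡_ (enum S)
enum-injective S eq = pick-injective (bit ∘ S) (lift eq)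
  where lift : ∀ {x y : Σ (Fin _) (Fin ∘ bit ∘ S)} → proj₁ x ≡ proj₁ y → x ≡ y
        lift {x} {y} refl = cong (proj₁ x ,_) (Fin-bit-unique (proj₂ x) (proj₂ y))

enum₂ : ∀ {N K} (R : Fin N → Subset K) → Fin (sum (# ∘ R)) → Fin N × Fin K
enum₂ R i = let x , j = pick (# ∘ R) i in x , enum (R x) j

enum₂-∈ : ∀ {N K} (R : Fin N → Subset K) i → uncurry R (enum₂ R i) ≡ true
enum₂-∈ R i = enum-∈ (R _) _

enum₂-injective : ∀ {N K} (R : Fin N → Subset K) → Injective _≡_ _≡_ (enum₂ R)
enum₂-injective R eq = pick-injective (# ∘ R) (lift eq)
  where lift : ∀ {x y : Σ (Fin _) (Fin ∘ # ∘ R)} → _≡_ {A = Fin _ × Fin _} (proj₁ x , enum (R _) (proj₂ x)) (proj₁ y , enum (R _) (proj₂ y)) → x ≡ y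
        lift {x , i} {y , j} p with refl ← proj₁ (,-injective p) = cong (x ,_) (enum-injective (R x) (proj₂ (,-injective p)))

#-pos⁻¹ : ∀ {N} (S : Subset N) → 0 < # S → ∃ λ v → v ∈ S
#-pos⁻¹ S p = enum S (fromℕ< p) , enum-∈ S _

rank : ∀ {N} → Subset N → Fin N → ℕ
rank S zero    = 0
rank S (suc v) = bit (S zero) + rank (S ∘ suc) v

rank< : ∀ {N} (S : Subset N) v → v ∈ S → rank S v < # S
rank< S zero    p rewrite p = s≤s z≤n
rank< S (suc v) p = +-monoʳ-< (bit (S zero)) (rank< (S ∘ suc) v p)

rank-injective : ∀ {N} (S : Subset N) u v → u ∈ S → v ∈ S → rank S u ≡ rank S v → u ≡ v
rank-injective S zero    zero    p q eq = refl
rank-injective S zero    (suc v) p q eq rewrite p with () ← eq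
rank-injective S (suc u) zero    p q eq rewrite q with () ← eq
rank-injective S (suc u) (suc v) p q eq = cong suc (rank-injective (S ∘ suc) u v p q (+-cancelˡ-≡ (bit (S zero)) _ _ eq))

#-δ-injective : ∀ {N s} {a : Fin s → Fin N} → Injective _≡_ _≡_ a → ∀ v → # (λ i → δ (a i) v) ≤ 1
#-δ-injective {a = a} inj v with any? (λ i → a i ≟ᶠ v)
... | yes (i , refl) = ≤-trans (#-mono {T = δ i} (λ j p → does-true (i ≟ᶠ j) (sym (inj (∈δ⇒≡ p))))) (≤-reflexive (#-δ i))
... | no ¬p = ≤-trans (≤-reflexive (sum-0 λ i → cong bit (¬true⇒false λ q → ¬p (i , ∈δ⇒≡ q)))) z≤n

sum-injective-≤ : ∀ {N s} {a : Fin s → Fin N} → Injective _≡_ _≡_ a → ∀ f → sum (f ∘ a) ≤ sum f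
sum-injective-≤ {N} {s} {a} inj f = begin
  sum (f ∘ a) ≡⟨ sum-cong-≗ (λ i → sym (sum-δ (a i) f)) ⟩
  sum (λ i → sum (λ v → bit (δ (a i) v) * f v)) ≡⟨ ∑-comm (λ i v → bit (δ (a i) v) * f v) ⟩
  sum (λ v → sum (λ i → bit (δ (a i) v) * f v)) ≡⟨ sum-cong-≗ (λ v → sum-*ʳ (f v) (λ i → bit (δ (a i) v))) ⟩
  sum (λ v → # (λ i → δ (a i) v) * f v) ≤⟨ sum-mono (λ v → *-monoˡ-≤ (f v) (#-δ-injective inj v)) ⟩
  sum (λ v → 1 * f v) ≡⟨ sum-cong-≗ (λ v → *-identityˡ (f v)) ⟩
  sum f ∎
  where open ≤-Reasoning

image : ∀ {N s} → (Fin s → Fin N) → Subset N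
image a v = does (any? (λ i → a i ≟ᶠ v))

image-∈ : ∀ {N s} (a : Fin s → Fin N) i → a i ∈ image a
image-∈ a i = does-true (any? _) (i , refl)

image-∈⁻¹ : ∀ {N s} (a : Fin s → Fin N) {v} → v ∈ image a → ∃ λ i → a i ≡ v
image-∈⁻¹ a = does-elim (any? _)

#-image : ∀ {N s} (a : Fin s → Fin N) → # (image a) ≤ s
#-image {N} {s} a = injective⇒≤ {f = λ j → proj₁ (pre j)} λ {j} {k} eq →
  enum-injective (image a) (trans (sym (proj₂ (pre j))) (trans (cong a eq) (proj₂ (pre k))))
  where pre : ∀ j → ∃ λ i → a i ≡ enum (image a) j
        pre j = image-∈⁻¹ a (enum-∈ (image a) j)

sumOn : ∀ {N} → Subset N → (Fin N → ℕ) → ℕ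
sumOn S f = sum (λ v → bit (S v) * f v)

sumOn-mono : ∀ {N} (S : Subset N) {f g} → (∀ v → v ∈ S → f v ≤ g v) → sumOn S f ≤ sumOn S g
sumOn-mono S {f} {g} p = sum-mono λ v → go v (S v) refl
  where go : ∀ v b → S v ≡ b → bit b * f v ≤ bit b * g v
        go v true  e = *-monoʳ-≤ 1 (p v e)
        go v false e = z≤n

sumOn-⊆ : ∀ {N} {S T : Subset N} f → S ⊆ T → sumOn S f ≤ sumOn T f
sumOn-⊆ f p = sum-mono λ v → *-monoˡ-≤ (f v) (bit-mono (p v))

sumOn-const : ∀ {N} (S : Subset N) k → sumOn S (λ _ → k) ≡ # S * k
sumOn-const S k = sum-*ʳ k (bit ∘ S)

sumOn-upper : ∀ {N} (S : Subset N) {f} k → (∀ v → v ∈ S → f v ≤ k) → sumOn S f ≤ # S * k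
sumOn-upper S k p = ≤-trans (sumOn-mono S p) (≤-reflexive (sumOn-const S k))

sumOn-lower : ∀ {N} (S : Subset N) {f} k → (∀ v → v ∈ S → k ≤ f v) → # S * k ≤ sumOn S f
sumOn-lower S k p = ≤-trans (≤-reflexive (sym (sumOn-const S k))) (sumOn-mono S p)

sumOn-split : ∀ {N} (S Q : Subset N) f → sumOn S f ≡ sumOn (S ∩ Q) f + sumOn (S ∖ Q) f
sumOn-split S Q f = trans
  (sum-cong-≗ λ v → trans (cong (_* f v) (bit-split (S v) (Q v))) (*-distribʳ-+ (f v) (bit (S v ∧ Q v)) _))
  (∑-distrib-+ (λ v → bit (S v ∧ Q v) * f v) _)

sumOn-+ : ∀ {N} (S : Subset N) f g → sumOn S (λ v → f v + g v) ≡ sumOn S f + sumOn S g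
sumOn-+ S f g = trans (sum-cong-≗ λ v → *-distribˡ-+ (bit (S v)) (f v) (g v)) (∑-distrib-+ (λ v → bit (S v) * f v) _)

sumOn-average : ∀ {N} (S : Subset N) {f} k → 0 < # S → sumOn S f < # S * k → ∃ λ v → v ∈ S × f v < k
sumOn-average S {f} k pos lt with any? (λ v → dec v)
  where
    dec : ∀ v → Dec (v ∈ S × f v < k)
    dec v with v ∈? S | f v <? k
    ... | yes p | yes q = yes (p , q)
    ... | yes p | no ¬q = no (¬q ∘ proj₂)
    ... | no ¬p | _     = no (¬p ∘ proj₁)
... | yes r = r
... | no ¬r = ⊥-elim (<⇒≱ lt (sumOn-lower S k λ v v∈S → ≮⇒≥ λ q → ¬r (v , v∈S , q)))

-- Counting labelled graphs

-- A Lehmer code: the quotient is the image of `zero`, the remainder encodes the permutation of the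
-- other points.
perm : ∀ n → Fin (n !) → Permutation′ n
perm zero    _ = Data.Fin.Permutation.id
  where import Data.Fin.Permutation
perm (suc n) i = let q , r = remQuot {suc n} (n !) i in insert zero q (perm n r)

remQuot-injective : ∀ {m} n {i j : Fin (m * n)} → remQuot {m} n i ≡ remQuot {m} n j → i ≡ j
remQuot-injective {m} n {i} {j} eq =
  trans (sym (combine-remQuot {m} n i)) (trans (cong (uncurry combine) eq) (combine-remQuot {m} n j))

perm-injective : ∀ n {i j} → (∀ a → perm n i ⟨$⟩ʳ a ≡ perm n j ⟨$⟩ʳ a) → i ≡ j
perm-injective zero    {zero} {zero} _ = refl
perm-injective (suc n) {i} {j} eq = remQuot-injective {suc n} (n !) (cong₂ _,_ q≡ (perm-injective n r≡))
  where
    qi = proj₁ (remQuot {suc n} (n !) i)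
    qj = proj₁ (remQuot {suc n} (n !) j)
    πi = perm n (proj₂ (remQuot {suc n} (n !) i))
    πj = perm n (proj₂ (remQuot {suc n} (n !) j))
    q≡ : qi ≡ qj
    q≡ = eq zero
    r≡ : ∀ a → πi ⟨$⟩ʳ a ≡ πj ⟨$⟩ʳ a
    r≡ a = punchIn-injective qj _ _ (begin
      punchIn qj (πi ⟨$⟩ʳ a) ≡⟨ cong (λ q → punchIn q (πi ⟨$⟩ʳ a)) q≡ ⟨
      punchIn qi (πi ⟨$⟩ʳ a) ≡⟨ insert-punchIn zero qi πi a ⟨
      insert zero qi πi ⟨$⟩ʳ suc a ≡⟨ eq (suc a) ⟩
      insert zero qj πj ⟨$⟩ʳ suc a ≡⟨ insert-punchIn zero qj πj a ⟩
      punchIn qj (πj ⟨$⟩ʳ a) ∎)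
      where open ≡-Reasoning

-- Each fibre is injected into Fin z by a code that may depend on a reference element of the fibre.
fibre-count : ∀ {a b z} (f : Fin a → Fin b) (enc : Fin a → Fin a → Fin z) →
  (∀ x₀ x₁ x₂ → f x₁ ≡ f x₀ → f x₂ ≡ f x₀ → enc x₀ x₁ ≡ enc x₀ x₂ → x₁ ≡ x₂) → a ≤ b * z
fibre-count {a} {b} {z} f enc enc-inj = injective⇒≤ {f = g} g-inj
  where
    h : Fin b → Fin a → Fin z
    h y x with any? (λ x₀ → f x₀ ≟ᶠ y)
    ... | yes (x₀ , _) = enc x₀ x
    ... | no _         = enc x x
    g : Fin a → Fin (b * z)
    g x = combine (f x) (h (f x) x)
    h-inj : ∀ y x₁ x₂ → f x₁ ≡ y → f x₂ ≡ y → h y x₁ ≡ h y x₂ → x₁ ≡ x₂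
    h-inj y x₁ x₂ p₁ p₂ eq with any? (λ x₀ → f x₀ ≟ᶠ y)
    ... | yes (x₀ , p₀) = enc-inj x₀ x₁ x₂ (trans p₁ (sym p₀)) (trans p₂ (sym p₀)) eq
    ... | no ¬p = ⊥-elim (¬p (x₁ , p₁))
    g-inj : Injective _≡_ _≡_ g
    g-inj {x₁} {x₂} eq with e₁ , e₂ ← combine-injective (f x₁) _ (f x₂) _ eq =
      h-inj (f x₂) x₁ x₂ e₁ refl (trans (cong (λ y → h y x₁) (sym e₁)) e₂)

funToFin-cong : ∀ {m n} {f g : Fin m → Fin n} → (∀ i → f i ≡ g i) → funToFin f ≡ funToFin g
funToFin-cong {zero}  _ = refl
funToFin-cong {suc m} p = cong₂ combine (p zero) (funToFin-cong (p ∘ suc))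

finToFun-injective : ∀ {m n} {i j : Fin (n ^ m)} → (∀ a → finToFun {n} {m} i a ≡ finToFun j a) → i ≡ j
finToFun-injective {m} {n} {i} {j} p =
  trans (sym (funToFin-finToFin {m} {n} i)) (trans (funToFin-cong p) (funToFin-finToFin {m} {n} j))

funToFin-injective : ∀ {m n} {f g : Fin m → Fin n} → funToFin f ≡ funToFin g → ∀ i → f i ≡ g i
funToFin-injective {f = f} {g} eq i =
  trans (sym (finToFun-funToFin f i)) (trans (cong (λ x → finToFun x i) eq) (finToFun-funToFin g i))

^-distribʳ-* : ∀ n a b → (a * b) ^ n ≡ a ^ n * b ^ n
^-distribʳ-* zero    a b = refl
^-distribʳ-* (suc n) a b = trans (cong (a * b *_) (^-distribʳ-* n a b)) (swap a b (a ^ n) (b ^ n))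
  where swap : ∀ a b x y → a * b * (x * y) ≡ a * x * (b * y)
        swap = solve-∀

record ColourIso {N M C : ℕ} (G : Graph N) (col : Fin M → Fin C) (v w : Fin M → Fin N) (ψ : Fin M → Fin M) : Set where
  field
    inj     : Injective _≡_ _≡_ ψ
    colours : ∀ a → col (ψ a) ≡ col a
    edges   : ∀ a b → adj G (v a) (v b) ≡ adj G (w (ψ a)) (w (ψ b))

-- The graphs induced by the maps v χ ∘ π, for all χ and all permutations π, are counted together
-- with the colouring col ∘ π; two of them coincide only if they differ by a coloured isomorphism.
counting : (X : GraphFamily) → Hereditary X → ∀ c → (∀ n → CardX≤ X n (n ! * c ^ n)) →
  ∀ {N} (G : Graph N) → X N G → ∀ {M k m C Z} (v : (Fin m → Fin k) → Fin M → Fin N) →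
  (∀ χ χ′ i i′ → v χ i ≡ v χ′ i′ → i ≡ i′) →
  (∀ χ χ′ → (∀ i → v χ i ≡ v χ′ i) → ∀ j → χ j ≡ χ′ j) →
  (col : Fin M → Fin C) (code : (χ₀ χ₁ : Fin m → Fin k) → (Fin M → Fin M) → Fin Z) →
  (∀ χ₀ χ₁ ψ₁ χ₂ ψ₂ → ColourIso G col (v χ₀) (v χ₁) ψ₁ → ColourIso G col (v χ₀) (v χ₂) ψ₂ →
    code χ₀ χ₁ ψ₁ ≡ code χ₀ χ₂ ψ₂ → ∀ a → v χ₁ (ψ₁ a) ≡ v χ₂ (ψ₂ a)) →
  k ^ m ≤ (c * C) ^ M * Z
counting X her c small {N} G G∈X {M} {k} {m} {C} {Z} v v-inj v-χ col code rigid =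
  -- The M ! orderings of each choice cancel the factor M ! that smallness allows.
  *-cancelʳ-≤ (k ^ m) ((c * C) ^ M * Z) (M !) ⦃ M !≢0 ⦄ (≤-trans total (≤-reflexive rearrange))
  where
    χ : Fin (k ^ m * M !) → Fin m → Fin k
    χ x = finToFun (proj₁ (remQuot {k ^ m} (M !) x))
    π : Fin (k ^ m * M !) → Permutation′ M
    π x = perm M (proj₂ (remQuot {k ^ m} (M !) x))
    w : ∀ x → Fin M → Fin N
    w x a = v (χ x) (π x ⟨$⟩ʳ a)
    π-inj : ∀ (ρ : Permutation′ M) → Injective _≡_ _≡_ (ρ ⟨$⟩ʳ_)
    π-inj ρ eq = trans (sym (inverseˡ ρ)) (trans (cong (ρ ⟨$⟩ˡ_) eq) (inverseˡ ρ))
    w-inj : ∀ x → Injective _≡_ _≡_ (w x)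
    w-inj x eq = π-inj (π x) (v-inj (χ x) (χ x) _ _ eq)
    member : ∀ x → Σ (Graph M) (X M)
    member x = induced G (w x) , her G (w x) (w-inj x) G∈X
    f : Fin (k ^ m * M !) → Fin ((M ! * c ^ M) * C ^ M)
    f x = combine (proj₁ (small M) (member x)) (funToFin (λ a → col (π x ⟨$⟩ʳ a)))
    ψ : ∀ x₀ x → Fin M → Fin M
    ψ x₀ x a = π x ⟨$⟩ʳ (π x₀ ⟨$⟩ˡ a)
    iso : ∀ x₀ x → f x ≡ f x₀ → ColourIso G col (v (χ x₀)) (v (χ x)) (ψ x₀ x)
    iso x₀ x eq with e₁ , e₂ ← combine-injective (proj₁ (small M) (member x)) _ _ _ eq = record
      { inj = λ p → trans (sym (inverseʳ (π x₀))) (trans (cong (π x₀ ⟨$⟩ʳ_) (π-inj (π x) p)) (inverseʳ (π x₀)))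
      ; colours = λ a → trans (funToFin-injective e₂ (π x₀ ⟨$⟩ˡ a)) (cong col (inverseʳ (π x₀)))
      ; edges = λ a b → sym (trans (proj₂ (small M) (member x) (member x₀) e₁ (π x₀ ⟨$⟩ˡ a) (π x₀ ⟨$⟩ˡ b))
          (cong₂ (λ i j → adj G (v (χ x₀) i) (v (χ x₀) j)) (inverseʳ (π x₀)) (inverseʳ (π x₀)))) }
    distinct : ∀ x₀ x₁ x₂ → f x₁ ≡ f x₀ → f x₂ ≡ f x₀ →
      code (χ x₀) (χ x₁) (ψ x₀ x₁) ≡ code (χ x₀) (χ x₂) (ψ x₀ x₂) → x₁ ≡ x₂
    distinct x₀ x₁ x₂ p₁ p₂ eq = remQuot-injective {k ^ m} (M !)
      (cong₂ _,_ (finToFun-injective {m} {k} (v-χ _ _ λ i → trans (cong (v (χ x₁)) (sym (inverseʳ (π x₁))))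
                    (trans (same _) (cong (v (χ x₂)) (trans (sym (π≡ _)) (inverseʳ (π x₁)))))))
                 (perm-injective M π≡))
      where
        -- Undoing the reference permutation turns rigidity into equality of the injections `w`. As
        -- `v` is injective even across different choices, the permutations agree, and then the
        -- choices do.
        same : ∀ b → w x₁ b ≡ w x₂ b
        same b = subst (λ b → w x₁ b ≡ w x₂ b) (inverseˡ (π x₀))
          (rigid (χ x₀) (χ x₁) _ (χ x₂) _ (iso x₀ x₁ p₁) (iso x₀ x₂ p₂) eq (π x₀ ⟨$⟩ʳ b))
        π≡ : ∀ b → π x₁ ⟨$⟩ʳ b ≡ π x₂ ⟨$⟩ʳ b
        π≡ b = v-inj _ _ _ _ (same b)
    total : k ^ m * M ! ≤ ((M ! * c ^ M) * C ^ M) * Z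
    total = fibre-count f (λ x₀ x → code (χ x₀) (χ x) (ψ x₀ x)) distinct
    rearrange : ((M ! * c ^ M) * C ^ M) * Z ≡ (c * C) ^ M * Z * M !
    rearrange = begin
      ((M ! * c ^ M) * C ^ M) * Z ≡⟨ cong (_* Z) (trans (*-assoc (M !) _ _) (*-comm (M !) _)) ⟩
      (c ^ M * C ^ M) * M ! * Z ≡⟨ trans (*-assoc (c ^ M * C ^ M) _ _) (trans (cong (c ^ M * C ^ M *_) (*-comm (M !) Z)) (sym (*-assoc (c ^ M * C ^ M) Z _))) ⟩
      (c ^ M * C ^ M) * Z * M ! ≡⟨ cong (λ y → y * Z * M !) (sym (^-distribʳ-* M c C)) ⟩
      (c * C) ^ M * Z * M ! ∎
      where open ≡-Reasoning

-- Density, orientations and trees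

⊆-∩ˡ : ∀ {N} (S Q : Subset N) → (S ∩ Q) ⊆ S
⊆-∩ˡ S Q v = ∧-elimˡ

⊆-∖ : ∀ {N} (S Q : Subset N) → (S ∖ Q) ⊆ S
⊆-∖ S Q v = ∧-elimˡ

deg : ∀ {N} → Graph N → Subset N → Fin N → ℕ
deg A T u = # (T ∩ adj A u)

links : ∀ {N} → Graph N → Subset N → Subset N → ℕ
links A S T = sumOn S (deg A T)

-- The number of ordered adjacent pairs, that is, twice the number of edges.
E : ∀ {N} → Graph N → Subset N → ℕ
E A S = links A S S

deg-mono : ∀ {N} (A : Graph N) {S T : Subset N} → S ⊆ T → ∀ u → deg A S u ≤ deg A T u
deg-mono A {S} p u = #-mono λ v q → ∧-intro (p v (∧-elimˡ q)) (∧-elimʳ {S v} q)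

deg≤# : ∀ {N} (A : Graph N) (S : Subset N) u → deg A S u ≤ # S
deg≤# A S u = #-mono (⊆-∩ˡ S (adj A u))

deg-split : ∀ {N} (A : Graph N) (T Q : Subset N) u → deg A T u ≡ deg A (T ∩ Q) u + deg A (T ∖ Q) u
deg-split A T Q u = trans (#-split (T ∩ adj A u) Q)
  (cong₂ _+_ (#-cong λ v → swap (T v) (adj A u v) (Q v)) (#-cong λ v → swap (T v) (adj A u v) (not (Q v))))
  where swap : ∀ a b c → (a ∧ b) ∧ c ≡ (a ∧ c) ∧ b
        swap a b c = trans (∧-assoc a b c) (trans (cong (a ∧_) (∧-comm b c)) (sym (∧-assoc a c b)))

links-sum : ∀ {N} (A : Graph N) (S T : Subset N) →
  links A S T ≡ sum (λ u → sum (λ v → bit (S u) * (bit (T v) * bit (adj A u v))))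
links-sum A S T = sum-cong-≗ λ u → trans (sym (sum-*ˡ (bit (S u)) (λ v → bit (T v ∧ adj A u v))))
  (sum-cong-≗ λ v → cong (bit (S u) *_) (bit-∧ (T v) (adj A u v)))

links-sym : ∀ {N} (A : Graph N) (S T : Subset N) → links A S T ≡ links A T S
links-sym A S T = begin
  links A S T ≡⟨ links-sum A S T ⟩
  sum (λ u → sum (λ v → bit (S u) * (bit (T v) * bit (adj A u v)))) ≡⟨ ∑-comm (λ u v → bit (S u) * (bit (T v) * bit (adj A u v))) ⟩
  sum (λ v → sum (λ u → bit (S u) * (bit (T v) * bit (adj A u v)))) ≡⟨ sum-cong-≗ (λ v → sum-cong-≗ λ u → step u v) ⟩
  sum (λ v → sum (λ u → bit (T v) * (bit (S u) * bit (adj A v u)))) ≡⟨ links-sum A T S ⟨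
  links A T S ∎
  where
    open ≡-Reasoning
    swap : ∀ a b c → a * (b * c) ≡ b * (a * c)
    swap = solve-∀
    step : ∀ u v → bit (S u) * (bit (T v) * bit (adj A u v)) ≡ bit (T v) * (bit (S u) * bit (adj A v u))
    step u v = trans (swap (bit (S u)) (bit (T v)) (bit (adj A u v))) (cong (λ b → bit (T v) * (bit (S u) * bit b)) (adj-sym A u v))

links-splitˡ : ∀ {N} (A : Graph N) (S T Q : Subset N) → links A S T ≡ links A (S ∩ Q) T + links A (S ∖ Q) T
links-splitˡ A S T Q = sumOn-split S Q (deg A T)

links-splitʳ : ∀ {N} (A : Graph N) (S T Q : Subset N) → links A S T ≡ links A S (T ∩ Q) + links A S (T ∖ Q)
links-splitʳ A S T Q = trans (sum-cong-≗ λ u → cong (bit (S u) *_) (deg-split A T Q u)) (sumOn-+ S (deg A (T ∩ Q)) (deg A (T ∖ Q)))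

links-mono : ∀ {N} (A : Graph N) {S S′ T T′ : Subset N} → S ⊆ S′ → T ⊆ T′ → links A S T ≤ links A S′ T′
links-mono A {S} {S′} {T} {T′} p q = ≤-trans (sumOn-mono S λ v _ → deg-mono A q v) (sumOn-⊆ (deg A T′) p)

E-split : ∀ {N} (A : Graph N) (S Q : Subset N) → E A S ≡ E A (S ∩ Q) + E A (S ∖ Q) + 2 * links A (S ∩ Q) (S ∖ Q)
E-split A S Q = begin
  E A S ≡⟨ links-splitˡ A S S Q ⟩
  links A I S + links A O S ≡⟨ cong₂ _+_ (links-splitʳ A I S Q) (links-splitʳ A O S Q) ⟩
  (E A I + links A I O) + (links A O I + E A O) ≡⟨ cong (λ x → (E A I + links A I O) + (x + E A O)) (links-sym A O I) ⟩
  (E A I + links A I O) + (links A I O + E A O) ≡⟨ arrange (E A I) (links A I O) (E A O) ⟩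
  E A I + E A O + 2 * links A I O ∎
  where
    open ≡-Reasoning
    I = S ∩ Q
    O = S ∖ Q
    arrange : ∀ a b c → (a + b) + (b + c) ≡ a + c + 2 * b
    arrange = solve-∀

E-empty : ∀ {N} (A : Graph N) (S : Subset N) → # S ≡ 0 → E A S ≡ 0
E-empty A S p = n≤0⇒n≡0 (≤-trans (sumOn-upper S _ λ v _ → deg≤# A S v) (≤-reflexive (cong (_* # S) p)))

sparse-≤ : ∀ {N} (A : Graph N) k (S : Subset N) → (0 < # S → E A S < k * # S) → E A S ≤ k * # S
sparse-≤ A k S f = cases (# S) refl
  where cases : ∀ n → # S ≡ n → E A S ≤ k * # S
        cases zero    eq = ≤-trans (≤-reflexive (E-empty A S eq)) z≤n
        cases (suc n) eq = <⇒≤ (f (subst (0 <_) (sym eq) (s≤s z≤n)))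

E-remove : ∀ {N} (A : Graph N) (S : Subset N) v → E A S ≤ E A (S ∖ δ v) + 2 * deg A S v
E-remove A S v = begin
  E A S ≡⟨ E-split A S (δ v) ⟩
  E A (S ∩ δ v) + E A (S ∖ δ v) + 2 * links A (S ∩ δ v) (S ∖ δ v) ≤⟨ +-mono-≤ (+-monoˡ-≤ _ (≤-reflexive loops)) (*-monoʳ-≤ 2 nbrs) ⟩
  0 + E A (S ∖ δ v) + 2 * deg A S v ∎
  where
    open ≤-Reasoning
    single : ∀ u → u ∈ (S ∩ δ v) → v ≡ u
    single u p = ∈δ⇒≡ (∧-elimʳ {S u} p)
    loops : E A (S ∩ δ v) ≡ 0
    loops = n≤0⇒n≡0 (≤-trans (sumOn-upper (S ∩ δ v) 0 λ u p → ≤-reflexive (sum-0 λ w → cong bit (¬true⇒false λ q →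
      true≢false (∧-elimʳ {(S ∩ δ v) w} q) (subst (λ x → adj A u x ≡ false) (trans (sym (single u p)) (single w (∧-elimˡ q))) (adj-irrefl A u)))))
      (≤-reflexive (*-zeroʳ (# (S ∩ δ v)))))
    nbrs : links A (S ∩ δ v) (S ∖ δ v) ≤ deg A S v
    nbrs = begin
      links A (S ∩ δ v) (S ∖ δ v) ≤⟨ links-mono A {S ∩ δ v} {δ v} {S ∖ δ v} {S} (λ u p → ∧-elimʳ {S u} p) (⊆-∖ S (δ v)) ⟩
      links A (δ v) S ≡⟨ sum-δ v (deg A S) ⟩
      deg A S v ∎

#-remove : ∀ {N} (S : Subset N) v → v ∈ S → # S ≡ suc (# (S ∖ δ v))
#-remove S v v∈S = trans (#-split S (δ v)) (cong (_+ # (S ∖ δ v)) (trans (#-cong eq) (#-δ v)))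
  where eq : ∀ u → (S ∩ δ v) u ≡ δ v u
        eq u with v ≟ᶠ u
        ... | yes refl = ∧-intro v∈S refl
        ... | no _     = ∧-comm (S u) false

-- Connectedness of the subgraph induced on S, expressed by cuts.
Crossing : ∀ {N} → Graph N → Subset N → Set
Crossing {N} A S = ∀ Q → (∃ λ u → u ∈ (S ∩ Q)) → (∃ λ v → v ∈ (S ∖ Q)) →
  ∃₂ λ u v → u ∈ (S ∩ Q) × v ∈ (S ∖ Q) × adj A u v ≡ true

module MinimalDense {N} (A : Graph N) (ρ : ℕ) (S : Subset N) (dense : ρ * # S ≤ E A S)
  (sparser : ∀ T → T ⊆ S → # T < # S → 0 < # T → E A T < ρ * # T) where

  sparser≤ : ∀ T → T ⊆ S → # T < # S → E A T ≤ ρ * # T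
  sparser≤ T T⊆S lt = sparse-≤ A ρ T (sparser T T⊆S lt)

  removed : ∀ v → v ∈ S → E A (S ∖ δ v) ≤ ρ * # (S ∖ δ v)
  removed v v∈S = sparser≤ (S ∖ δ v) (⊆-∖ S (δ v)) (≤-reflexive (sym (#-remove S v v∈S)))

  -- Deleting `v` leaves density at most ρ, so `v` accounts for at least ρ ordered pairs.
  min-degree : ∀ v → v ∈ S → ρ ≤ 2 * deg A S v
  min-degree v v∈S = +-cancelˡ-≤ (ρ * # (S ∖ δ v)) ρ (2 * deg A S v) (begin
    ρ * # (S ∖ δ v) + ρ ≡⟨ trans (+-comm _ ρ) (sym (*-suc ρ _)) ⟩
    ρ * suc (# (S ∖ δ v)) ≡⟨ cong (ρ *_) (sym (#-remove S v v∈S)) ⟩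
    ρ * # S ≤⟨ dense ⟩
    E A S ≤⟨ E-remove A S v ⟩
    E A (S ∖ δ v) + 2 * deg A S v ≤⟨ +-monoˡ-≤ _ (removed v v∈S) ⟩
    ρ * # (S ∖ δ v) + 2 * deg A S v ∎)
    where open ≤-Reasoning

  -- One deleted vertex carries at most 2 * # S ordered pairs, so minimality keeps the density
  -- within 2 of ρ.
  upper : 0 < # S → E A S ≤ (ρ + 2) * # S
  upper pos with v , v∈S ← #-pos⁻¹ S pos = begin
    E A S ≤⟨ E-remove A S v ⟩
    E A (S ∖ δ v) + 2 * deg A S v ≤⟨ +-mono-≤ (removed v v∈S) (*-monoʳ-≤ 2 (deg≤# A S v)) ⟩
    ρ * # (S ∖ δ v) + 2 * # S ≤⟨ +-monoˡ-≤ _ (*-monoʳ-≤ ρ (#-mono (⊆-∖ S (δ v)))) ⟩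
    ρ * # S + 2 * # S ≡⟨ sym (*-distribʳ-+ (# S) ρ 2) ⟩
    (ρ + 2) * # S ∎
    where open ≤-Reasoning

  -- If no edge crossed the cut, both sides would be sparser than ρ, and so would their union S.
  crossing : Crossing A S
  crossing Q (u₀ , u₀∈) (v₀ , v₀∈) with any? (λ u → any? (λ v → dec u v))
    where
      dec : ∀ u v → Dec (u ∈ (S ∩ Q) × v ∈ (S ∖ Q) × adj A u v ≡ true)
      dec u v with u ∈? (S ∩ Q) | v ∈? (S ∖ Q) | v ∈? adj A u
      ... | yes p | yes q | yes r = yes (p , q , r)
      ... | no ¬p | _     | _     = no (¬p ∘ proj₁)
      ... | _     | no ¬q | _     = no (¬q ∘ proj₁ ∘ proj₂)
      ... | _     | _     | no ¬r = no (¬r ∘ proj₂ ∘ proj₂)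
  ... | yes (u , v , r) = u , v , r
  ... | no none = ⊥-elim (<⇒≱ total dense)
    where
      no-links : links A (S ∩ Q) (S ∖ Q) ≡ 0
      no-links = n≤0⇒n≡0 (≤-trans (sumOn-upper (S ∩ Q) 0 λ u p → ≤-reflexive (sum-0 λ v → cong bit (¬true⇒false λ q →
        none (u , v , p , ∧-elimˡ q , ∧-elimʳ {(S ∖ Q) v} q)))) (≤-reflexive (*-zeroʳ (# (S ∩ Q)))))
      #in : 0 < # (S ∩ Q)
      #in = #-pos (S ∩ Q) u₀ u₀∈
      #out : 0 < # (S ∖ Q)
      #out = #-pos (S ∖ Q) v₀ v₀∈
      in< : # (S ∩ Q) < # S
      in< = subst (# (S ∩ Q) <_) (sym (#-split S Q)) (m<m+n (# (S ∩ Q)) #out)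
      out< : # (S ∖ Q) < # S
      out< = subst (# (S ∖ Q) <_) (sym (#-split S Q)) (m<n+m (# (S ∖ Q)) #in)
      total : E A S < ρ * # S
      total = begin-strict
        E A S ≡⟨ E-split A S Q ⟩
        E A (S ∩ Q) + E A (S ∖ Q) + 2 * links A (S ∩ Q) (S ∖ Q) ≡⟨ trans (cong (λ x → E A (S ∩ Q) + E A (S ∖ Q) + 2 * x) no-links) (+-identityʳ _) ⟩
        E A (S ∩ Q) + E A (S ∖ Q) <⟨ +-mono-< (sparser (S ∩ Q) (⊆-∩ˡ S Q) in< #in) (sparser (S ∖ Q) (⊆-∖ S Q) out< #out) ⟩
        ρ * # (S ∩ Q) + ρ * # (S ∖ Q) ≡⟨ sym (*-distribˡ-+ ρ (# (S ∩ Q)) _) ⟩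
        ρ * (# (S ∩ Q) + # (S ∖ Q)) ≡⟨ cong (ρ *_) (sym (#-split S Q)) ⟩
        ρ * # S ∎
        where open ≤-Reasoning

-- Strong induction on the size of a set: it is enough to refute minimal dense sets.
no-dense : ∀ {N} (A : Graph N) ρ (P : Subset N → Set) → (∀ {S T} → T ⊆ S → P S → P T) →
  (∀ S → P S → 0 < # S → ρ * # S ≤ E A S → (∀ T → T ⊆ S → # T < # S → 0 < # T → E A T < ρ * # T) → ⊥) →
  ∀ S → P S → 0 < # S → E A S < ρ * # S
no-dense A ρ P P-mono refute S PS pos = go (suc (# S)) S ≤-refl PS pos
  where
    go : ∀ n S → # S < n → P S → 0 < # S → E A S < ρ * # S
    go (suc n) S (s≤s lt) PS pos with E A S <? ρ * # S
    ... | yes p = p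
    ... | no ¬p = ⊥-elim (refute S PS pos (≮⇒≥ ¬p) λ T T⊆S T< posT → go n T (≤-trans T< lt) (P-mono T⊆S PS) posT)

low-degree : ∀ {N} (A : Graph N) d (S : Subset N) → 0 < # S → E A S < d * # S → ∃ λ v → v ∈ S × deg A S v < d
low-degree A d S pos lt = sumOn-average S d pos (subst (E A S <_) (*-comm d (# S)) lt)

record Orientation {N} (A : Graph N) (S : Subset N) (d : ℕ) : Set where
  field
    out       : Fin N → Subset N
    covers    : ∀ u v → u ∈ S → v ∈ S → adj A u v ≡ true → v ∈ out u ⊎ u ∈ out v
    out-adj   : ∀ u v → v ∈ out u → adj A u v ≡ true
    outdegree : ∀ u → # (out u) ≤ d

-- A degeneracy order: a vertex of low degree is removed, and its edges are directed from it to the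
-- remaining vertices.
orient : ∀ {N} (A : Graph N) d (S : Subset N) → (∀ T → T ⊆ S → 0 < # T → ∃ λ v → v ∈ T × deg A T v ≤ d) → Orientation A S d
orient {N} A d S low = go (suc (# S)) S ≤-refl λ _ p → p
  where
    go : ∀ n T → # T < n → T ⊆ S → Orientation A T d
    go (suc n) T (s≤s lt) T⊆S with # T in eq
    ... | zero = record
      { out = λ _ _ → false
      ; covers = λ u v p _ _ → ⊥-elim (<⇒≱ (#-pos T u p) (≤-reflexive eq))
      ; out-adj = λ _ _ ()
      ; outdegree = λ u → ≤-trans (≤-reflexive (sum-0 {N} λ _ → refl)) z≤n }
    ... | suc k with v , v∈T , v-low ← low T T⊆S (subst (0 <_) (sym eq) (s≤s z≤n)) =
      record { out = out ; covers = covers ; out-adj = out-adj ; outdegree = outdegree }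
      where
        T′ = T ∖ δ v
        rec : Orientation A T′ d
        rec = go n T′ (≤-trans (≤-reflexive (sym (#-remove T v v∈T))) (≤-trans (≤-reflexive eq) lt)) (λ u p → T⊆S u (∧-elimˡ p))
        module R = Orientation rec
        out : Fin N → Subset N
        out u with v ≟ᶠ u
        ... | yes _ = T ∩ adj A v
        ... | no _  = R.out u
        covers : ∀ u w → u ∈ T → w ∈ T → adj A u w ≡ true → w ∈ out u ⊎ u ∈ out w
        covers u w p q a with v ≟ᶠ u | v ≟ᶠ w
        ... | yes refl | _        = inj₁ (∧-intro q a)
        ... | no _     | yes refl = inj₂ (∧-intro p (trans (adj-sym A v u) a))
        ... | no v≢u   | no v≢w   = R.covers u w (∧-intro p (not-intro (v≢u ∘ ∈δ⇒≡))) (∧-intro q (not-intro (v≢w ∘ ∈δ⇒≡))) a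
        out-adj : ∀ u w → w ∈ out u → adj A u w ≡ true
        out-adj u w p with v ≟ᶠ u
        ... | yes refl = ∧-elimʳ {T w} p
        ... | no _     = R.out-adj u w p
        outdegree : ∀ u → # (out u) ≤ d
        outdegree u with v ≟ᶠ u
        ... | yes _ = v-low
        ... | no _  = R.outdegree u

-- The newest vertex stands first. So the root has the last index `fromℕ n`, and the edge `e` joins
-- `inject₁ e` to a parent of larger index.
data Tree {N} (A : Graph N) : ∀ {n} → Vec (Fin N) (suc n) → Set where
  root : ∀ v → Tree A (v ∷ [])
  grow : ∀ {n} {vs : Vec (Fin N) (suc n)} → Tree A vs → ∀ v i → (∀ j → lookup vs j ≢ v) → adj A (lookup vs i) v ≡ true → Tree A (v ∷ vs)

tree-injective : ∀ {N} {A : Graph N} {n} {vs : Vec (Fin N) (suc n)} → Tree A vs → Injective _≡_ _≡_ (lookup vs)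
tree-injective t {zero} {zero} eq = refl
tree-injective (root v) {zero} {suc ()} eq
tree-injective (grow t v i fresh a) {zero} {suc j} eq = ⊥-elim (fresh j (sym eq))
tree-injective (root v) {suc ()} eq
tree-injective (grow t v i fresh a) {suc k} {zero} eq = ⊥-elim (fresh k eq)
tree-injective (grow t v i fresh a) {suc k} {suc j} eq = cong suc (tree-injective t eq)

parent : ∀ {N} {A : Graph N} {n} {vs : Vec (Fin N) (suc n)} → Tree A vs → Fin n → Fin (suc n)
parent (grow t v i _ _) zero    = suc i
parent (grow t v i _ _) (suc e) = suc (parent t e)

parent-adj : ∀ {N} {A : Graph N} {n} {vs : Vec (Fin N) (suc n)} (t : Tree A vs) e →
  adj A (lookup vs (parent t e)) (lookup vs (inject₁ e)) ≡ true
parent-adj (grow t v i _ a) zero    = a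
parent-adj (grow t v i _ a) (suc e) = parent-adj t e

parent-later : ∀ {N} {A : Graph N} {n} {vs : Vec (Fin N) (suc n)} (t : Tree A vs) e → toℕ e < toℕ (parent t e)
parent-later (grow t v i _ _) zero    = s≤s z≤n
parent-later (grow t v i _ _) (suc e) = s≤s (parent-later t e)

-- The position of the child's image among the neighbours of its parent's image. The tree lives in
-- A, its image in B.
treeCode : ∀ {N} {A : Graph N} {n} {vs : Vec (Fin N) (suc n)} → Tree A vs → Graph N → Subset N → (Fin (suc n) → Fin N) → Fin n → ℕ
treeCode t B S φ e = rank (S ∩ adj B (φ (parent t e))) (φ (inject₁ e))

-- Decoding proceeds from the root: once the image of the parent is known, the rank singles out the
-- image of the child.
tree-decode : ∀ {N} {A : Graph N} {n} {vs : Vec (Fin N) (suc n)} (t : Tree A vs) (B : Graph N) (S : Subset N) (φ φ′ : Fin (suc n) → Fin N) →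
  (∀ i → φ i ∈ S) → (∀ i → φ′ i ∈ S) →
  (∀ e → adj B (φ (parent t e)) (φ (inject₁ e)) ≡ true) → (∀ e → adj B (φ′ (parent t e)) (φ′ (inject₁ e)) ≡ true) →
  φ (fromℕ n) ≡ φ′ (fromℕ n) → (∀ e → treeCode t B S φ e ≡ treeCode t B S φ′ e) → ∀ i → φ i ≡ φ′ i
tree-decode (root v) B S φ φ′ s s′ a a′ r c zero = r
tree-decode (grow t v j _ _) B S φ φ′ s s′ a a′ r c = λ where
    zero    → rank-injective (S ∩ adj B (φ (suc j))) _ _ (∧-intro (s zero) (a zero))
                (∧-intro (s′ zero) (subst (λ x → adj B x (φ′ zero) ≡ true) (sym (rec j)) (a′ zero)))
                (trans (c zero) (cong (λ x → rank (S ∩ adj B x) (φ′ zero)) (sym (rec j))))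
    (suc i) → rec i
  where rec : ∀ i → φ (suc i) ≡ φ′ (suc i)
        rec = tree-decode t B S (φ ∘ suc) (φ′ ∘ suc) (s ∘ suc) (s′ ∘ suc) (a ∘ suc) (a′ ∘ suc) r (c ∘ suc)

spanning : ∀ {N} (A : Graph N) (S : Subset N) → 0 < # S → Crossing A S →
  ∃₂ λ n (vs : Vec (Fin N) (suc n)) → Tree A vs × (∀ i → lookup vs i ∈ S) × (∀ v → v ∈ S → ∃ λ i → lookup vs i ≡ v)
spanning {N} A S pos cross = go (suc (# (S ∖ image (lookup (v₀ ∷ []))))) (v₀ ∷ []) (root v₀) (λ { zero → proj₂ (#-pos⁻¹ S pos) }) ≤-refl
  where
    v₀ = proj₁ (#-pos⁻¹ S pos)
    go : ∀ k {n} (vs : Vec (Fin N) (suc n)) → Tree A vs → (∀ i → lookup vs i ∈ S) → # (S ∖ image (lookup vs)) < k →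
      ∃₂ λ n (vs : Vec (Fin N) (suc n)) → Tree A vs × (∀ i → lookup vs i ∈ S) × (∀ v → v ∈ S → ∃ λ i → lookup vs i ≡ v)
    go (suc k) {n} vs t vs⊆S (s≤s lt) with any? (λ v → v ∈? (S ∖ image (lookup vs)))
    ... | no none = n , vs , t , vs⊆S , cover
      where
        cover : ∀ v → v ∈ S → ∃ λ i → lookup vs i ≡ v
        cover v v∈S with any? (λ i → lookup vs i ≟ᶠ v)
        ... | yes p = p
        ... | no ¬p = ⊥-elim (none (v , ∧-intro v∈S (not-intro (¬p ∘ image-∈⁻¹ (lookup vs)))))
    ... | yes missing with u , w , u∈ , w∈ , a ← cross (image (lookup vs)) (lookup vs zero , ∧-intro (vs⊆S zero) (image-∈ (lookup vs) zero)) missing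
      with i , refl ← image-∈⁻¹ (lookup vs) (∧-elimʳ {S u} u∈) =
      go k (w ∷ vs) (grow t w i fresh a) (λ { zero → ∧-elimˡ w∈ ; (suc j) → vs⊆S j })
        (≤-trans (#-mono-< {S = S ∖ image (lookup (w ∷ vs))} {S ∖ image (lookup vs)}
          (λ v p → ∧-intro (∧-elimˡ p) (not-intro λ q → not-elim (∧-elimʳ {S v} p) (later v q)))
          w w∈ λ p → not-elim (∧-elimʳ {S w} p) (image-∈ (lookup (w ∷ vs)) zero)) lt)
      where
        fresh : ∀ j → lookup vs j ≢ w
        fresh j eq = not-elim (∧-elimʳ {S w} w∈) (subst (_∈ image (lookup vs)) eq (image-∈ (lookup vs) j))
        later : ∀ v → v ∈ image (lookup vs) → v ∈ image (lookup (w ∷ vs))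
        later v q with j , refl ← image-∈⁻¹ (lookup vs) q = image-∈ (lookup (w ∷ vs)) (suc j)

-- Bicliques, and matchings of vertices to pairs

-- The default `zero` only makes codes total; it is not reached where a code is decoded.
clamp : ∀ D → ℕ → Fin (suc D)
clamp D n with n <? suc D
... | yes p = fromℕ< p
... | no _  = zero

clamp-injective : ∀ D {m n} → m ≤ D → n ≤ D → clamp D m ≡ clamp D n → m ≡ n
clamp-injective D {m} {n} p q eq with m <? suc D | n <? suc D
... | yes p′ | yes q′ = trans (sym (toℕ-fromℕ< p′)) (trans (cong toℕ eq) (toℕ-fromℕ< q′))
... | no ¬p  | _      = ⊥-elim (¬p (s≤s p))
... | yes _  | no ¬q  = ⊥-elim (¬q (s≤s q))

#-pigeonhole : ∀ {N Z} (U : Subset N) (code : Fin N → Fin Z) s → s * Z < # U → ∃ λ z → s < # (U ∩ λ v → δ (code v) z)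
#-pigeonhole {N} {Z} U code s lt with any? (λ z → s <? # (U ∩ λ v → δ (code v) z))
... | yes r = r
... | no ¬r = ⊥-elim (<⇒≱ lt (begin
  # U ≡⟨ sum-cong-≗ (λ v → sym (trans (sum-*ˡ (bit (U v)) (bit ∘ δ (code v))) (trans (cong (bit (U v) *_) (#-δ (code v))) (*-identityʳ _)))) ⟩
  sum (λ v → sum (λ z → bit (U v) * bit (δ (code v) z))) ≡⟨ ∑-comm (λ v z → bit (U v) * bit (δ (code v) z)) ⟩
  sum (λ z → sum (λ v → bit (U v) * bit (δ (code v) z))) ≡⟨ sum-cong-≗ (λ z → sum-cong-≗ λ v → sym (bit-∧ (U v) (δ (code v) z))) ⟩
  sum (λ z → # (U ∩ λ v → δ (code v) z)) ≤⟨ sum-mono (λ z → ≮⇒≥ λ q → ¬r (z , q)) ⟩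
  sum {Z} (λ _ → s) ≡⟨ trans (sum-const Z s) (*-comm Z s) ⟩
  s * Z ∎))
  where open ≤-Reasoning

record Biclique {N} (s : ℕ) (U : Subset N) (rel : Fin N → Subset N) : Set where
  field
    left right : Fin s → Fin N
    left-inj   : Injective _≡_ _≡_ left
    right-inj  : Injective _≡_ _≡_ right
    left-∈     : ∀ i → left i ∈ U
    complete   : ∀ i j → right j ∈ rel (left i)

biclique-mono : ∀ {N s} {U V : Subset N} {rel} → U ⊆ V → Biclique s U rel → Biclique s V rel
biclique-mono p K = record { Biclique K ; left-∈ = λ i → p _ (Biclique.left-∈ K i) }

-- Each vertex of U lists s elements of its set by their ranks in W, in one of suc Δ ^ s ways. More
-- than s vertices share a list, and this list is the other side.
same-code⇒biclique : ∀ {N} s (U : Subset N) (rel : Fin N → Subset N) (W : Subset N) Δ → # W ≤ suc Δ →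
  (∀ b → b ∈ U → rel b ⊆ W) → (∀ b → b ∈ U → s ≤ # (rel b)) → s * suc Δ ^ s < # U → Biclique s U rel
same-code⇒biclique {N} s U rel W Δ #W rel⊆W s≤ lt = record
  { left = left ; right = right ; left-inj = left-inj ; right-inj = right-inj
  ; left-∈ = λ i → ∧-elimˡ (enum-∈ V _) ; complete = complete }
  where
    elem : Fin N → Fin s → Fin N
    elem b i with s ≤? # (rel b)
    ... | yes p = enum (rel b) (inject≤ i p)
    ... | no _  = b
    elem-∈ : ∀ b → b ∈ U → ∀ i → elem b i ∈ rel b
    elem-∈ b b∈U i with s ≤? # (rel b)
    ... | yes p = enum-∈ (rel b) _
    ... | no ¬p = ⊥-elim (¬p (s≤ b b∈U))
    elem-inj : ∀ b → b ∈ U → Injective _≡_ _≡_ (elem b)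
    elem-inj b b∈U eq with s ≤? # (rel b)
    ... | yes p = inject≤-injective p p _ _ (enum-injective (rel b) eq)
    ... | no ¬p = ⊥-elim (¬p (s≤ b b∈U))
    code : Fin N → Fin (suc Δ ^ s)
    code b = funToFin (λ i → clamp Δ (rank W (elem b i)))
    hole = #-pigeonhole U code s lt
    V = U ∩ λ v → δ (code v) (proj₁ hole)
    s≤#V = <⇒≤ (proj₂ hole)
    left : Fin s → Fin N
    left i = enum V (inject≤ i s≤#V)
    left-inj : Injective _≡_ _≡_ left
    left-inj eq = inject≤-injective s≤#V s≤#V _ _ (enum-injective V eq)
    b₀ = enum V (fromℕ< (≤-trans (s≤s z≤n) (proj₂ hole)))
    b₀∈V = enum-∈ V (fromℕ< (≤-trans (s≤s z≤n) (proj₂ hole)))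
    right : Fin s → Fin N
    right = elem b₀
    right-inj : Injective _≡_ _≡_ right
    right-inj = elem-inj b₀ (∧-elimˡ b₀∈V)
    bound : ∀ b → b ∈ U → ∀ i → rank W (elem b i) ≤ Δ
    bound b b∈U i = ≤-pred (≤-trans (rank< W _ (rel⊆W b b∈U _ (elem-∈ b b∈U i))) #W)
    same : ∀ b → b ∈ V → ∀ i → elem b i ≡ elem b₀ i
    same b b∈V i = rank-injective W _ _ (rel⊆W b b∈U _ (elem-∈ b b∈U i)) (rel⊆W b₀ b₀∈U _ (elem-∈ b₀ b₀∈U i))
      (clamp-injective Δ (bound b b∈U i) (bound b₀ b₀∈U i)
        (funToFin-injective (trans (∈δ⇒≡ (∧-elimʳ {U b} b∈V)) (sym (∈δ⇒≡ (∧-elimʳ {U b₀} b₀∈V)))) i))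
      where b∈U = ∧-elimˡ b∈V
            b₀∈U = ∧-elimˡ b₀∈V
    complete : ∀ i j → right j ∈ rel (left i)
    complete i j = subst (_∈ rel (left i)) (same (left i) (enum-∈ V _) j) (elem-∈ (left i) (∧-elimˡ (enum-∈ V _)) j)

-- Remove a vertex v of low degree in P. A clique through v lies in v and its at most Δ neighbours,
-- so only boundedly many b see v, or else there is a biclique. All other b see cliques avoiding v.
clique-count : ∀ {N} s Δ (P : Graph N) (Q U : Subset N) (rel : Fin N → Subset N) → 0 < s →
  (∀ T → T ⊆ Q → 0 < # T → ∃ λ v → v ∈ T × deg P T v ≤ Δ) →
  (∀ b → b ∈ U → rel b ⊆ Q) → (∀ b → b ∈ U → s ≤ # (rel b)) →
  (∀ b → b ∈ U → ∀ x y → x ∈ rel b → y ∈ rel b → x ≢ y → adj P x y ≡ true) →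
  ¬ Biclique s U rel → # U ≤ # Q * (s * suc Δ ^ s)
clique-count {N} s Δ P Q U rel 0<s low rel⊆Q s≤ clique none = go (suc (# Q)) Q U ≤-refl (λ _ p → p) (λ _ p → p) rel⊆Q
  where
    Z = s * suc Δ ^ s
    go : ∀ n T V → # T < n → T ⊆ Q → V ⊆ U → (∀ b → b ∈ V → rel b ⊆ T) → # V ≤ # T * Z
    go (suc n) T V (s≤s lt) T⊆Q V⊆U rel⊆T with # T in eq
    ... | zero = ≤-reflexive (sum-0 λ b → cong bit (¬true⇒false λ b∈V → empty b b∈V))
      where
        empty : ∀ b → b ∈ V → ⊥
        empty b b∈V with x , x∈ ← #-pos⁻¹ (rel b) (≤-trans 0<s (s≤ b (V⊆U b b∈V))) =
          <⇒≱ (#-pos T x (rel⊆T b b∈V x x∈)) (≤-reflexive eq)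
    ... | suc k with v , v∈T , v-low ← low T T⊆Q (subst (0 <_) (sym eq) (s≤s z≤n)) = begin
      # V ≡⟨ #-split V (λ b → rel b v) ⟩
      # V₁ + # V₂ ≤⟨ +-mono-≤ V₁≤ V₂≤ ⟩
      Z + # (T ∖ δ v) * Z ≡⟨ cong (λ x → Z + x * Z) (suc-injective (trans (sym (#-remove T v v∈T)) eq)) ⟩
      suc k * Z ∎
      where
        open ≤-Reasoning
        V₁ = V ∩ λ b → rel b v
        V₂ = V ∖ λ b → rel b v
        W : Subset N
        W x = δ v x ∨ (T ∩ adj P v) x
        W∖v : ∀ x → x ∈ (W ∖ δ v) → x ∈ (T ∩ adj P v)
        W∖v x p with δ v x
        ... | false = ∧-elimˡ p
        W∋ : ∀ x → (x ≢ v → x ∈ (T ∩ adj P v)) → x ∈ W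
        W∋ x p with v ≟ᶠ x
        ... | yes _ = refl
        ... | no v≢x = p (v≢x ∘ sym)
        #W : # W ≤ suc Δ
        #W = begin
          # W ≡⟨ #-remove W v (W∋ v λ v≢v → ⊥-elim (v≢v refl)) ⟩
          suc (# (W ∖ δ v)) ≤⟨ s≤s (≤-trans (#-mono W∖v) v-low) ⟩
          suc Δ ∎
        V₁≤ : # V₁ ≤ Z
        V₁≤ with # V₁ ≤? Z
        ... | yes p = p
        ... | no ¬p = ⊥-elim (none (biclique-mono (λ b p → V⊆U b (∧-elimˡ p)) (same-code⇒biclique s V₁ rel W Δ #W
                (λ b p x x∈ → W∋ x λ x≢v → ∧-intro (rel⊆T b (∧-elimˡ p) x x∈)
                   (clique b (V⊆U b (∧-elimˡ p)) v x (∧-elimʳ {V b} p) x∈ (x≢v ∘ sym)))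
                (λ b p → s≤ b (V⊆U b (∧-elimˡ p))) (≰⇒> ¬p))))
        V₂≤ : # V₂ ≤ # (T ∖ δ v) * Z
        V₂≤ = go n (T ∖ δ v) V₂ (≤-trans (≤-reflexive (sym (#-remove T v v∈T))) (≤-trans (≤-reflexive eq) lt))
          (λ x p → T⊆Q x (∧-elimˡ p)) (λ b p → V⊆U b (∧-elimˡ p))
          (λ b p x x∈ → ∧-intro (rel⊆T b (∧-elimˡ p) x x∈)
             (not-intro λ q → not-elim (∧-elimʳ {V b} p) (subst (_∈ rel b) (sym (∈δ⇒≡ q)) x∈)))

SamePair : ∀ {N} (x y x′ y′ : Fin N) → Set
SamePair x y x′ y′ = (x ≡ x′ × y ≡ y′) ⊎ (x ≡ y′ × y ≡ x′)

samePair? : ∀ {N} (x y x′ y′ : Fin N) → Dec (SamePair x y x′ y′)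
samePair? x y x′ y′ = (x ≟ᶠ x′ ×-dec y ≟ᶠ y′) ⊎-dec (x ≟ᶠ y′ ×-dec y ≟ᶠ x′)
  where open import Relation.Nullary.Decidable using (_×-dec_; _⊎-dec_)

SamePair-swapˡ : ∀ {N} {x y x′ y′ : Fin N} → SamePair x y x′ y′ → SamePair y x x′ y′
SamePair-swapˡ (inj₁ (p , q)) = inj₂ (q , p)
SamePair-swapˡ (inj₂ (p , q)) = inj₁ (q , p)

SamePair-sym : ∀ {N} {x y x′ y′ : Fin N} → SamePair x y x′ y′ → SamePair x′ y′ x y
SamePair-sym (inj₁ (refl , refl)) = inj₁ (refl , refl)
SamePair-sym (inj₂ (refl , refl)) = inj₂ (refl , refl)

SamePair-trans : ∀ {N} {x y x′ y′ x″ y″ : Fin N} → SamePair x y x′ y′ → SamePair x′ y′ x″ y″ → SamePair x y x″ y″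
SamePair-trans (inj₁ (refl , refl)) q = q
SamePair-trans (inj₂ (refl , refl)) q = SamePair-swapˡ q

Triple : ℕ → Set
Triple N = Fin N × Fin N × Fin N

-- Distinct vertices b of B are assigned to distinct pairs of vertices of rel b: pm x y and pm y x both hold
-- the triple (b , x , y) or both hold (b , y , x).
record Matching {N} (B Q : Subset N) (rel : Fin N → Subset N) (bad : Fin N → Fin N → Bool) : Set where
  field
    pm      : Fin N → Fin N → Maybe (Triple N)
    used    : Subset N
    pm-sym  : ∀ x y → pm x y ≡ pm y x
    pm-pair : ∀ {x y b x₀ y₀} → pm x y ≡ just (b , x₀ , y₀) → SamePair x y x₀ y₀
    pm-used : ∀ {x y b x₀ y₀} → pm x y ≡ just (b , x₀ , y₀) → b ∈ used
    pm-B    : ∀ {x y b x₀ y₀} → pm x y ≡ just (b , x₀ , y₀) → b ∈ B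
    pm-x    : ∀ {x y b x₀ y₀} → pm x y ≡ just (b , x₀ , y₀) → x₀ ∈ rel b
    pm-y    : ∀ {x y b x₀ y₀} → pm x y ≡ just (b , x₀ , y₀) → y₀ ∈ rel b
    pm-≢    : ∀ {x y b x₀ y₀} → pm x y ≡ just (b , x₀ , y₀) → x₀ ≢ y₀
    pm-bad  : ∀ {x y b x₀ y₀} → pm x y ≡ just (b , x₀ , y₀) → bad x₀ y₀ ≡ false
    pm-inj  : ∀ {x y b x₀ y₀ x′ y′ x₀′ y₀′} → pm x y ≡ just (b , x₀ , y₀) → pm x′ y′ ≡ just (b , x₀′ , y₀′) → x₀ ≡ x₀′ × y₀ ≡ y₀′

  pm-irrefl : ∀ x → is-just (pm x x) ≡ false
  pm-irrefl x with pm x x in eq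
  ... | nothing = refl
  ... | just (b , x₀ , y₀) with pm-pair eq
  ...   | inj₁ (refl , refl) = ⊥-elim (pm-≢ eq refl)
  ...   | inj₂ (refl , refl) = ⊥-elim (pm-≢ eq refl)

  pairs : Graph N
  pairs = record { adj = λ x y → is-just (pm x y) ; adj-sym = λ x y → cong is-just (pm-sym x y) ; adj-irrefl = pm-irrefl }

  triple : ∀ {x y} → adj pairs x y ≡ true → ∃ λ t → pm x y ≡ just t
  triple {x} {y} a with pm x y
  ... | just t = t , refl

record Maximal {N} {B Q : Subset N} {rel bad} (M : Matching B Q rel bad) : Set where
  open Matching M
  field
    count   : # used ≤ E pairs Q
    maximal : ∀ b → b ∈ (B ∖ used) → ∀ x y → x ∈ rel b → y ∈ rel b → x ≢ y → adj pairs x y ≡ true ⊎ bad x y ≡ true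

module _ {N} (B Q : Subset N) (rel : Fin N → Subset N) (bad : Fin N → Fin N → Bool) (rel⊆Q : ∀ b → b ∈ B → rel b ⊆ Q) where

  empty-matching : Matching B Q rel bad
  empty-matching = record
    { pm = λ _ _ → nothing ; used = λ _ → false ; pm-sym = λ _ _ → refl ; pm-pair = λ () ; pm-used = λ () ; pm-B = λ ()
    ; pm-x = λ () ; pm-y = λ () ; pm-≢ = λ () ; pm-bad = λ () ; pm-inj = λ () }

  module Extend (M : Matching B Q rel bad) (b x y : Fin N) (b∈B : b ∈ B) (b-new : ¬ (b ∈ Matching.used M))
    (x∈ : x ∈ rel b) (y∈ : y ∈ rel b) (x≢y : x ≢ y) (new : adj (Matching.pairs M) x y ≡ false) (ok : bad x y ≡ false) where
    open Matching M

    pm′ : Fin N → Fin N → Maybe (Triple N)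
    pm′ u w with samePair? u w x y
    ... | yes _ = just (b , x , y)
    ... | no _  = pm u w

    used′ : Subset N
    used′ u = δ b u ∨ used u

    used⊆ : used ⊆ used′
    used⊆ u p with δ b u
    ... | true  = refl
    ... | false = p

    data View (u w : Fin N) (t : Triple N) : Set where
      here  : SamePair u w x y → t ≡ (b , x , y) → View u w t
      there : pm u w ≡ just t → View u w t

    view : ∀ {u w t} → pm′ u w ≡ just t → View u w t
    view {u} {w} eq with samePair? u w x y
    ... | yes p = here p (sym (just-injective eq))
    ... | no _  = there eq

    extended : Matching B Q rel bad
    extended = record
      { pm = pm′ ; used = used′ ; pm-sym = sym′
      ; pm-pair = λ {u} {w} eq → case view {u} {w} eq of λ { (here p refl) → p ; (there q) → pm-pair q }
      ; pm-used = λ {u} {w} eq → case view {u} {w} eq of λ { (here p refl) → cong (_∨ used b) (∈δ b) ; (there q) → used⊆ _ (pm-used q) }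
      ; pm-B = λ {u} {w} eq → case view {u} {w} eq of λ { (here p refl) → b∈B ; (there q) → pm-B q }
      ; pm-x = λ {u} {w} eq → case view {u} {w} eq of λ { (here p refl) → x∈ ; (there q) → pm-x q }
      ; pm-y = λ {u} {w} eq → case view {u} {w} eq of λ { (here p refl) → y∈ ; (there q) → pm-y q }
      ; pm-≢ = λ {u} {w} eq → case view {u} {w} eq of λ { (here p refl) → x≢y ; (there q) → pm-≢ q }
      ; pm-bad = λ {u} {w} eq → case view {u} {w} eq of λ { (here p refl) → ok ; (there q) → pm-bad q }
      ; pm-inj = λ {u} {w} {_} {_} {_} {u′} {w′} eq eq′ → inj′ (view {u} {w} eq) (view {u′} {w′} eq′) }
      where
        sym′ : ∀ u w → pm′ u w ≡ pm′ w u
        sym′ u w with samePair? u w x y | samePair? w u x y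
        ... | yes _ | yes _ = refl
        ... | yes p | no ¬q = ⊥-elim (¬q (SamePair-swapˡ p))
        ... | no ¬p | yes q = ⊥-elim (¬p (SamePair-swapˡ q))
        ... | no _  | no _  = pm-sym u w
        inj′ : ∀ {u w u′ w′ c x₀ y₀ x₀′ y₀′} → View u w (c , x₀ , y₀) → View u′ w′ (c , x₀′ , y₀′) → x₀ ≡ x₀′ × y₀ ≡ y₀′
        inj′ (here _ refl) (here _ refl) = refl , refl
        inj′ (here _ refl) (there q)     = ⊥-elim (b-new (pm-used q))
        inj′ (there q)     (here _ refl) = ⊥-elim (b-new (pm-used q))
        inj′ (there q)     (there q′)    = pm-inj q q′

    open Matching extended using () renaming (pairs to pairs′)

    more : ∀ u w → adj pairs u w ≡ true → adj pairs′ u w ≡ true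
    more u w p with samePair? u w x y
    ... | yes _ = refl
    ... | no _  = p

    added : adj pairs′ x y ≡ true
    added with samePair? x y x y
    ... | yes _ = refl
    ... | no ¬p = ⊥-elim (¬p (inj₁ (refl , refl)))

    -- A new pair contributes two ordered pairs; counting one of them is enough.
    count′ : # used ≤ E pairs Q → # used′ ≤ E pairs′ Q
    count′ le = begin
      # used′ ≡⟨ #-remove used′ b (cong (_∨ used b) (∈δ b)) ⟩
      suc (# (used′ ∖ δ b)) ≤⟨ s≤s (#-mono old) ⟩
      suc (# used) ≤⟨ s≤s le ⟩
      suc (E pairs Q) ≤⟨ sum-mono-< (λ u → *-monoʳ-≤ (bit (Q u)) (#-mono (more′ u))) x gain ⟩
      E pairs′ Q ∎
      where
        open ≤-Reasoning
        old : (used′ ∖ δ b) ⊆ used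
        old u p with δ b u
        ... | false = ∧-elimˡ p
        more′ : ∀ u → (Q ∩ adj pairs u) ⊆ (Q ∩ adj pairs′ u)
        more′ u w p = ∧-intro (∧-elimˡ p) (more u w (∧-elimʳ {Q w} p))
        gain : bit (Q x) * deg pairs Q x < bit (Q x) * deg pairs′ Q x
        gain rewrite rel⊆Q b b∈B x x∈ | *-identityˡ (deg pairs Q x) | *-identityˡ (deg pairs′ Q x) =
          #-mono-< (more′ x) y (∧-intro (rel⊆Q b b∈B y y∈) added) λ p → true≢false (∧-elimʳ {Q y} p) new

  greedy : ∃ λ (M : Matching B Q rel bad) → Maximal M
  greedy = go (suc (# (B ∖ λ _ → false))) empty-matching (≤-trans (≤-reflexive (sum-0 {N} λ _ → refl)) z≤n) ≤-refl
    where
      go : ∀ n (M : Matching B Q rel bad) → # (Matching.used M) ≤ E (Matching.pairs M) Q → # (B ∖ Matching.used M) < n → ∃ λ (M : Matching B Q rel bad) → Maximal M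
      go (suc n) M le (s≤s lt) with any? (λ b → any? (λ x → any? (λ y → dec b x y)))
        where
          open import Relation.Nullary.Decidable using (_×-dec_; ¬?)
          open Matching M
          dec : ∀ b x y → Dec (b ∈ (B ∖ used) × x ∈ rel b × y ∈ rel b × x ≢ y × (not (adj pairs x y ∨ bad x y)) ≡ true)
          dec b x y = (b ∈? (B ∖ used)) ×-dec (x ∈? rel b) ×-dec (y ∈? rel b) ×-dec ¬? (x ≟ᶠ y) ×-dec (y ∈? λ y → not (adj pairs x y ∨ bad x y))
      ... | yes (b , x , y , b∈ , x∈ , y∈ , x≢y , free) =
        go n Ext.extended (Ext.count′ le) (≤-trans (#-mono-< {S = B ∖ Ext.used′} {B ∖ used}
            (λ u p → ∧-intro (∧-elimˡ p) (not-intro λ q → not-elim (∧-elimʳ {B u} p) (Ext.used⊆ u q)))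
            b b∈ λ p → not-elim (∧-elimʳ {B b} p) (cong (_∨ used b) (∈δ b))) lt)
        where
          open Matching M
          split : ∀ {p q} → not (p ∨ q) ≡ true → p ≡ false × q ≡ false
          split {false} {false} _ = refl , refl
          module Ext = Extend M b x y (∧-elimˡ b∈) (not-elim (∧-elimʳ {B b} b∈)) x∈ y∈ x≢y (proj₁ (split free)) (proj₂ (split {adj pairs x y} free))
      ... | no none = M , record { count = le ; maximal = maximal }
        where
          open Matching M
          or : ∀ p {q} → ¬ (not (p ∨ q) ≡ true) → p ≡ true ⊎ q ≡ true
          or true  _ = inj₁ refl
          or false {true}  _ = inj₂ refl
          or false {false} p = ⊥-elim (p refl)
          maximal : ∀ b → b ∈ (B ∖ used) → ∀ x y → x ∈ rel b → y ∈ rel b → x ≢ y → adj pairs x y ≡ true ⊎ bad x y ≡ true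
          maximal b b∈ x y x∈ y∈ x≢y = or (adj pairs x y) λ free → none (b , x , y , b∈ , x∈ , y∈ , x≢y , free)

-- Unbalanced pairs in minimal dense sets

heavy : ∀ {N} → Graph N → Subset N → ℕ → Subset N
heavy A S D v = does (D <? deg A S v)

heavy-bound : ∀ {N} (A : Graph N) (S : Subset N) D → # (S ∩ heavy A S D) * D ≤ E A S
heavy-bound A S D = ≤-trans
  (sumOn-lower (S ∩ heavy A S D) D λ v p → <⇒≤ (does-elim (D <? deg A S v) (∧-elimʳ {S v} p)))
  (sumOn-⊆ (deg A S) (⊆-∩ˡ S (heavy A S D)))

light-degree : ∀ {N} (A : Graph N) (S : Subset N) D v → v ∈ (S ∖ heavy A S D) → deg A (S ∖ heavy A S D) v ≤ D
light-degree A S D v p = ≤-trans (deg-mono A (⊆-∖ S (heavy A S D)) v)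
  (≮⇒≥ λ q → not-elim (∧-elimʳ {S v} p) (does-true (D <? deg A S v) q))

record Unbalanced {N} (A : Graph N) (S : Subset N) (a y s : ℕ) : Set where
  field
    Q B      : Subset N
    Q⊆S      : Q ⊆ S
    B⊆S      : B ⊆ S
    disjoint : ∀ v → v ∈ Q → v ∈ B → ⊥
    Q<S      : # Q < # S
    Q-small  : # Q * y ≤ # S
    B-large  : # S ≤ 64 * # B
    B-degree : ∀ b → b ∈ B → s ≤ deg A Q b
    B-sparse : ∀ b → b ∈ B → deg A S b ≤ a * 2048

-- Edges inside Q are few by minimality and edges outside Q by assumption, so many edges cross.
-- Those at vertices with fewer than s neighbours in Q are negligible. Thus Q and the rich vertices
-- carry a constant fraction of all edges; by minimality they are not much denser than S, so they
-- form a constant fraction of S, nearly all of it outside Q.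
unbalanced : ∀ {N} (A : Graph N) (S : Subset N) a y s → .⦃ _ : NonZero a ⦄ → 32 ≤ y → s ≤ a → 0 < # S → 16 * a * # S ≤ E A S →
  (∀ T → T ⊆ S → # T < # S → 0 < # T → E A T < 16 * a * # T) →
  E A (S ∖ heavy A S (32 * a * y)) ≤ 8 * a * # S → Unbalanced A S a y s
unbalanced {N} A S a y s 32≤y s≤a pos dense sparser light = record
  { Q = Q ; B = B ; Q⊆S = ⊆-∩ˡ S H ; B⊆S = λ v p → ∧-elimˡ (∧-elimˡ {(S ∖ H) v} (∧-elimˡ {B₁ v} p))
  ; disjoint = λ v p q → not-elim (∧-elimʳ {S v} (∧-elimˡ (∧-elimˡ {B₁ v} q))) (∧-elimʳ {S v} p)
  ; Q<S = Q<S ; Q-small = Q-small ; B-large = B-large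
  ; B-degree = λ b p → does-elim (s ≤? deg A Q b) (∧-elimʳ {(S ∖ H) b} (∧-elimˡ p))
  ; B-sparse = λ b p → ≮⇒≥ λ q → not-elim (∧-elimʳ {B₁ b} p) (does-true (a * 2048 <? deg A S b) q) }
  where
    open ≤-Reasoning
    open MinimalDense A (16 * a) S dense sparser
    n = # S
    H = heavy A S (32 * a * y)
    Q = S ∩ H
    B₀ = S ∖ H
    rich : Subset N
    rich v = does (s ≤? deg A Q v)
    B₁ = B₀ ∩ rich
    B = B₁ ∖ heavy A S (a * 2048)
    1≤a : 1 ≤ a
    1≤a = >-nonZero⁻¹ a
    E≤ : E A S ≤ 32 * a * n
    E≤ = ≤-trans (upper pos) (*-monoˡ-≤ n (begin
      16 * a + 2 ≤⟨ +-monoʳ-≤ (16 * a) (*-mono-≤ {2} {16} {1} {a} (s≤s (s≤s z≤n)) 1≤a) ⟩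
      16 * a + 16 * a ≡⟨ r a ⟩
      32 * a ∎))
      where r : ∀ a → 16 * a + 16 * a ≡ 32 * a
            r = solve-∀
    Q-small : # Q * y ≤ n
    Q-small = *-cancelʳ-≤ (# Q * y) n (32 * a) ⦃ m*n≢0 32 a ⦄ (begin
      # Q * y * (32 * a) ≡⟨ r (# Q) y (32 * a) ⟩
      # Q * (32 * a * y) ≤⟨ heavy-bound A S (32 * a * y) ⟩
      E A S ≤⟨ E≤ ⟩
      32 * a * n ≡⟨ *-comm (32 * a) n ⟩
      n * (32 * a) ∎)
      where r : ∀ q y z → q * y * z ≡ q * (z * y)
            r = solve-∀
    Q-small′ : # Q * 32 ≤ n
    Q-small′ = ≤-trans (*-monoʳ-≤ (# Q) 32≤y) Q-small
    Q<S : # Q < n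
    Q<S = go (# Q) Q-small′
      where go : ∀ q → q * 32 ≤ n → q < n
            go zero    _ = pos
            go (suc q) p = ≤-trans (s≤s (s≤s (≤-trans (m≤m*n q 32) (m≤n+m (q * 32) 30)))) p
    E-Q : E A Q ≤ 4 * a * n
    E-Q = begin
      E A Q ≤⟨ sparser≤ Q (⊆-∩ˡ S H) Q<S ⟩
      16 * a * # Q ≤⟨ *-monoˡ-≤ (# Q) (*-monoˡ-≤ a {16} {128} (m≤m+n 16 112)) ⟩
      128 * a * # Q ≡⟨ r a (# Q) ⟩
      4 * a * (# Q * 32) ≤⟨ *-monoʳ-≤ (4 * a) Q-small′ ⟩
      4 * a * n ∎
      where r : ∀ a q → 128 * a * q ≡ 4 * a * (q * 32)
            r = solve-∀
    many-links : 2 * a * n ≤ links A Q B₀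
    many-links = *-cancelˡ-≤ 2 (+-cancelˡ-≤ (12 * a * n) _ _ (begin
      12 * a * n + 2 * (2 * a * n) ≡⟨ r₁ (a) n ⟩
      16 * a * n ≤⟨ dense ⟩
      E A S ≡⟨ E-split A S H ⟩
      E A Q + E A B₀ + 2 * links A Q B₀ ≤⟨ +-monoˡ-≤ _ (+-mono-≤ E-Q light) ⟩
      4 * a * n + 8 * a * n + 2 * links A Q B₀ ≡⟨ cong (_+ 2 * links A Q B₀) (r₂ a n) ⟩
      12 * a * n + 2 * links A Q B₀ ∎))
      where r₁ : ∀ a n → 12 * a * n + 2 * (2 * a * n) ≡ 16 * a * n
            r₁ = solve-∀
            r₂ : ∀ a n → 4 * a * n + 8 * a * n ≡ 12 * a * n
            r₂ = solve-∀
    rich-links : a * n ≤ links A B₁ Q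
    rich-links = +-cancelʳ-≤ (a * n) _ _ (begin
      a * n + a * n ≡⟨ r a n ⟩
      2 * a * n ≤⟨ many-links ⟩
      links A Q B₀ ≡⟨ links-sym A Q B₀ ⟩
      links A B₀ Q ≡⟨ links-splitˡ A B₀ Q rich ⟩
      links A B₁ Q + links A (B₀ ∖ rich) Q ≤⟨ +-monoʳ-≤ (links A B₁ Q) (begin
        links A (B₀ ∖ rich) Q ≤⟨ sumOn-upper (B₀ ∖ rich) s (λ v p → <⇒≤ (≰⇒> λ q → not-elim (∧-elimʳ {B₀ v} p) (does-true (s ≤? deg A Q v) q))) ⟩
        # (B₀ ∖ rich) * s ≤⟨ *-mono-≤ (#-mono λ v p → ∧-elimˡ (∧-elimˡ {B₀ v} p)) s≤a ⟩
        n * a ≡⟨ *-comm n a ⟩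
        a * n ∎) ⟩
      links A B₁ Q + a * n ∎)
      where r : ∀ a n → a * n + a * n ≡ 2 * a * n
            r = solve-∀
    -- Q together with B₁, written so that cutting along H gives back the two parts.
    T : Subset N
    T v = S v ∧ (H v ∨ rich v)
    Q⊆T∩H : Q ⊆ (T ∩ H)
    Q⊆T∩H v p with S v | H v
    ... | true | true = refl
    T∩H⊆Q : (T ∩ H) ⊆ Q
    T∩H⊆Q v p with S v | H v
    ... | true | true = refl
    ... | true | false = ⊥-elim (true≢false p (∧-comm (rich v) false))
    B₁⊆T∖H : B₁ ⊆ (T ∖ H)
    B₁⊆T∖H v p with S v | H v | rich v
    ... | true | false | true = refl
    T∖H⊆B₁ : (T ∖ H) ⊆ B₁
    T∖H⊆B₁ v p with S v | H v | rich v
    ... | true | false | true = refl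
    E-T : E A T ≤ 32 * a * # T
    E-T with # T <? # S
    ... | yes lt = ≤-trans (sparser≤ T (λ v → ∧-elimˡ) lt) (*-monoˡ-≤ (# T) (*-monoˡ-≤ a {16} {32} (m≤m+n 16 16)))
    ... | no ¬lt = begin
      E A T ≤⟨ links-mono A {T} {S} {T} {S} (λ v → ∧-elimˡ) (λ v → ∧-elimˡ) ⟩
      E A S ≤⟨ E≤ ⟩
      32 * a * n ≤⟨ *-monoʳ-≤ (32 * a) (≮⇒≥ ¬lt) ⟩
      32 * a * # T ∎
    #T : # T ≤ # Q + # B₁
    #T = ≤-trans (≤-reflexive (#-split T H)) (+-mono-≤ (#-mono T∩H⊆Q) (#-mono T∖H⊆B₁))
    n≤T : n ≤ 16 * # T
    n≤T = *-cancelˡ-≤ (2 * a) ⦃ m*n≢0 2 a ⦄ (begin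
      2 * a * n ≡⟨ *-assoc 2 a n ⟩
      2 * (a * n) ≤⟨ *-monoʳ-≤ 2 rich-links ⟩
      2 * links A B₁ Q ≤⟨ *-monoʳ-≤ 2 (links-mono A B₁⊆T∖H Q⊆T∩H) ⟩
      2 * links A (T ∖ H) (T ∩ H) ≡⟨ cong (2 *_) (links-sym A (T ∖ H) (T ∩ H)) ⟩
      2 * links A (T ∩ H) (T ∖ H) ≤⟨ m≤n+m _ (E A (T ∩ H) + E A (T ∖ H)) ⟩
      E A (T ∩ H) + E A (T ∖ H) + 2 * links A (T ∩ H) (T ∖ H) ≡⟨ E-split A T H ⟨
      E A T ≤⟨ E-T ⟩
      32 * a * # T ≡⟨ r a (# T) ⟩
      2 * a * (16 * # T) ∎)
      where r : ∀ a t → 32 * a * t ≡ 2 * a * (16 * t)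
            r = solve-∀
    n≤B₁ : n ≤ 32 * # B₁
    n≤B₁ = +-cancelˡ-≤ n _ _ (begin
      n + n ≡⟨ r₁ n ⟩
      2 * n ≤⟨ *-monoʳ-≤ 2 (≤-trans n≤T (*-monoʳ-≤ 16 #T)) ⟩
      2 * (16 * (# Q + # B₁)) ≡⟨ r₂ (# Q) (# B₁) ⟩
      # Q * 32 + 32 * # B₁ ≤⟨ +-monoˡ-≤ _ Q-small′ ⟩
      n + 32 * # B₁ ∎)
      where r₁ : ∀ n → n + n ≡ 2 * n
            r₁ = solve-∀
            r₂ : ∀ q b → 2 * (16 * (q + b)) ≡ q * 32 + 32 * b
            r₂ = solve-∀
    -- Markov's inequality: the degrees sum to at most 32 a n, so cutting at 2048 a loses n / 64
    -- vertices, half of the n / 32 guaranteed in B₁.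
    few-heavy : 64 * # (B₁ ∩ heavy A S (a * 2048)) ≤ n
    few-heavy = *-cancelʳ-≤ _ n (32 * a) ⦃ m*n≢0 32 a ⦄ (begin
      64 * # (B₁ ∩ heavy A S (a * 2048)) * (32 * a) ≡⟨ r (# (B₁ ∩ heavy A S (a * 2048))) a ⟩
      # (B₁ ∩ heavy A S (a * 2048)) * (a * 2048) ≤⟨ *-monoˡ-≤ (a * 2048) (#-mono λ v p → ∧-intro (∧-elimˡ (∧-elimˡ {(S ∖ H) v} (∧-elimˡ {B₁ v} p))) (∧-elimʳ {B₁ v} p)) ⟩
      # (S ∩ heavy A S (a * 2048)) * (a * 2048) ≤⟨ heavy-bound A S (a * 2048) ⟩
      E A S ≤⟨ E≤ ⟩
      32 * a * n ≡⟨ *-comm (32 * a) n ⟩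
      n * (32 * a) ∎)
      where r : ∀ x a → 64 * x * (32 * a) ≡ x * (a * 2048)
            r = solve-∀
    B-large : n ≤ 64 * # B
    B-large = +-cancelˡ-≤ n _ _ (begin
      n + n ≡⟨ r₁ n ⟩
      2 * n ≤⟨ *-monoʳ-≤ 2 n≤B₁ ⟩
      2 * (32 * # B₁) ≡⟨ cong (λ x → 2 * (32 * x)) (#-split B₁ (heavy A S (a * 2048))) ⟩
      2 * (32 * (# (B₁ ∩ heavy A S (a * 2048)) + # B)) ≡⟨ r₂ (# (B₁ ∩ heavy A S (a * 2048))) (# B) ⟩
      64 * # (B₁ ∩ heavy A S (a * 2048)) + 64 * # B ≤⟨ +-monoˡ-≤ _ few-heavy ⟩
      n + 64 * # B ∎)
      where r₁ : ∀ n → n + n ≡ 2 * n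
            r₁ = solve-∀
            r₂ : ∀ q b → 2 * (32 * (q + b)) ≡ 64 * q + 64 * b
            r₂ = solve-∀

squeeze : ∀ {q n y w} → 0 < n → q * y ≤ n → n ≤ w * q → w < y → ⊥
squeeze {zero}  {n} {y} {w} pos _ le _ = <⇒≱ pos (≤-trans le (≤-reflexive (*-zeroʳ w)))
squeeze {suc q} {n} {y} {w} pos le le′ lt = <⇒≱ (*-monoˡ-< (suc q) lt) (≤-trans (≤-reflexive (*-comm y (suc q))) (≤-trans le le′))

-- Subdivisions of graphs of bounded degree

-- A subdivision of the graph F inside G, every edge x y of F being replaced by the L vertices ch x y. These need not
-- form a path: conn only says that they induce a connected graph.
record Subdivision {N} (G : Graph N) (L : ℕ) : Set where
  field
    F      : Graph N
    ch     : Fin N → Fin N → Fin L → Fin N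
    ch-sym : ∀ x y l → adj F x y ≡ true → ch x y l ≡ ch y x l
    ch-inj : ∀ {x y x′ y′ l l′} → adj F x y ≡ true → adj F x′ y′ ≡ true → ch x y l ≡ ch x′ y′ l′ → l ≡ l′ × SamePair x y x′ y′
    ch-br  : ∀ {x y x′ y′ l} → adj F x y ≡ true → adj F x′ y′ ≡ true → ch x y l ≢ x′
    br-br  : ∀ {x y x′ y′} → adj F x y ≡ true → adj F x′ y′ ≡ true → adj G x x′ ≡ false
    ch-ch  : ∀ {x y x′ y′ l l′} → adj F x y ≡ true → adj F x′ y′ ≡ true → adj G (ch x y l) (ch x′ y′ l′) ≡ true → SamePair x y x′ y′
    br-ch  : ∀ {x y x′ y′ l} → adj F x y ≡ true → adj F x′ y′ ≡ true → adj G x (ch x′ y′ l) ≡ true → x ≡ x′ ⊎ x ≡ y′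
    end    : ∀ {x y} → adj F x y ≡ true → ∃ λ l → adj G x (ch x y l) ≡ true
    conn   : ∀ {x y} → adj F x y ≡ true → (g : Fin L → ℕ) →
             (∀ l l′ → adj G (ch x y l) (ch x y l′) ≡ true → g l ≡ g l′) → ∀ l l′ → g l ≡ g l′

n<2^n : ∀ n → n < 2 ^ n
n<2^n zero    = s≤s z≤n
n<2^n (suc n) = begin-strict
  suc n <⟨ s≤s (n<2^n n) ⟩
  1 + 2 ^ n ≤⟨ +-monoˡ-≤ (2 ^ n) (m^n>0 2 n) ⟩
  2 ^ n + 2 ^ n ≡⟨ cong (2 ^ n +_) (sym (+-identityʳ (2 ^ n))) ⟩
  2 ^ suc n ∎
  where open ≤-Reasoning

^-mono-< : ∀ a m → 0 < m → a ^ m < suc a ^ m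
^-mono-< a (suc zero)    _ = s≤s (≤-reflexive (trans (*-identityʳ a) (sym (*-identityʳ a))))
^-mono-< a (suc (suc m)) _ = begin-strict
  a * a ^ suc m ≤⟨ *-monoˡ-≤ (a ^ suc m) (n≤1+n a) ⟩
  suc a * a ^ suc m <⟨ *-monoʳ-< (suc a) (^-mono-< a (suc m) (s≤s z≤n)) ⟩
  suc a * suc a ^ suc m ∎
  where open ≤-Reasoning

-- The cost per vertex of a counted graph: c + 1 from smallness, L + 1 colours, and 2 because the
-- position of the root is bounded by M ≤ 2 ^ M.
base : ℕ → ℕ → ℕ
base c L = 2 * suc c * suc L

-- One more than the cost per chosen edge: there are at most 2 L vertices for each of them, and the
-- tree code adds a factor 2.
blocks : ℕ → ℕ → ℕ
blocks c L = suc (2 * base c L ^ (2 * L))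

sum-bit-any : ∀ {s} {P : Fin s → Set} (P? : ∀ i → Dec (P i)) → bit (does (any? P?)) ≤ sum (λ i → bit (does (P? i)))
sum-bit-any P? with any? P?
... | yes (i , p) = ≤-trans (≤-reflexive (sym (cong bit (does-true (P? i) p)))) (term≤sum (λ i → bit (does (P? i))) i)
... | no _ = z≤n

bit-≤ : ∀ b {n} → (b ≡ true → 1 ≤ n) → bit b ≤ n
bit-≤ true  f = f refl
bit-≤ false f = z≤n

bit-does : ∀ {P : Set} (d : Dec P) {n} → (P → 1 ≤ n) → bit (does d) ≤ n
bit-does (yes p) f = f p
bit-does (no _)  f = z≤n

samePair-count : ∀ {N} (a b : Fin N) → sum (λ x → sum (λ y → bit (does (samePair? x y a b)))) ≤ 2
samePair-count {N} a b = begin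
  sum (λ x → sum (λ y → bit (does (samePair? x y a b)))) ≤⟨ sum-mono (λ x → sum-mono λ y → bound x y) ⟩
  sum (λ x → sum (λ y → bit (δ a x) * bit (δ b y) + bit (δ b x) * bit (δ a y))) ≡⟨ sum-cong-≗ (λ x → trans (∑-distrib-+ (λ y → bit (δ a x) * bit (δ b y)) _) (cong₂ _+_ (row a b x) (row b a x))) ⟩
  sum (λ x → bit (δ a x) + bit (δ b x)) ≡⟨ trans (∑-distrib-+ (bit ∘ δ a) (bit ∘ δ b)) (cong₂ _+_ (#-δ a) (#-δ b)) ⟩
  2 ∎
  where
    open ≤-Reasoning
    row : ∀ a b x → sum (λ y → bit (δ a x) * bit (δ b y)) ≡ bit (δ a x)
    row a b x = trans (sum-*ˡ (bit (δ a x)) (bit ∘ δ b)) (trans (cong (bit (δ a x) *_) (#-δ b)) (*-identityʳ _))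
    bound : ∀ x y → bit (does (samePair? x y a b)) ≤ bit (δ a x) * bit (δ b y) + bit (δ b x) * bit (δ a y)
    bound x y = bit-does (samePair? x y a b) λ where
      (inj₁ (refl , refl)) → ≤-trans (≤-reflexive (sym (cong₂ (λ p q → bit p * bit q) (∈δ x) (∈δ y)))) (m≤m+n _ _)
      (inj₂ (refl , refl)) → ≤-trans (≤-reflexive (sym (cong₂ (λ p q → bit p * bit q) (∈δ x) (∈δ y)))) (m≤n+m _ _)

module BoundedDegree (X : GraphFamily) (her : Hereditary X) (c : ℕ) (small : ∀ n → CardX≤ X n (n ! * c ^ n))
  {N} (G : Graph N) (G∈X : X N G) {L} (0<L : 0 < L) (Sd : Subdivision G L) where
  open Subdivision Sd

  module Pool (S : Subset N) (pos : 0 < # S) (q : ℕ) (2≤q : 2 ≤ q)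
    (cross : Crossing F S)
    {p} (vs : Vec (Fin N) (suc p)) (t : Tree F vs) (vs∈S : ∀ i → lookup vs i ∈ S) (cover : ∀ v → v ∈ S → ∃ λ i → lookup vs i ≡ v)
    (k m : ℕ) (m≡ : m ≡ suc p * q) (k>0 : 0 < k) (dense : 2 * (q * k + 1) * # S ≤ E F S) where

    vs-inj : Injective _≡_ _≡_ (lookup vs)
    vs-inj = tree-injective t

    TreePair : Fin N → Fin N → Set
    TreePair x y = ∃ λ e → SamePair x y (lookup vs (parent t e)) (lookup vs (inject₁ e))

    treePair? : ∀ x y → Dec (TreePair x y)
    treePair? x y = any? (λ e → samePair? x y (lookup vs (parent t e)) (lookup vs (inject₁ e)))

    R : Fin N → Subset N
    R x y = does (toℕ x <? toℕ y) ∧ ((S x ∧ (S y ∧ adj F x y)) ∧ not (does (treePair? x y)))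

    suc-p≤ : suc p ≤ # S
    suc-p≤ = begin
      suc p ≡⟨ *-identityʳ (suc p) ⟨
      suc p * 1 ≡⟨ sum-const (suc p) 1 ⟨
      sum {suc p} (λ _ → 1) ≡⟨ sum-cong-≗ {suc p} (λ i → sym (cong bit (vs∈S i))) ⟩
      sum (λ i → bit (S (lookup vs i))) ≤⟨ sum-injective-≤ vs-inj (bit ∘ S) ⟩
      # S ∎
      where open ≤-Reasoning

    R-intro : ∀ x y → S x ∧ (S y ∧ adj F x y) ≡ true → toℕ x < toℕ y → ¬ (does (treePair? x y) ≡ true) → y ∈ R x
    R-intro x y s lt nt = ∧-intro (does-true (toℕ x <? toℕ y) lt) (∧-intro s (not-intro nt))

    pair-bound : ∀ x y → bit (S x) * bit (S y ∧ adj F x y) ≤ bit (R x y) + bit (R y x) + bit (does (treePair? x y))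
    pair-bound x y = ≤-trans (≤-reflexive (sym (bit-∧ (S x) (S y ∧ adj F x y)))) (bit-≤ (S x ∧ (S y ∧ adj F x y)) λ s →
      case treePair? x y of λ where
        (yes e) → ≤-trans (≤-reflexive (sym (cong bit (does-true (treePair? x y) e)))) (m≤n+m _ (bit (R x y) + bit (R y x)))
        (no ne) → ≤-trans (ordered x y s ne) (m≤m+n (bit (R x y) + bit (R y x)) _))
      where
        ordered : ∀ x y → S x ∧ (S y ∧ adj F x y) ≡ true → ¬ TreePair x y → 1 ≤ bit (R x y) + bit (R y x)
        ordered x y s ne with <-cmp (toℕ x) (toℕ y)
        ... | tri< lt _ _ = ≤-trans (≤-reflexive (sym (cong bit (R-intro x y s lt (ne ∘ does-elim (treePair? x y)))))) (m≤m+n _ _)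
        ... | tri≈ _ e _ = ⊥-elim (true≢false (∧-elimʳ {S y} (∧-elimʳ {S x} s)) (subst (λ z → adj F x z ≡ false) (toℕ-injective e) (adj-irrefl F x)))
        ... | tri> _ _ gt = ≤-trans (≤-reflexive (sym (cong bit (R-intro y x
            (∧-intro (∧-elimˡ {S y} (∧-elimʳ {S x} s)) (∧-intro (∧-elimˡ {S x} s) (trans (adj-sym F y x) (∧-elimʳ {S y} (∧-elimʳ {S x} s))))) gt
            λ q → ne (let e , sp = does-elim (treePair? y x) q in e , SamePair-swapˡ sp))))) (m≤n+m _ (bit (R x y)))

    E-bound : E F S ≤ 2 * sum (# ∘ R) + 2 * p
    E-bound = begin
      E F S ≡⟨ sum-cong-≗ (λ x → sym (sum-*ˡ (bit (S x)) (λ y → bit (S y ∧ adj F x y)))) ⟩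
      sum (λ x → sum (λ y → bit (S x) * bit (S y ∧ adj F x y))) ≤⟨ sum-mono (λ x → sum-mono λ y → pair-bound x y) ⟩
      sum (λ x → sum (λ y → bit (R x y) + bit (R y x) + tp x y)) ≡⟨ sum-cong-≗ (λ x → trans (∑-distrib-+ (λ y → bit (R x y) + bit (R y x)) (tp x)) (cong (_+ sum (tp x)) (∑-distrib-+ (bit ∘ R x) (λ y → bit (R y x))))) ⟩
      sum (λ x → # (R x) + sum (λ y → bit (R y x)) + sum (tp x)) ≡⟨ trans (∑-distrib-+ (λ x → # (R x) + sum (λ y → bit (R y x))) (λ x → sum (tp x))) (cong (_+ sum (λ x → sum (tp x))) (∑-distrib-+ (# ∘ R) (λ x → sum (λ y → bit (R y x))))) ⟩
      sum (# ∘ R) + sum (λ x → sum (λ y → bit (R y x))) + sum (λ x → sum (tp x)) ≡⟨ cong (λ z → sum (# ∘ R) + z + sum (λ x → sum (tp x))) (∑-comm (λ x y → bit (R y x))) ⟩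
      sum (# ∘ R) + sum (# ∘ R) + sum (λ x → sum (tp x)) ≤⟨ +-mono-≤ (≤-reflexive (cong (sum (# ∘ R) +_) (sym (+-identityʳ _)))) tree-count ⟩
      2 * sum (# ∘ R) + 2 * p ∎
      where
        open ≤-Reasoning
        tp : Fin N → Fin N → ℕ
        tp x y = bit (does (treePair? x y))
        te : Fin p → Fin N → Fin N → ℕ
        te e x y = bit (does (samePair? x y (lookup vs (parent t e)) (lookup vs (inject₁ e))))
        tree-count : sum (λ x → sum (tp x)) ≤ 2 * p
        tree-count = begin
          sum (λ x → sum (tp x)) ≤⟨ sum-mono (λ x → sum-mono λ y → sum-bit-any (λ e → samePair? x y (lookup vs (parent t e)) (lookup vs (inject₁ e)))) ⟩
          sum (λ x → sum (λ y → sum (λ e → te e x y))) ≡⟨ sum-cong-≗ (λ x → ∑-comm (λ y e → te e x y)) ⟩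
          sum (λ x → sum (λ e → sum (λ y → te e x y))) ≡⟨ ∑-comm (λ x e → sum (λ y → te e x y)) ⟩
          sum (λ e → sum (λ x → sum (λ y → te e x y))) ≤⟨ sum-mono (λ e → samePair-count (lookup vs (parent t e)) (lookup vs (inject₁ e))) ⟩
          sum {p} (λ _ → 2) ≡⟨ trans (sum-const p 2) (*-comm p 2) ⟩
          2 * p ∎

    -- The summand 1 in the density pays for the tree edges, which are left out of the pool.
    pool-size : m * k ≤ sum (# ∘ R)
    pool-size = *-cancelˡ-≤ 2 (+-cancelʳ-≤ (2 * p) _ _ (begin
      2 * (m * k) + 2 * p ≡⟨ cong (λ z → 2 * (z * k) + 2 * p) m≡ ⟩
      2 * (suc p * q * k) + 2 * p ≤⟨ +-monoʳ-≤ (2 * (suc p * q * k)) (*-monoʳ-≤ 2 (n≤1+n p)) ⟩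
      2 * (suc p * q * k) + 2 * suc p ≡⟨ r (suc p) q k ⟩
      2 * (q * k + 1) * suc p ≤⟨ *-monoʳ-≤ (2 * (q * k + 1)) suc-p≤ ⟩
      2 * (q * k + 1) * # S ≤⟨ dense ⟩
      E F S ≤⟨ E-bound ⟩
      2 * sum (# ∘ R) + 2 * p ∎))
      where
        open ≤-Reasoning
        r : ∀ n q k → 2 * (n * q * k) + 2 * n ≡ 2 * (q * k + 1) * n
        r = solve-∀

    R-elim : ∀ x y → y ∈ R x → (toℕ x < toℕ y × S x ∧ (S y ∧ adj F x y) ≡ true) × ¬ TreePair x y
    R-elim x y p = (does-elim (toℕ x <? toℕ y) (∧-elimˡ p) , ∧-elimˡ {S x ∧ (S y ∧ adj F x y)} w) ,
      λ e → not-elim (∧-elimʳ {S x ∧ (S y ∧ adj F x y)} w) (does-true (treePair? x y) e)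
      where w = ∧-elimʳ {does (toℕ x <? toℕ y)} p

    -- The non-tree edges, each taken once in increasing order, are cut into m blocks of k; a choice
    -- χ takes one edge of each block.
    pool : Fin m → Fin k → Fin N × Fin N
    pool j i = enum₂ R (inject≤ (combine j i) pool-size)

    pool-ok : ∀ j i → let x , y = pool j i in (toℕ x < toℕ y × S x ∧ (S y ∧ adj F x y) ≡ true) × ¬ TreePair x y
    pool-ok j i = R-elim _ _ (enum₂-∈ R _)

    pool-injective : ∀ j i j′ i′ → pool j i ≡ pool j′ i′ → j ≡ j′ × i ≡ i′
    pool-injective j i j′ i′ eq = combine-injective j i j′ i′ (inject≤-injective pool-size pool-size _ _ (enum₂-injective R eq))

    -- The conditions on a subdivision speak only of ends of edges of F, so every tree vertex needs
    -- such an edge. An isolated vertex contradicts connectedness unless it is all of S, which the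
    -- density rules out.
    branch-edge : ∀ i → ∃ λ y → adj F (lookup vs i) y ≡ true
    branch-edge i with deg F S (lookup vs i) in eq
    ... | suc d = let y , y∈ = #-pos⁻¹ (S ∩ adj F (lookup vs i)) (subst (0 <_) (sym eq) (s≤s z≤n)) in y , ∧-elimʳ {S y} y∈
    ... | zero  = ⊥-elim (isolated (crossed i))
      where
        isolated : (∃₂ λ u w → u ∈ (S ∩ δ (lookup vs i)) × w ∈ (S ∖ δ (lookup vs i)) × adj F u w ≡ true) → ⊥
        isolated (u , w , u∈ , w∈ , a) with refl ← ∈δ⇒≡ {v = lookup vs i} {u} (∧-elimʳ {S u} u∈) =
          <⇒≱ (#-pos (S ∩ adj F (lookup vs i)) w (∧-intro (∧-elimˡ w∈) a)) (≤-reflexive eq)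
        crossed : ∀ i → ∃₂ λ u w → u ∈ (S ∩ δ (lookup vs i)) × w ∈ (S ∖ δ (lookup vs i)) × adj F u w ≡ true
        crossed i = cross (δ (lookup vs i)) (lookup vs i , ∧-intro (vs∈S i) (∈δ (lookup vs i))) other
          where
            other : ∃ λ w → w ∈ (S ∖ δ (lookup vs i))
            other with any? (λ w → w ∈? (S ∖ δ (lookup vs i)))
            ... | yes r = r
            ... | no none = ⊥-elim (<⇒≱ big (begin
                E F S ≤⟨ E-remove F S (lookup vs i) ⟩
                E F (S ∖ δ (lookup vs i)) + 2 * deg F S (lookup vs i) ≤⟨ +-mono-≤ (≤-reflexive (E-empty F (S ∖ δ (lookup vs i)) none′)) (*-monoʳ-≤ 2 (deg≤# F S (lookup vs i))) ⟩
                2 * # S ∎))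
              where
                open ≤-Reasoning
                none′ : # (S ∖ δ (lookup vs i)) ≡ 0
                none′ = sum-0 λ w → cong bit (¬true⇒false λ w∈ → none (w , w∈))
                big : 2 * # S < E F S
                big = <-≤-trans (begin-strict
                  2 * # S ≡⟨ cong (_* # S) (sym (*-identityʳ 2)) ⟩
                  2 * 1 * # S <⟨ *-monoˡ-< (# S) ⦃ >-nonZero pos ⦄ (*-monoʳ-< 2 {1} {q * k + 1} (≤-trans (+-mono-≤ {1} {q * k} {1} {1} (*-mono-≤ {1} {q} {1} {k} (≤-trans (s≤s z≤n) 2≤q) k>0) ≤-refl) ≤-refl)) ⟩
                  2 * (q * k + 1) * # S ∎) dense

  module Core (S : Subset N) (pos : 0 < # S) (D q : ℕ) (D<2^q : suc D ≤ 2 ^ q) (2≤q : 2 ≤ q) (max-deg : ∀ v → v ∈ S → deg F S v ≤ D)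
    {p} (vs : Vec (Fin N) (suc p)) (t : Tree F vs) (vs∈S : ∀ i → lookup vs i ∈ S) (cover : ∀ v → v ∈ S → ∃ λ i → lookup vs i ≡ v)
    (branch-edge : ∀ i → ∃ λ y → adj F (lookup vs i) y ≡ true)
    (k m : ℕ) (m≡ : m ≡ suc p * q) (pool : Fin m → Fin k → Fin N × Fin N) (pool-inj : ∀ j i j′ i′ → pool j i ≡ pool j′ i′ → j ≡ j′ × i ≡ i′)
    (pool-< : ∀ j i → toℕ (proj₁ (pool j i)) < toℕ (proj₂ (pool j i)))
    (pool-S : ∀ j i → S (proj₁ (pool j i)) ∧ (S (proj₂ (pool j i)) ∧ adj F (proj₁ (pool j i)) (proj₂ (pool j i))) ≡ true)
    (pool-tree : ∀ j i e → ¬ SamePair (proj₁ (pool j i)) (proj₂ (pool j i)) (lookup vs (parent t e)) (lookup vs (inject₁ e))) where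

    vs-inj : Injective _≡_ _≡_ (lookup vs)
    vs-inj = tree-injective t

    edge : (Fin m → Fin k) → Fin p ⊎ Fin m → Fin N × Fin N
    edge χ (inj₁ e) = lookup vs (parent t e) , lookup vs (inject₁ e)
    edge χ (inj₂ j) = pool j (χ j)

    src tgt : (Fin m → Fin k) → Fin p ⊎ Fin m → Fin N
    src χ e = proj₁ (edge χ e)
    tgt χ e = proj₂ (edge χ e)

    edge-F : ∀ χ e → adj F (src χ e) (tgt χ e) ≡ true
    edge-F χ (inj₁ e) = parent-adj t e
    edge-F χ (inj₂ j) = let x , y = pool j (χ j) in ∧-elimʳ {S y} (∧-elimʳ {S x} (pool-S j (χ j)))

    src-∈ : ∀ χ e → src χ e ∈ S
    src-∈ χ (inj₁ e) = vs∈S _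
    src-∈ χ (inj₂ j) = ∧-elimˡ (pool-S j (χ j))

    tgt-∈ : ∀ χ e → tgt χ e ∈ S
    tgt-∈ χ (inj₁ e) = vs∈S _
    tgt-∈ χ (inj₂ j) = let x , y = pool j (χ j) in ∧-elimˡ (∧-elimʳ {S x} (pool-S j (χ j)))

    -- Tree edges lead from a larger to a smaller tree index and chosen edges increase, so no edge
    -- is the reverse of another of its kind; the pool avoids the tree.
    edge-inj : ∀ χ χ′ e e′ → SamePair (src χ e) (tgt χ e) (src χ′ e′) (tgt χ′ e′) → e ≡ e′ × edge χ e ≡ edge χ′ e′
    edge-inj χ χ′ (inj₁ e) (inj₁ e′) (inj₁ (_ , p₂)) with refl ← inject₁-injective (vs-inj p₂) = refl , refl
    edge-inj χ χ′ (inj₁ e) (inj₁ e′) (inj₂ (p₁ , p₂)) = ⊥-elim (<-asym (step e e′ (vs-inj p₁)) (step e′ e (sym (vs-inj p₂))))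
      where step : ∀ e e′ → parent t e ≡ inject₁ e′ → toℕ e < toℕ e′
            step e e′ eq = subst (toℕ e <_) (trans (cong toℕ eq) (toℕ-inject₁ e′)) (parent-later t e)
    edge-inj χ χ′ (inj₁ e) (inj₂ j) s = ⊥-elim (pool-tree j (χ′ j) e (SamePair-sym s))
    edge-inj χ χ′ (inj₂ j) (inj₁ e) s = ⊥-elim (pool-tree j (χ j) e s)
    edge-inj χ χ′ (inj₂ j) (inj₂ j′) (inj₁ (p₁ , p₂)) with refl , _ ← pool-inj j (χ j) j′ (χ′ j′) (cong₂ _,_ p₁ p₂) = refl , cong₂ _,_ p₁ p₂
    edge-inj χ χ′ (inj₂ j) (inj₂ j′) (inj₂ (p₁ , p₂)) =
      ⊥-elim (<-asym (pool-< j (χ j)) (subst (λ z → toℕ (tgt χ (inj₂ j)) < toℕ z) (sym p₁) (subst (λ z → toℕ z < toℕ (tgt χ′ (inj₂ j′))) (sym p₂) (pool-< j′ (χ′ j′)))))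

    I : Set
    I = Fin (suc p) ⊎ (Fin p ⊎ Fin m) × Fin L

    M = suc p + (p + m) * L

    chunkIndex : Fin (p + m) × Fin L → I
    chunkIndex (e , l) = inj₂ (splitAt p e , l)

    dec : Fin M → I
    dec a = [ inj₁ , chunkIndex ∘ remQuot {p + m} L ]′ (splitAt (suc p) a)

    enc : I → Fin M
    enc (inj₁ i)       = i ↑ˡ ((p + m) * L)
    enc (inj₂ (e , l)) = suc p ↑ʳ combine (join p m e) l

    dec-enc : ∀ x → dec (enc x) ≡ x
    dec-enc (inj₁ i) = cong [ inj₁ , chunkIndex ∘ remQuot {p + m} L ]′ (splitAt-↑ˡ (suc p) i ((p + m) * L))
    dec-enc (inj₂ (e , l)) = begin
      dec (enc (inj₂ (e , l))) ≡⟨ cong [ inj₁ , chunkIndex ∘ remQuot {p + m} L ]′ (splitAt-↑ʳ (suc p) ((p + m) * L) (combine (join p m e) l)) ⟩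
      chunkIndex (remQuot {p + m} L (combine (join p m e) l)) ≡⟨ cong chunkIndex (remQuot-combine (join p m e) l) ⟩
      chunkIndex (join p m e , l) ≡⟨ cong (λ z → inj₂ (z , l)) (splitAt-join p m e) ⟩
      inj₂ (e , l) ∎
      where open ≡-Reasoning

    enc-split : ∀ z → enc ([ inj₁ , chunkIndex ∘ remQuot {p + m} L ]′ z) ≡ join (suc p) ((p + m) * L) z
    enc-split (inj₁ i) = refl
    enc-split (inj₂ r) = cong (suc p ↑ʳ_) (trans (cong (λ z → combine z (proj₂ (remQuot {p + m} L r))) (join-splitAt p m (proj₁ (remQuot {p + m} L r)))) (combine-remQuot {p + m} L r))

    enc-dec : ∀ a → enc (dec a) ≡ a
    enc-dec a = trans (enc-split (splitAt (suc p) a)) (join-splitAt (suc p) ((p + m) * L) a)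

    vI : (Fin m → Fin k) → I → Fin N
    vI χ (inj₁ i)       = lookup vs i
    vI χ (inj₂ (e , l)) = ch (src χ e) (tgt χ e) l

    v : (Fin m → Fin k) → Fin M → Fin N
    v χ a = vI χ (dec a)

    vI-inj : ∀ χ χ′ x x′ → vI χ x ≡ vI χ′ x′ → x ≡ x′
    vI-inj χ χ′ (inj₁ i) (inj₁ i′) eq = cong inj₁ (vs-inj eq)
    vI-inj χ χ′ (inj₁ i) (inj₂ (e , l)) eq = ⊥-elim (ch-br (edge-F χ′ e) (proj₂ (branch-edge i)) (sym eq))
    vI-inj χ χ′ (inj₂ (e , l)) (inj₁ i) eq = ⊥-elim (ch-br (edge-F χ e) (proj₂ (branch-edge i)) eq)
    vI-inj χ χ′ (inj₂ (e , l)) (inj₂ (e′ , l′)) eq with refl , s ← ch-inj (edge-F χ e) (edge-F χ′ e′) eq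
      with refl , _ ← edge-inj χ χ′ e e′ s = refl

    v-inj : ∀ χ χ′ a a′ → v χ a ≡ v χ′ a′ → a ≡ a′
    v-inj χ χ′ a a′ eq = trans (sym (enc-dec a)) (trans (cong enc (vI-inj χ χ′ (dec a) (dec a′) eq)) (enc-dec a′))

    l₀ : Fin L
    l₀ = fromℕ< 0<L

    v-χ : ∀ χ χ′ → (∀ a → v χ a ≡ v χ′ a) → ∀ j → χ j ≡ χ′ j
    v-χ χ χ′ eq j = proj₂ (pool-inj j (χ j) j (χ′ j) (proj₂ (edge-inj χ χ′ (inj₂ j) (inj₂ j)
      (proj₂ (ch-inj (edge-F χ (inj₂ j)) (edge-F χ′ (inj₂ j)) (subst (λ x → vI χ x ≡ vI χ′ x) (dec-enc (inj₂ (inj₂ j , l₀))) (eq (enc (inj₂ (inj₂ j , l₀))))))))))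

    -- The colours make isomorphisms preserve branch vertices and the position of a vertex in its
    -- chunk.
    colI : I → Fin (suc L)
    colI (inj₁ i)       = zero
    colI (inj₂ (e , l)) = suc l

    col : Fin M → Fin (suc L)
    col a = colI (dec a)

    colI-zero : ∀ x → colI x ≡ zero → ∃ λ i → x ≡ inj₁ i
    colI-zero (inj₁ i) _ = i , refl

    colI-suc : ∀ x {l} → colI x ≡ suc l → ∃ λ e → x ≡ inj₂ (e , l)
    colI-suc (inj₂ (e , l)) refl = e , refl

    φ : (Fin m → Fin k) → (Fin M → Fin M) → Fin (suc p) → Fin N
    φ χ ψ i = v χ (ψ (enc (inj₁ i)))

    -- The chosen edges need no code of their own: the tree spans S, so their ends are tree
    -- vertices, and the images of the ends determine the image of the chunk.
    code : (χ₀ χ₁ : Fin m → Fin k) → (Fin M → Fin M) → Fin (M * suc D ^ p)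
    code χ₀ χ₁ ψ = combine (ψ (enc (inj₁ (fromℕ p)))) (funToFin (λ e → clamp D (treeCode t F S (φ χ₁ ψ) e)))

    module Embedding (χ₀ χ₁ : Fin m → Fin k) (ψ : Fin M → Fin M) (iso : ColourIso G col (v χ₀) (v χ₁) ψ) where
      open ColourIso iso renaming (inj to ψ-inj)

      ψI : I → I
      ψI x = dec (ψ (enc x))

      ψI-inj : ∀ {x y} → ψI x ≡ ψI y → x ≡ y
      ψI-inj {x} {y} eq = trans (sym (dec-enc x)) (trans (cong dec (ψ-inj (trans (sym (enc-dec _)) (trans (cong enc eq) (enc-dec _))))) (dec-enc y))

      ψI-col : ∀ x → colI (ψI x) ≡ colI x
      ψI-col x = trans (colours (enc x)) (cong colI (dec-enc x))

      ψI-adj : ∀ x y → adj G (vI χ₀ x) (vI χ₀ y) ≡ true → adj G (vI χ₁ (ψI x)) (vI χ₁ (ψI y)) ≡ true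
      ψI-adj x y a = trans (sym (edges (enc x) (enc y))) (trans (cong₂ (λ x y → adj G (vI χ₀ x) (vI χ₀ y)) (dec-enc x) (dec-enc y)) a)

      br-image : ∀ i → ∃ λ i′ → ψI (inj₁ i) ≡ inj₁ i′
      br-image i = colI-zero (ψI (inj₁ i)) (ψI-col (inj₁ i))

      ch-image : ∀ e l → ∃ λ e′ → ψI (inj₂ (e , l)) ≡ inj₂ (e′ , l)
      ch-image e l = colI-suc (ψI (inj₂ (e , l))) (ψI-col (inj₂ (e , l)))

      φ-∈ : ∀ i → φ χ₁ ψ i ∈ S
      φ-∈ i = let i′ , eq = br-image i in subst (_∈ S) (cong (vI χ₁) (sym eq)) (vs∈S i′)

      φ-inj : ∀ {i j} → φ χ₁ ψ i ≡ φ χ₁ ψ j → i ≡ j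
      φ-inj {i} {j} eq = inj₁-injective (ψI-inj (vI-inj χ₁ χ₁ _ _ eq))
        where open import Data.Sum.Properties using (inj₁-injective)

      φ-edge : ∀ i → ∃ λ y → adj F (φ χ₁ ψ i) y ≡ true
      φ-edge i = let i′ , eq = br-image i ; y , a = branch-edge i′ in y , subst (λ z → adj F z y ≡ true) (cong (vI χ₁) (sym eq)) a

      -- A chunk is mapped onto a chunk, because it is connected, and its ends determine which one.
      chunk : ∀ e i j → lookup vs i ≡ src χ₀ e → lookup vs j ≡ tgt χ₀ e →
        adj F (φ χ₁ ψ i) (φ χ₁ ψ j) ≡ true × (∀ l → vI χ₁ (ψI (inj₂ (e , l))) ≡ ch (φ χ₁ ψ i) (φ χ₁ ψ j) l)
      chunk e i j ei ej = finish pair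
        where
          im : Fin L → Fin p ⊎ Fin m
          im l = proj₁ (ch-image e l)
          at : ∀ l → vI χ₁ (ψI (inj₂ (e , l))) ≡ ch (src χ₁ (im l)) (tgt χ₁ (im l)) l
          at l = cong (vI χ₁) (proj₂ (ch-image e l))
          index : Fin L → ℕ
          index l = toℕ (join p m (im l))
          join-inj : ∀ {x y : Fin p ⊎ Fin m} → toℕ (join p m x) ≡ toℕ (join p m y) → x ≡ y
          join-inj {x} {y} eq = trans (sym (splitAt-join p m x)) (trans (cong (splitAt p) (toℕ-injective eq)) (splitAt-join p m y))
          constant : ∀ l → im l ≡ im l₀
          constant l = join-inj (conn (edge-F χ₀ e) index
            (λ l l′ a → cong (toℕ ∘ join p m) (proj₁ (edge-inj χ₁ χ₁ (im l) (im l′) (ch-ch (edge-F χ₁ (im l)) (edge-F χ₁ (im l′))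
              (subst (λ z → adj G z (ch (src χ₁ (im l′)) (tgt χ₁ (im l′)) l′) ≡ true) (at l)
                (subst (λ z → adj G (vI χ₁ (ψI (inj₂ (e , l)))) z ≡ true) (at l′) (ψI-adj (inj₂ (e , l)) (inj₂ (e , l′)) a))))))) l l₀)
          e* = im l₀
          x* = src χ₁ e*
          y* = tgt χ₁ e*
          at* : ∀ l → vI χ₁ (ψI (inj₂ (e , l))) ≡ ch x* y* l
          at* l = trans (at l) (cong (λ z → ch (src χ₁ z) (tgt χ₁ z) l) (constant l))
          touch : ∀ i l → adj G (lookup vs i) (ch (src χ₀ e) (tgt χ₀ e) l) ≡ true → φ χ₁ ψ i ≡ x* ⊎ φ χ₁ ψ i ≡ y*
          touch i l a = br-ch (proj₂ (φ-edge i)) (edge-F χ₁ e*) (subst (λ z → adj G (φ χ₁ ψ i) z ≡ true) (at* l) (ψI-adj (inj₁ i) (inj₂ (e , l)) a))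
          F₀ = edge-F χ₀ e
          F₀′ : adj F (tgt χ₀ e) (src χ₀ e) ≡ true
          F₀′ = trans (adj-sym F _ _) F₀
          touch-i : φ χ₁ ψ i ≡ x* ⊎ φ χ₁ ψ i ≡ y*
          touch-i = let l , a = end F₀ in touch i l (subst (λ z → adj G z (ch (src χ₀ e) (tgt χ₀ e) l) ≡ true) (sym ei) a)
          touch-j : φ χ₁ ψ j ≡ x* ⊎ φ χ₁ ψ j ≡ y*
          touch-j = let l , a = end F₀′ in touch j l (subst (λ z → adj G z (ch (src χ₀ e) (tgt χ₀ e) l) ≡ true) (sym ej)
            (subst (λ z → adj G (tgt χ₀ e) z ≡ true) (ch-sym _ _ l F₀′) a))
          i≢j : φ χ₁ ψ i ≢ φ χ₁ ψ j
          i≢j eq = true≢false F₀ (subst (λ z → adj F (src χ₀ e) z ≡ false) (trans (sym ei) (trans (cong (lookup vs) (φ-inj eq)) ej)) (adj-irrefl F _))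
          pair : SamePair (φ χ₁ ψ i) (φ χ₁ ψ j) x* y*
          pair = both i≢j touch-i touch-j
            where
              both : ∀ {u w x y : Fin N} → u ≢ w → u ≡ x ⊎ u ≡ y → w ≡ x ⊎ w ≡ y → SamePair u w x y
              both u≢w (inj₁ p) (inj₁ q) = ⊥-elim (u≢w (trans p (sym q)))
              both u≢w (inj₁ p) (inj₂ q) = inj₁ (p , q)
              both u≢w (inj₂ p) (inj₁ q) = inj₂ (p , q)
              both u≢w (inj₂ p) (inj₂ q) = ⊥-elim (u≢w (trans p (sym q)))
          finish : ∀ {u w} → SamePair u w x* y* → adj F u w ≡ true × (∀ l → vI χ₁ (ψI (inj₂ (e , l))) ≡ ch u w l)
          finish (inj₁ (refl , refl)) = edge-F χ₁ e* , at*
          finish (inj₂ (refl , refl)) = trans (adj-sym F _ _) (edge-F χ₁ e*) , λ l → trans (at* l) (ch-sym _ _ l (edge-F χ₁ e*))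

      tree-adj : ∀ e → adj F (φ χ₁ ψ (parent t e)) (φ χ₁ ψ (inject₁ e)) ≡ true
      tree-adj e = proj₁ (chunk (inj₁ e) (parent t e) (inject₁ e) refl refl)

      code≤D : ∀ e → treeCode t F S (φ χ₁ ψ) e ≤ D
      code≤D e = ≤-trans (<⇒≤ (rank< (S ∩ adj F (φ χ₁ ψ (parent t e))) (φ χ₁ ψ (inject₁ e)) (∧-intro (φ-∈ (inject₁ e)) (tree-adj e)))) (max-deg _ (φ-∈ (parent t e)))

    rigid : ∀ χ₀ χ₁ ψ₁ χ₂ ψ₂ → ColourIso G col (v χ₀) (v χ₁) ψ₁ → ColourIso G col (v χ₀) (v χ₂) ψ₂ →
      code χ₀ χ₁ ψ₁ ≡ code χ₀ χ₂ ψ₂ → ∀ a → v χ₁ (ψ₁ a) ≡ v χ₂ (ψ₂ a)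
    rigid χ₀ χ₁ ψ₁ χ₂ ψ₂ iso₁ iso₂ eq a = subst (λ a → v χ₁ (ψ₁ a) ≡ v χ₂ (ψ₂ a)) (enc-dec a) (onI (dec a))
      where
        module I₁ = Embedding χ₀ χ₁ ψ₁ iso₁
        module I₂ = Embedding χ₀ χ₂ ψ₂ iso₂
        eqs = combine-injective (ψ₁ (enc (inj₁ (fromℕ p)))) _ (ψ₂ (enc (inj₁ (fromℕ p)))) _ eq
        -- Branch vertices do not depend on the choice, so the same index gives the same vertex for
        -- χ₁ and χ₂.
        root-≡ : φ χ₁ ψ₁ (fromℕ p) ≡ φ χ₂ ψ₂ (fromℕ p)
        root-≡ with i , e₁ ← I₁.br-image (fromℕ p) | j , e₂ ← I₂.br-image (fromℕ p)
          with refl ← trans (sym e₁) (trans (cong dec (proj₁ eqs)) e₂) = trans (cong (vI χ₁) e₁) (cong (vI χ₂) (sym e₂))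
        φ≡ : ∀ i → φ χ₁ ψ₁ i ≡ φ χ₂ ψ₂ i
        φ≡ = tree-decode t F S (φ χ₁ ψ₁) (φ χ₂ ψ₂) I₁.φ-∈ I₂.φ-∈ I₁.tree-adj I₂.tree-adj root-≡
          λ e → clamp-injective D (I₁.code≤D e) (I₂.code≤D e) (funToFin-injective (proj₂ eqs) e)
        onI : ∀ x → v χ₁ (ψ₁ (enc x)) ≡ v χ₂ (ψ₂ (enc x))
        onI (inj₁ i) = φ≡ i
        onI (inj₂ (e , l)) with i , ei ← cover (src χ₀ e) (src-∈ χ₀ e) | j , ej ← cover (tgt χ₀ e) (tgt-∈ χ₀ e) =
          trans (proj₂ (I₁.chunk e i j ei ej) l) (trans (cong₂ (λ x y → ch x y l) (φ≡ i) (φ≡ j)) (sym (proj₂ (I₂.chunk e i j ei ej) l)))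

    counted : k ^ m ≤ (c * suc L) ^ M * (M * suc D ^ p)
    counted = counting X her c small G G∈X v v-inj v-χ col code rigid

    -- Since q ≥ 2, the tree vertices and the chunks on tree edges together take no more room than
    -- the m chosen chunks.
    M≤ : M ≤ 2 * L * m
    M≤ = begin
      suc p + (p + m) * L ≤⟨ +-monoʳ-≤ (suc p) (*-monoˡ-≤ L (+-monoˡ-≤ m (n≤1+n p))) ⟩
      suc p + (suc p + m) * L ≤⟨ +-monoˡ-≤ _ (m≤m*n (suc p) L ⦃ >-nonZero 0<L ⦄) ⟩
      suc p * L + (suc p + m) * L ≡⟨ r₁ (suc p) L m ⟩
      suc p * 2 * L + m * L ≤⟨ +-monoˡ-≤ (m * L) (*-monoˡ-≤ L (≤-trans (*-monoʳ-≤ (suc p) 2≤q) (≤-reflexive (sym m≡)))) ⟩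
      m * L + m * L ≡⟨ r₂ L m ⟩
      2 * L * m ∎
      where
        open ≤-Reasoning
        r₁ : ∀ n L m → n * L + (n + m) * L ≡ n * 2 * L + m * L
        r₁ = solve-∀
        r₂ : ∀ L m → m * L + m * L ≡ 2 * L * m
        r₂ = solve-∀

    impossible : k ≡ blocks c L → ⊥
    impossible refl = <⇒≱ (^-mono-< (2 * base c L ^ (2 * L)) m m>0) (begin
      k ^ m ≤⟨ counted ⟩
      (c * suc L) ^ M * (M * suc D ^ p) ≤⟨ *-mono-≤ (^-monoˡ-≤ M (*-monoˡ-≤ (suc L) (n≤1+n c))) (*-mono-≤ (<⇒≤ (n<2^n M)) tree-factor) ⟩
      (suc c * suc L) ^ M * (2 ^ M * 2 ^ m) ≡⟨ trans (sym (*-assoc ((suc c * suc L) ^ M) (2 ^ M) (2 ^ m))) (cong (_* 2 ^ m) (trans (*-comm ((suc c * suc L) ^ M) (2 ^ M)) (sym (^-distribʳ-* M 2 (suc c * suc L))))) ⟩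
      (2 * (suc c * suc L)) ^ M * 2 ^ m ≡⟨ cong (λ z → z ^ M * 2 ^ m) (sym (*-assoc 2 (suc c) (suc L))) ⟩
      base c L ^ M * 2 ^ m ≤⟨ *-monoˡ-≤ (2 ^ m) (^-monoʳ-≤ (base c L) M≤) ⟩
      base c L ^ (2 * L * m) * 2 ^ m ≡⟨ cong (_* 2 ^ m) (sym (^-*-assoc (base c L) (2 * L) m)) ⟩
      (base c L ^ (2 * L)) ^ m * 2 ^ m ≡⟨ trans (*-comm _ (2 ^ m)) (sym (^-distribʳ-* m 2 _)) ⟩
      (2 * base c L ^ (2 * L)) ^ m ∎)
      where
        open ≤-Reasoning
        m>0 : 0 < m
        m>0 = subst (0 <_) (sym m≡) (*-mono-≤ {1} {suc p} {1} {q} (s≤s z≤n) (≤-trans (s≤s z≤n) 2≤q))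
        -- Each tree vertex costs at most q bits and there are q chosen edges per tree vertex, so
        -- the tree costs one bit per chosen edge.
        tree-factor : suc D ^ p ≤ 2 ^ m
        tree-factor = begin
          suc D ^ p ≤⟨ ^-monoʳ-≤ (suc D) (n≤1+n p) ⟩
          suc D ^ suc p ≤⟨ ^-monoˡ-≤ (suc p) D<2^q ⟩
          (2 ^ q) ^ suc p ≡⟨ ^-*-assoc 2 q (suc p) ⟩
          2 ^ (q * suc p) ≡⟨ cong (2 ^_) (trans (*-comm q (suc p)) (sym m≡)) ⟩
          2 ^ m ∎

  bounded-degree-sparse : ∀ D q → suc D ≤ 2 ^ q → 2 ≤ q → ∀ S → (∀ v → v ∈ S → deg F S v ≤ D) → 0 < # S →
    E F S < 2 * (q * blocks c L + 1) * # S
  bounded-degree-sparse D q D<2^q 2≤q = no-dense F (2 * (q * blocks c L + 1)) (λ S → ∀ v → v ∈ S → deg F S v ≤ D)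
    (λ T⊆S P v v∈T → ≤-trans (deg-mono F T⊆S v) (P v (T⊆S v v∈T)))
    refute
    where
      refute : ∀ S → (∀ v → v ∈ S → deg F S v ≤ D) → 0 < # S → 2 * (q * blocks c L + 1) * # S ≤ E F S →
        (∀ T → T ⊆ S → # T < # S → 0 < # T → E F T < 2 * (q * blocks c L + 1) * # T) → ⊥
      refute S P pos dense sparser = go (spanning F S pos cross)
        where
          cross = MinimalDense.crossing F (2 * (q * blocks c L + 1)) S dense sparser
          go : (∃₂ λ n (vs : Vec (Fin N) (suc n)) → Tree F vs × (∀ i → lookup vs i ∈ S) × (∀ v → v ∈ S → ∃ λ i → lookup vs i ≡ v)) → ⊥
          go (p , vs , t , vs∈S , cover) = Core.impossible S pos D q D<2^q 2≤q P vs t vs∈S cover branch-edge (blocks c L) (suc p * q) refl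
            pool pool-injective (λ j i → proj₁ (proj₁ (pool-ok j i))) (λ j i → proj₂ (proj₁ (pool-ok j i))) (λ j i e s → proj₂ (pool-ok j i) (e , s)) refl
            where open Pool S pos q 2≤q cross vs t vs∈S cover (blocks c L) (suc p * q) refl (s≤s z≤n) dense

-- Subdivisions of arbitrary graphs

module Coarsen {N} {G : Graph N} {L} (Sd : Subdivision G L) (B Q : Subset N) (disjoint : ∀ v → v ∈ Q → v ∈ B → ⊥)
  (M : Matching B Q (λ b → Q ∩ adj (Subdivision.F Sd) b) (λ _ _ → false)) where
  open Subdivision Sd
  open Matching M

  chunk : Triple N → Fin L ⊎ Fin (suc L) → Fin N
  chunk (b , x , y) (inj₁ l)       = ch b x l
  chunk (b , x , y) (inj₂ zero)    = b
  chunk (b , x , y) (inj₂ (suc l)) = ch b y l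

  record Valid (t : Triple N) : Set where
    b = proj₁ t
    x = proj₁ (proj₂ t)
    y = proj₂ (proj₂ t)
    field
      {x̂ ŷ} : Fin N
      is    : pm x̂ ŷ ≡ just t
    b∈B : b ∈ B
    b∈B = pm-B is
    x∈Q : x ∈ Q
    x∈Q = ∧-elimˡ (pm-x is)
    y∈Q : y ∈ Q
    y∈Q = ∧-elimˡ (pm-y is)
    Fx : adj F b x ≡ true
    Fx = ∧-elimʳ {Q x} (pm-x is)
    Fy : adj F b y ≡ true
    Fy = ∧-elimʳ {Q y} (pm-y is)
    Fx′ : adj F x b ≡ true
    Fx′ = trans (adj-sym F x b) Fx
    Fy′ : adj F y b ≡ true
    Fy′ = trans (adj-sym F y b) Fy

  B≢Q : ∀ {b x} → b ∈ B → x ∈ Q → b ≢ x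
  B≢Q b∈ x∈ refl = disjoint _ x∈ b∈

  same-b : ∀ {t t′} → Valid t → Valid t′ → proj₁ t ≡ proj₁ t′ → t ≡ t′
  same-b V V′ refl with refl , refl ← pm-inj (Valid.is V) (Valid.is V′) = refl

  -- The chunks in use all join B to Q with the end in B written first, so a crossed coincidence
  -- would put a vertex in both sets.
  pair-b : ∀ {b x b′ x′} → b ∈ B → x′ ∈ Q → SamePair b x b′ x′ → b ≡ b′ × x ≡ x′
  pair-b b∈ x∈ (inj₁ p)       = p
  pair-b b∈ x∈ (inj₂ (p , _)) = ⊥-elim (B≢Q b∈ x∈ p)

  chunk-inj : ∀ {t t′} → Valid t → Valid t′ → ∀ i i′ → chunk t i ≡ chunk t′ i′ → i ≡ i′ × t ≡ t′
  chunk-inj V V′ (inj₁ l) (inj₁ l′) eq with refl , s ← ch-inj (Valid.Fx V) (Valid.Fx V′) eq =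
    refl , same-b V V′ (proj₁ (pair-b (Valid.b∈B V) (Valid.x∈Q V′) s))
  chunk-inj V V′ (inj₁ l) (inj₂ zero) eq = ⊥-elim (ch-br (Valid.Fx V) (Valid.Fx V′) eq)
  chunk-inj V V′ (inj₁ l) (inj₂ (suc l′)) eq with _ , s ← ch-inj (Valid.Fx V) (Valid.Fy V′) eq
    with p , q ← pair-b (Valid.b∈B V) (Valid.y∈Q V′) s with refl ← same-b V V′ p = ⊥-elim (pm-≢ (Valid.is V) q)
  chunk-inj V V′ (inj₂ zero) (inj₁ l′) eq = ⊥-elim (ch-br (Valid.Fx V′) (Valid.Fx V) (sym eq))
  chunk-inj V V′ (inj₂ zero) (inj₂ zero) eq = refl , same-b V V′ eq
  chunk-inj V V′ (inj₂ zero) (inj₂ (suc l′)) eq = ⊥-elim (ch-br (Valid.Fy V′) (Valid.Fx V) (sym eq))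
  chunk-inj V V′ (inj₂ (suc l)) (inj₁ l′) eq with _ , s ← ch-inj (Valid.Fy V) (Valid.Fx V′) eq
    with p , q ← pair-b (Valid.b∈B V) (Valid.x∈Q V′) s with refl ← same-b V V′ p = ⊥-elim (pm-≢ (Valid.is V) (sym q))
  chunk-inj V V′ (inj₂ (suc l)) (inj₂ zero) eq = ⊥-elim (ch-br (Valid.Fy V) (Valid.Fx V′) eq)
  chunk-inj V V′ (inj₂ (suc l)) (inj₂ (suc l′)) eq with refl , s ← ch-inj (Valid.Fy V) (Valid.Fy V′) eq =
    refl , same-b V V′ (proj₁ (pair-b (Valid.b∈B V) (Valid.y∈Q V′) s))

  flip-adj : ∀ {u w} → adj G u w ≡ true → adj G w u ≡ true
  flip-adj {u} {w} = trans (adj-sym G w u)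

  b-near : ∀ {b b′ x′ y′ l} → b ∈ B → x′ ∈ Q → adj F b y′ ≡ true → adj F b′ x′ ≡ true → adj G b (ch b′ x′ l) ≡ true → b ≡ b′
  b-near b∈ x∈ f f′ a with br-ch f f′ a
  ... | inj₁ p = p
  ... | inj₂ p = ⊥-elim (B≢Q b∈ x∈ p)

  chunk-adj : ∀ {t t′} → Valid t → Valid t′ → ∀ i i′ → adj G (chunk t i) (chunk t′ i′) ≡ true → t ≡ t′
  chunk-adj V V′ (inj₁ l) (inj₁ l′) a = same-b V V′ (proj₁ (pair-b (Valid.b∈B V) (Valid.x∈Q V′) (ch-ch (Valid.Fx V) (Valid.Fx V′) a)))
  chunk-adj V V′ (inj₁ l) (inj₂ zero) a = same-b V V′ (sym (b-near (Valid.b∈B V′) (Valid.x∈Q V) (Valid.Fx V′) (Valid.Fx V) (flip-adj a)))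
  chunk-adj V V′ (inj₁ l) (inj₂ (suc l′)) a = same-b V V′ (proj₁ (pair-b (Valid.b∈B V) (Valid.y∈Q V′) (ch-ch (Valid.Fx V) (Valid.Fy V′) a)))
  chunk-adj V V′ (inj₂ zero) (inj₁ l′) a = same-b V V′ (b-near (Valid.b∈B V) (Valid.x∈Q V′) (Valid.Fx V) (Valid.Fx V′) a)
  chunk-adj V V′ (inj₂ zero) (inj₂ zero) a = ⊥-elim (true≢false a (br-br (Valid.Fx V) (Valid.Fx V′)))
  chunk-adj V V′ (inj₂ zero) (inj₂ (suc l′)) a = same-b V V′ (b-near (Valid.b∈B V) (Valid.y∈Q V′) (Valid.Fx V) (Valid.Fy V′) a)
  chunk-adj V V′ (inj₂ (suc l)) (inj₁ l′) a = same-b V V′ (proj₁ (pair-b (Valid.b∈B V) (Valid.x∈Q V′) (ch-ch (Valid.Fy V) (Valid.Fx V′) a)))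
  chunk-adj V V′ (inj₂ (suc l)) (inj₂ zero) a = same-b V V′ (sym (b-near (Valid.b∈B V′) (Valid.y∈Q V) (Valid.Fx V′) (Valid.Fy V) (flip-adj a)))
  chunk-adj V V′ (inj₂ (suc l)) (inj₂ (suc l′)) a = same-b V V′ (proj₁ (pair-b (Valid.b∈B V) (Valid.y∈Q V′) (ch-ch (Valid.Fy V) (Valid.Fy V′) a)))

  chunk-br : ∀ {t u w} → Valid t → u ∈ Q → adj F u w ≡ true → ∀ i → chunk t i ≢ u
  chunk-br V u∈ f (inj₁ l)       eq = ch-br (Valid.Fx V) f eq
  chunk-br V u∈ f (inj₂ zero)    eq = B≢Q (Valid.b∈B V) u∈ eq
  chunk-br V u∈ f (inj₂ (suc l)) eq = ch-br (Valid.Fy V) f eq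

  chunk-near : ∀ {t u w} (V : Valid t) → u ∈ Q → adj F u w ≡ true → ∀ i → adj G u (chunk t i) ≡ true → u ≡ Valid.x V ⊎ u ≡ Valid.y V
  chunk-near V u∈ f (inj₁ l) a with br-ch f (Valid.Fx V) a
  ... | inj₁ p = ⊥-elim (B≢Q (Valid.b∈B V) u∈ (sym p))
  ... | inj₂ p = inj₁ p
  chunk-near V u∈ f (inj₂ zero) a = ⊥-elim (true≢false a (br-br f (Valid.Fx V)))
  chunk-near V u∈ f (inj₂ (suc l)) a with br-ch f (Valid.Fy V) a
  ... | inj₁ p = ⊥-elim (B≢Q (Valid.b∈B V) u∈ (sym p))
  ... | inj₂ p = inj₂ p

  end-at : ∀ {b x} → adj F b x ≡ true → ∃ λ l → adj G x (ch b x l) ≡ true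
  end-at {b} {x} f = let f′ = trans (adj-sym F x b) f ; l , a = end f′ in l , subst (λ z → adj G x z ≡ true) (ch-sym x b l f′) a

  ch′ : Fin N → Fin N → Fin (L + suc L) → Fin N
  ch′ x y i with pm x y
  ... | just t  = chunk t (splitAt L i)
  ... | nothing = x

  ch′-at : ∀ {x y t} → pm x y ≡ just t → ∀ i → ch′ x y i ≡ chunk t (splitAt L i)
  ch′-at {x} {y} eq i rewrite eq = refl

  valid : ∀ {x y} → adj pairs x y ≡ true → ∃ λ t → Valid t × pm x y ≡ just t
  valid {x} {y} a with t , eq ← triple {x} {y} a = t , record { is = eq } , eq

  branch : ∀ {x y} → adj pairs x y ≡ true → x ∈ Q × ∃ λ w → adj F x w ≡ true
  branch {x} {y} a with valid {x} {y} a
  ... | t , V , eq with pm-pair eq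
  ...   | inj₁ (refl , refl) = Valid.x∈Q V , _ , Valid.Fx′ V
  ...   | inj₂ (refl , refl) = Valid.y∈Q V , _ , Valid.Fy′ V

  joined : ∀ {x y x′ y′ t t′} → pm x y ≡ just t → pm x′ y′ ≡ just t′ → t ≡ t′ → SamePair x y x′ y′
  joined eq eq′ refl = SamePair-trans (pm-pair eq) (SamePair-sym (pm-pair eq′))

  -- A matched b, with its chunks towards x and y, replaces the pair x y. No pair has to be declared
  -- bad: branch vertices are pairwise non-adjacent in G, and edges of F inside Q disappear together
  -- with their chunks.
  coarse : Subdivision G (L + suc L)
  coarse = record
    { F = pairs ; ch = ch′ ; ch-sym = λ x y i a → ch-sym′ x y i a
    ; ch-inj = λ {x} {y} {x′} {y′} {i} {i′} a a′ eq → ch-inj′ x y x′ y′ i i′ a a′ eq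
    ; ch-br = λ {x} {y} {x′} {y′} {i} a a′ eq → ch-br′ x y x′ y′ i a a′ eq
    ; br-br = λ {x} {y} {x′} {y′} a a′ → br-br (proj₂ (proj₂ (branch {x} {y} a))) (proj₂ (proj₂ (branch {x′} {y′} a′)))
    ; ch-ch = λ {x} {y} {x′} {y′} {i} {i′} a a′ e → ch-ch′ x y x′ y′ i i′ a a′ e
    ; br-ch = λ {x} {y} {x′} {y′} {i} a a′ e → br-ch′ x y x′ y′ i a a′ e
    ; end = λ {x} {y} a → end′ x y a
    ; conn = λ {x} {y} a g h i j → trans (middle x y a g h i) (sym (middle x y a g h j)) }
    where
      ch-sym′ : ∀ x y i → adj pairs x y ≡ true → ch′ x y i ≡ ch′ y x i
      ch-sym′ x y i a = let t , _ , eq = valid {x} {y} a in trans (ch′-at eq i) (sym (ch′-at (trans (pm-sym y x) eq) i))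
      ch-inj′ : ∀ x y x′ y′ i i′ → adj pairs x y ≡ true → adj pairs x′ y′ ≡ true → ch′ x y i ≡ ch′ x′ y′ i′ → i ≡ i′ × SamePair x y x′ y′
      ch-inj′ x y x′ y′ i i′ a a′ e =
        let t , V , eq = valid {x} {y} a ; t′ , V′ , eq′ = valid {x′} {y′} a′
            p , q = chunk-inj V V′ (splitAt L i) (splitAt L i′) (trans (sym (ch′-at eq i)) (trans e (ch′-at eq′ i′)))
        in splitAt-injective L p , joined eq eq′ q
      ch-br′ : ∀ x y x′ y′ i → adj pairs x y ≡ true → adj pairs x′ y′ ≡ true → ch′ x y i ≢ x′
      ch-br′ x y x′ y′ i a a′ e =
        let t , V , eq = valid {x} {y} a ; x′∈ , _ , f = branch {x′} {y′} a′ in chunk-br V x′∈ f (splitAt L i) (trans (sym (ch′-at eq i)) e)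
      ch-ch′ : ∀ x y x′ y′ i i′ → adj pairs x y ≡ true → adj pairs x′ y′ ≡ true → adj G (ch′ x y i) (ch′ x′ y′ i′) ≡ true → SamePair x y x′ y′
      ch-ch′ x y x′ y′ i i′ a a′ e =
        let t , V , eq = valid {x} {y} a ; t′ , V′ , eq′ = valid {x′} {y′} a′
        in joined eq eq′ (chunk-adj V V′ (splitAt L i) (splitAt L i′) (trans (sym (cong₂ (adj G) (ch′-at eq i) (ch′-at eq′ i′))) e))
      br-ch′ : ∀ x y x′ y′ i → adj pairs x y ≡ true → adj pairs x′ y′ ≡ true → adj G x (ch′ x′ y′ i) ≡ true → x ≡ x′ ⊎ x ≡ y′
      br-ch′ x y x′ y′ i a a′ e with valid {x′} {y′} a′ | branch {x} {y} a
      ... | t′ , V′ , eq′ | x∈ , _ , f with pm-pair eq′ | chunk-near V′ x∈ f (splitAt L i) (trans (sym (cong (adj G x) (ch′-at eq′ i))) e)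
      ...   | inj₁ (refl , refl) | r      = r
      ...   | inj₂ (refl , refl) | inj₁ r = inj₂ r
      ...   | inj₂ (refl , refl) | inj₂ r = inj₁ r
      at-left : ∀ {x y t} → pm x y ≡ just t → ∀ l → ch′ x y (l ↑ˡ suc L) ≡ chunk t (inj₁ l)
      at-left {t = t} eq l = trans (ch′-at eq (l ↑ˡ suc L)) (cong (chunk t) (splitAt-↑ˡ L l (suc L)))
      at-right : ∀ {x y t} → pm x y ≡ just t → ∀ l → ch′ x y (L ↑ʳ l) ≡ chunk t (inj₂ l)
      at-right {t = t} eq l = trans (ch′-at eq (L ↑ʳ l)) (cong (chunk t) (splitAt-↑ʳ L (suc L) l))
      end′ : ∀ x y → adj pairs x y ≡ true → ∃ λ i → adj G x (ch′ x y i) ≡ true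
      end′ x y a with valid {x} {y} a
      ... | t , V , eq with pm-pair eq
      ...   | inj₁ (refl , refl) = let l , e = end-at (Valid.Fx V) in l ↑ˡ suc L , trans (cong (adj G x) (at-left eq l)) e
      ...   | inj₂ (refl , refl) = let l , e = end-at (Valid.Fy V) in L ↑ʳ suc l , trans (cong (adj G x) (at-right eq (suc l))) e
      -- Both halves are connected and each touches b, so `g` takes its value at b everywhere.
      middle : ∀ x y → adj pairs x y ≡ true → (g : Fin (L + suc L) → ℕ) → (∀ i j → adj G (ch′ x y i) (ch′ x y j) ≡ true → g i ≡ g j) →
        ∀ i → g i ≡ g (L ↑ʳ zero)
      middle x y a g h i with valid {x} {y} a
      ... | (b , x₀ , y₀) , V , eq = trans (cong g (sym (join-splitAt L (suc L) i))) (go (splitAt L i))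
        where
          left : ∀ l l′ → g (l ↑ˡ suc L) ≡ g (l′ ↑ˡ suc L)
          left = conn (Valid.Fx V) (λ l → g (l ↑ˡ suc L)) λ l l′ e → h _ _ (trans (cong₂ (adj G) (at-left eq l) (at-left eq l′)) e)
          right : ∀ l l′ → g (L ↑ʳ suc l) ≡ g (L ↑ʳ suc l′)
          right = conn (Valid.Fy V) (λ l → g (L ↑ʳ suc l)) λ l l′ e → h _ _ (trans (cong₂ (adj G) (at-right eq (suc l)) (at-right eq (suc l′))) e)
          go : ∀ s → g (join L (suc L) s) ≡ g (L ↑ʳ zero)
          go (inj₁ l) = let l′ , e = end (Valid.Fx V) in
            trans (left l l′) (h _ _ (trans (cong₂ (adj G) (at-left eq l′) (at-right eq zero)) (flip-adj e)))
          go (inj₂ zero) = refl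
          go (inj₂ (suc l)) = let l′ , e = end (Valid.Fy V) in
            trans (right l l′) (h _ _ (trans (cong₂ (adj G) (at-right eq (suc l′)) (at-right eq zero)) (flip-adj e)))

biclique-links : ∀ {N s} (A : Graph N) {U Q : Subset N} (K : Biclique s U (λ b → Q ∩ adj A b)) → let open Biclique K in
  s * s ≤ links A (image left) (image right)
biclique-links {N} {s} A {U} {Q} K = begin
  s * s ≡⟨ sum-const s s ⟨
  sum {s} (λ _ → s) ≤⟨ sum-mono (λ i → row i) ⟩
  sum (λ i → bit (image left (left i)) * deg A (image right) (left i)) ≤⟨ sum-injective-≤ left-inj (λ v → bit (image left v) * deg A (image right) v) ⟩
  links A (image left) (image right) ∎
  where
    open ≤-Reasoning
    open Biclique K
    row : ∀ i → s ≤ bit (image left (left i)) * deg A (image right) (left i)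
    row i = begin
      s ≡⟨ trans (sym (*-identityʳ s)) (sym (sum-const s 1)) ⟩
      sum {s} (λ _ → 1) ≡⟨ sum-cong-≗ {s} (λ j → sym (cong bit (∧-intro (image-∈ right j) (∧-elimʳ {Q (right j)} (complete i j))))) ⟩
      sum (λ j → bit ((image right ∩ adj A (left i)) (right j))) ≤⟨ sum-injective-≤ right-inj (λ v → bit ((image right ∩ adj A (left i)) v)) ⟩
      deg A (image right) (left i) ≡⟨ *-identityˡ _ ⟨
      1 * deg A (image right) (left i) ≡⟨ cong (λ z → bit z * deg A (image right) (left i)) (image-∈ left i) ⟨
      bit (image left (left i)) * deg A (image right) (left i) ∎

-- The vertices of B left unmatched see cliques of the sparse graph P, hence at most # Q * (s * suc Δ ^ s) of them can
-- avoid a biclique, and B would be too small.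
crowded : ∀ {N} (A : Graph N) {S : Subset N} {a y s} (U : Unbalanced A S a y s) → let open Unbalanced U in
  ∀ {bad} {M : Matching B Q (λ b → Q ∩ adj A b) bad} → Maximal M → let open Matching M in ∀ (P : Graph N) K Δ → 0 < s → 0 < # S →
  (∀ x w → adj pairs x w ≡ true ⊎ bad x w ≡ true → adj P x w ≡ true) → E pairs Q ≤ K * # Q →
  (∀ T → T ⊆ Q → 0 < # T → ∃ λ v → v ∈ T × deg P T v ≤ Δ) → ¬ Biclique s (B ∖ used) (λ b → Q ∩ adj A b) →
  64 * (K + s * suc Δ ^ s) < y → ⊥
crowded A {S} {s = s} U {M = M} max P K Δ 0<s pos inP few low none large = squeeze pos Q-small (begin
  # S ≤⟨ B-large ⟩
  64 * # B ≡⟨ cong (64 *_) (#-split B used) ⟩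
  64 * (# (B ∩ used) + # (B ∖ used)) ≤⟨ *-monoʳ-≤ 64 (+-mono-≤ (≤-trans (#-mono λ v p → ∧-elimʳ {B v} p) (≤-trans count few)) unused) ⟩
  64 * (K * # Q + # Q * (s * suc Δ ^ s)) ≡⟨ arrange K (# Q) (s * suc Δ ^ s) ⟩
  64 * (K + s * suc Δ ^ s) * # Q ∎) large
  where
    open ≤-Reasoning
    open Unbalanced U
    open Matching M
    open Maximal max
    arrange : ∀ k q z → 64 * (k * q + q * z) ≡ 64 * (k + z) * q
    arrange = solve-∀
    unused : # (B ∖ used) ≤ # Q * (s * suc Δ ^ s)
    unused = clique-count s Δ P Q (B ∖ used) (λ b → Q ∩ adj A b) 0<s low (λ b _ → ⊆-∩ˡ Q (adj A b)) (λ b b∈ → B-degree b (∧-elimˡ b∈))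
      (λ b b∈ x w x∈ w∈ x≢w → inP x w (maximal b b∈ x w x∈ w∈ x≢w)) none

-- For chunks of size L, `a` sets the density threshold, `y` the ratio between S and Q, and `s` the
-- size of the bicliques. `q` and `r` are the numbers of bits for the degree bounds 32 a y and 2 s.
record Constants (c : ℕ) : Set where
  field
    a y s q r : ℕ → ℕ
  K : ℕ → ℕ
  K L = 16 * a L
  field
    a>0       : ∀ L → 0 < L → 0 < a L
    s>0       : ∀ L → 0 < L → 0 < s L
    s≤a       : ∀ L → 0 < L → s L ≤ a L
    y≥32      : ∀ L → 0 < L → 32 ≤ y L
    q≥2       : ∀ L → 0 < L → 2 ≤ q L
    r≥2       : ∀ L → 0 < L → 2 ≤ r L
    q-degree  : ∀ L → 0 < L → suc (32 * a L * y L) ≤ 2 ^ q L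
    q-density : ∀ L → 0 < L → 2 * (q L * blocks c L + 1) ≤ 8 * a L
    r-degree  : ∀ L → 0 < L → suc (2 * s L) ≤ 2 ^ r L
    r-density : ∀ L → 0 < L → 2 * (r L * blocks c L + 1) * (2 * s L) ≤ s L * s L
    y-large   : ∀ L → 0 < L → 64 * (K (L + suc L) + s L * suc (K (L + suc L)) ^ s L) < y L

module SubdivisionSparse (X : GraphFamily) (her : Hereditary X) (c : ℕ) (small : ∀ n → CardX≤ X n (n ! * c ^ n)) (const : Constants c)
  {N} (G : Graph N) (G∈X : X N G) where
  open Constants const

  module Induct {L} (0<L : 0 < L) (Sd : Subdivision G L) (S : Subset N) (pos : 0 < # S) (dense : K L * # S ≤ E (Subdivision.F Sd) S)
    (sparser : ∀ T → T ⊆ S → # T < # S → 0 < # T → E (Subdivision.F Sd) T < K L * # T)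
    (ih : (Sd′ : Subdivision G (L + suc L)) → ∀ T → # T < # S → 0 < # T → E (Subdivision.F Sd′) T < K (L + suc L) * # T) where
    open Subdivision Sd
    open BoundedDegree X her c small G G∈X 0<L Sd using (bounded-degree-sparse)
    D = 32 * a L * y L

    light : E F (S ∖ heavy F S D) ≤ 8 * a L * # S
    light = begin
      E F (S ∖ heavy F S D) ≤⟨ sparse-≤ F (2 * (q L * blocks c L + 1)) (S ∖ heavy F S D) (bounded-degree-sparse D (q L) (q-degree L 0<L) (q≥2 L 0<L) (S ∖ heavy F S D) (light-degree F S D)) ⟩
      2 * (q L * blocks c L + 1) * # (S ∖ heavy F S D) ≤⟨ *-mono-≤ (q-density L 0<L) (#-mono (⊆-∖ S (heavy F S D))) ⟩
      8 * a L * # S ∎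
      where open ≤-Reasoning

    U : Unbalanced F S (a L) (y L) (s L)
    U = unbalanced F S (a L) (y L) (s L) ⦃ >-nonZero (a>0 L 0<L) ⦄ (y≥32 L 0<L) (s≤a L 0<L) pos dense sparser light
    open Unbalanced U

    rel : Fin N → Subset N
    rel b = Q ∩ adj F b

    match = greedy B Q rel (λ _ _ → false) (λ b _ → ⊆-∩ˡ Q (adj F b))
    open Matching (proj₁ match)
    open Coarsen Sd B Q disjoint (proj₁ match) using (coarse)

    -- The two sides form a set of at most 2 s vertices, so degrees in it are trivially at most 2 s.
    -- For that degree bound the s * s links of a biclique are already too dense.
    no-biclique : ¬ Biclique (s L) (B ∖ used) rel
    no-biclique J = <⇒≱ (begin-strict
      E F T <⟨ bounded-degree-sparse (2 * s L) (r L) (r-degree L 0<L) (r≥2 L 0<L) T (λ v _ → ≤-trans (deg≤# F T v) #T) T-pos ⟩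
      2 * (r L * blocks c L + 1) * # T ≤⟨ *-monoʳ-≤ (2 * (r L * blocks c L + 1)) #T ⟩
      2 * (r L * blocks c L + 1) * (2 * s L) ≤⟨ r-density L 0<L ⟩
      s L * s L ∎) (begin
      s L * s L ≤⟨ biclique-links F J ⟩
      links F (image left) (image right) ≤⟨ links-mono F (⊆-∪ˡ (image left) (image right)) (⊆-∪ʳ (image left) (image right)) ⟩
      E F T ∎)
      where
        open ≤-Reasoning
        open Biclique J
        T = image left ∪ image right
        #T : # T ≤ 2 * s L
        #T = ≤-trans (#-∪ (image left) (image right)) (≤-trans (+-mono-≤ (#-image left) (#-image right)) (≤-reflexive (cong (s L +_) (sym (+-identityʳ (s L))))))
        i₀ = fromℕ< (s>0 L 0<L)
        T-pos : 0 < # T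
        T-pos = #-pos T (left i₀) (⊆-∪ˡ (image left) (image right) (left i₀) (image-∈ left i₀))

    pairs-sparse : ∀ T → T ⊆ Q → 0 < # T → E pairs T < K (L + suc L) * # T
    pairs-sparse T T⊆Q = ih coarse T (≤-<-trans (#-mono T⊆Q) Q<S)

    impossible : ⊥
    impossible = crowded F U (proj₂ match) pairs (K (L + suc L)) (K (L + suc L)) (s>0 L 0<L) pos (λ { x w (inj₁ p) → p ; x w (inj₂ ()) })
      (sparse-≤ pairs (K (L + suc L)) Q (pairs-sparse Q λ _ p → p))
      (λ T T⊆Q posT → let v , v∈ , lt = low-degree pairs (K (L + suc L)) T posT (pairs-sparse T T⊆Q posT) in v , v∈ , <⇒≤ lt)
      no-biclique (y-large L 0<L)

  -- The induction is on the number of vertices alone: the chunks grow, but the new graph of pairs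
  -- lives on the strictly smaller set Q.
  subdivision-sparse : ∀ n {L} → 0 < L → (Sd : Subdivision G L) → ∀ S → # S < n → 0 < # S → E (Subdivision.F Sd) S < K L * # S
  subdivision-sparse (suc n) {L} 0<L Sd S (s≤s lt) pos with E (Subdivision.F Sd) S <? K L * # S
  ... | yes p = p
  ... | no ¬p = ⊥-elim (Induct.impossible 0<L Sd S pos (≮⇒≥ ¬p)
    (λ T _ T<S → subdivision-sparse n 0<L Sd T (<-≤-trans T<S lt))
    (λ Sd′ T T<S → subdivision-sparse n (≤-trans 0<L (m≤m+n L (suc L))) Sd′ T (<-≤-trans T<S lt)))

-- Thinning to an induced 1-subdivision

data Demand : Set where
  must forbid free : Demand

isMust isForbid : Demand → Bool
isMust must     = true
isMust _        = false
isForbid forbid = true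
isForbid _      = false

meets : Bool → Demand → Bool
meets true  forbid = false
meets false must   = false
meets _     _      = true

sat : ∀ {N} → Subset N → (Fin N → Demand) → Bool
sat {zero}  W τ = true
sat {suc N} W τ = meets (W zero) (τ zero) ∧ sat (W ∘ suc) (τ ∘ suc)

sat-must : ∀ {N} (W : Subset N) τ → sat W τ ≡ true → ∀ v → τ v ≡ must → v ∈ W
sat-must W τ p zero    e with W zero | τ zero
sat-must W τ p zero    refl | true | must = refl
sat-must W τ p (suc v) e = sat-must (W ∘ suc) (τ ∘ suc) (∧-elimʳ {meets (W zero) (τ zero)} p) v e

sat-forbid : ∀ {N} (W : Subset N) τ → sat W τ ≡ true → ∀ v → τ v ≡ forbid → ¬ (v ∈ W)
sat-forbid W τ p zero    e w with W zero | τ zero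
sat-forbid W τ () zero   refl w | true | forbid
sat-forbid W τ p (suc v) e w = sat-forbid (W ∘ suc) (τ ∘ suc) (∧-elimʳ {meets (W zero) (τ zero)} p) v e w

-- With every vertex kept with probability 1 / suc M, the demand τ is met with probability weight M τ / suc M ^ N.
weight : ∀ {N} → ℕ → (Fin N → Demand) → ℕ
weight {zero}  M τ = 1
weight {suc N} M τ = (bit (meets true (τ zero)) + M * bit (meets false (τ zero))) * weight M (τ ∘ suc)

sum₂ : ∀ {m n} → (Fin m → Fin n → ℕ) → ℕ
sum₂ f = sum (λ x → sum (f x))

sum₂-mono : ∀ {m n} {f g : Fin m → Fin n → ℕ} → (∀ x y → f x y ≤ g x y) → sum₂ f ≤ sum₂ g
sum₂-mono p = sum-mono λ x → sum-mono λ y → p x y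

sum₂-cong : ∀ {m n} {f g : Fin m → Fin n → ℕ} → (∀ x y → f x y ≡ g x y) → sum₂ f ≡ sum₂ g
sum₂-cong p = sum-cong-≗ λ x → sum-cong-≗ λ y → p x y

sum₂-+ : ∀ {m n} (f g : Fin m → Fin n → ℕ) → sum₂ (λ x y → f x y + g x y) ≡ sum₂ f + sum₂ g
sum₂-+ f g = trans (sum-cong-≗ λ x → ∑-distrib-+ (f x) (g x)) (∑-distrib-+ (λ x → sum (f x)) (λ x → sum (g x)))

sum₂-* : ∀ {m n} k (f : Fin m → Fin n → ℕ) → sum₂ (λ x y → k * f x y) ≡ k * sum₂ f
sum₂-* k f = trans (sum-cong-≗ λ x → sum-*ˡ k (f x)) (sum-*ˡ k (λ x → sum (f x)))

-- The method of conditional expectations: the fate of the first vertex is decided in favour of the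
-- larger conditional sum, keeping it having weight 1 and dropping it weight M.
choose : ∀ {N m n} M (a : Fin m → Fin n → ℕ) (τ : Fin m → Fin n → Fin N → Demand) →
  ∃ λ W → sum₂ (λ x y → a x y * weight M (τ x y)) ≤ suc M ^ N * sum₂ (λ x y → a x y * bit (sat W (τ x y)))
choose {zero}  M a τ = (λ ()) , ≤-reflexive (sym (*-identityˡ _))
choose {suc N} M a τ
  with W₁ , p₁ ← choose M (λ x y → a x y * bit (meets true (τ x y zero))) (λ x y v → τ x y (suc v))
     | W₂ , p₂ ← choose M (λ x y → a x y * bit (meets false (τ x y zero))) (λ x y v → τ x y (suc v)) = pickBest (≤-total g₂ g₁)
  where
    open ≤-Reasoning
    part : Bool → Subset N → Fin _ → Fin _ → ℕ
    part b W x y = a x y * bit (meets b (τ x y zero)) * bit (sat W (λ v → τ x y (suc v)))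
    branch : Bool → Fin _ → Fin _ → ℕ
    branch b x y = a x y * bit (meets b (τ x y zero)) * weight M (λ v → τ x y (suc v))
    g₁ = sum₂ (part true W₁)
    g₂ = sum₂ (part false W₂)
    total : sum₂ (λ x y → a x y * weight M (τ x y)) ≤ suc M ^ N * g₁ + M * (suc M ^ N * g₂)
    total = begin
      sum₂ (λ x y → a x y * weight M (τ x y))
        ≡⟨ sum₂-cong (λ x y → split (a x y) (bit (meets true (τ x y zero))) (bit (meets false (τ x y zero))) (weight M (λ v → τ x y (suc v))) M) ⟩
      sum₂ (λ x y → branch true x y + M * branch false x y)
        ≡⟨ trans (sum₂-+ (branch true) (λ x y → M * branch false x y)) (cong (sum₂ (branch true) +_) (sum₂-* M (branch false))) ⟩
      sum₂ (branch true) + M * sum₂ (branch false)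
        ≤⟨ +-mono-≤ p₁ (*-monoʳ-≤ M p₂) ⟩
      suc M ^ N * g₁ + M * (suc M ^ N * g₂) ∎
      where split : ∀ a i o w M → a * ((i + M * o) * w) ≡ a * i * w + M * (a * o * w)
            split = solve-∀
    glue : ∀ b W → sum₂ (part b W) ≡ sum₂ (λ x y → a x y * bit (sat (b ◂ W) (τ x y)))
    glue b W = sum₂-cong λ x y → trans (*-assoc (a x y) (bit (meets b (τ x y zero))) (bit (sat W (λ v → τ x y (suc v))))) (cong (a x y *_) (sym (bit-∧ (meets b (τ x y zero)) (sat W (λ v → τ x y (suc v))))))
    pickBest : g₂ ≤ g₁ ⊎ g₁ ≤ g₂ → ∃ λ W → sum₂ (λ x y → a x y * weight M (τ x y)) ≤ suc M ^ suc N * sum₂ (λ x y → a x y * bit (sat W (τ x y)))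
    pickBest (inj₁ le) = true ◂ W₁ , (begin
      sum₂ (λ x y → a x y * weight M (τ x y)) ≤⟨ total ⟩
      suc M ^ N * g₁ + M * (suc M ^ N * g₂) ≤⟨ +-monoʳ-≤ _ (*-monoʳ-≤ M (*-monoʳ-≤ (suc M ^ N) le)) ⟩
      suc M ^ N * g₁ + M * (suc M ^ N * g₁) ≡⟨ *-assoc (suc M) (suc M ^ N) g₁ ⟨
      suc M ^ suc N * g₁ ≡⟨ cong (suc M ^ suc N *_) (glue true W₁) ⟩
      suc M ^ suc N * sum₂ (λ x y → a x y * bit (sat (true ◂ W₁) (τ x y))) ∎)
    pickBest (inj₂ le) = false ◂ W₂ , (begin
      sum₂ (λ x y → a x y * weight M (τ x y)) ≤⟨ total ⟩
      suc M ^ N * g₁ + M * (suc M ^ N * g₂) ≤⟨ +-monoˡ-≤ _ (*-monoʳ-≤ (suc M ^ N) le) ⟩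
      suc M ^ N * g₂ + M * (suc M ^ N * g₂) ≡⟨ *-assoc (suc M) (suc M ^ N) g₂ ⟨
      suc M ^ suc N * g₂ ≡⟨ cong (suc M ^ suc N *_) (glue false W₂) ⟩
      suc M ^ suc N * sum₂ (λ x y → a x y * bit (sat (false ◂ W₂) (τ x y))) ∎)

-- Each required vertex costs a factor suc M; the z forbidden ones are all absent with probability
-- at least 1 - z / suc M by Bernoulli's inequality. Denominators are cleared.
weight-lower : ∀ {N} M (τ : Fin N → Demand) → suc M ^ N * (suc M ∸ # (isForbid ∘ τ)) ≤ weight M τ * suc M ^ # (isMust ∘ τ) * suc M
weight-lower {zero}  M τ = ≤-reflexive (trans (+-identityʳ (suc M)) (sym (+-identityʳ (suc M))))
weight-lower {suc N} M τ with τ zero | weight-lower M (τ ∘ suc)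
... | must | ih = begin
    suc M * suc M ^ N * (suc M ∸ z) ≡⟨ *-assoc (suc M) (suc M ^ N) (suc M ∸ z) ⟩
    suc M * (suc M ^ N * (suc M ∸ z)) ≤⟨ *-monoʳ-≤ (suc M) ih ⟩
    suc M * (w * u * suc M) ≡⟨ r (suc M) w u M ⟩
    (1 + M * 0) * w * (suc M * u) * suc M ∎
  where
    open ≤-Reasoning
    z = # (isForbid ∘ τ ∘ suc)
    w = weight M (τ ∘ suc)
    u = suc M ^ # (isMust ∘ τ ∘ suc)
    r : ∀ s w u M → s * (w * u * s) ≡ (1 + M * 0) * w * (s * u) * s
    r = solve-∀
... | free | ih = begin
    suc M * suc M ^ N * (suc M ∸ z) ≡⟨ *-assoc (suc M) (suc M ^ N) (suc M ∸ z) ⟩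
    suc M * (suc M ^ N * (suc M ∸ z)) ≤⟨ *-monoʳ-≤ (suc M) ih ⟩
    suc M * (w * u * suc M) ≡⟨ r w u M ⟩
    (1 + M * 1) * w * u * suc M ∎
  where
    open ≤-Reasoning
    z = # (isForbid ∘ τ ∘ suc)
    w = weight M (τ ∘ suc)
    u = suc M ^ # (isMust ∘ τ ∘ suc)
    r : ∀ w u M → suc M * (w * u * suc M) ≡ (1 + M * 1) * w * u * suc M
    r = solve-∀
... | forbid | ih = begin
    suc M * suc M ^ N * (M ∸ z) ≡⟨ r₁ (suc M) (suc M ^ N) (M ∸ z) ⟩
    suc M ^ N * (suc M * (M ∸ z)) ≤⟨ *-monoʳ-≤ (suc M ^ N) (drop M z) ⟩
    suc M ^ N * (M * (suc M ∸ z)) ≡⟨ r₂ (suc M ^ N) M (suc M ∸ z) ⟩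
    M * (suc M ^ N * (suc M ∸ z)) ≤⟨ *-monoʳ-≤ M ih ⟩
    M * (w * u * suc M) ≡⟨ r₃ M w u (suc M) ⟩
    (0 + M * 1) * w * u * suc M ∎
  where
    open ≤-Reasoning
    z = # (isForbid ∘ τ ∘ suc)
    w = weight M (τ ∘ suc)
    u = suc M ^ # (isMust ∘ τ ∘ suc)
    r₁ : ∀ s x y → s * x * y ≡ x * (s * y)
    r₁ = solve-∀
    r₂ : ∀ x m y → x * (m * y) ≡ m * (x * y)
    r₂ = solve-∀
    r₃ : ∀ M w u s → M * (w * u * s) ≡ (0 + M * 1) * w * u * s
    r₃ = solve-∀
    -- The induction step of Bernoulli's inequality; for z > M truncated subtraction makes the left
    -- side zero.
    drop : ∀ M z → suc M * (M ∸ z) ≤ M * (suc M ∸ z)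
    drop M z with z ≤? M
    ... | yes le = begin
      suc M * (M ∸ z) ≡⟨⟩
      M ∸ z + M * (M ∸ z) ≤⟨ +-monoˡ-≤ _ (m∸n≤m M z) ⟩
      M + M * (M ∸ z) ≡⟨ *-suc M (M ∸ z) ⟨
      M * suc (M ∸ z) ≡⟨ cong (M *_) (+-∸-assoc 1 le) ⟨
      M * (suc M ∸ z) ∎
    ... | no ¬le = ≤-trans (≤-reflexive (trans (cong (suc M *_) (m≤n⇒m∸n≡0 (<⇒≤ (≰⇒> ¬le)))) (*-zeroʳ (suc M)))) z≤n

-- If at most half of suc M vertices are forbidden, the Bernoulli factor is at least 1/2, so every
-- term survives with probability at least 1 / (2 * suc M ^ 3).
thinning : ∀ {N m n} M (a : Fin m → Fin n → ℕ) (τ : Fin m → Fin n → Fin N → Demand) →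
  (∀ x y → # (isMust ∘ τ x y) ≤ 3) → (∀ x y → 2 * # (isForbid ∘ τ x y) ≤ suc M) →
  ∃ λ W → sum₂ a ≤ 2 * suc M ^ 3 * sum₂ (λ x y → a x y * bit (sat W (τ x y)))
thinning {N} M a τ few-must few-forbid with W , p ← choose M a τ = W , *-cancelˡ-≤ (suc M ^ N) ⦃ m^n≢0 (suc M) N ⦄ (begin
  suc M ^ N * sum₂ a ≡⟨ sum₂-* (suc M ^ N) a ⟨
  sum₂ (λ x y → suc M ^ N * a x y) ≤⟨ sum₂-mono (λ x y → term x y) ⟩
  sum₂ (λ x y → 2 * suc M ^ 3 * (a x y * weight M (τ x y))) ≡⟨ sum₂-* (2 * suc M ^ 3) (λ x y → a x y * weight M (τ x y)) ⟩
  2 * suc M ^ 3 * sum₂ (λ x y → a x y * weight M (τ x y)) ≤⟨ *-monoʳ-≤ (2 * suc M ^ 3) p ⟩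
  2 * suc M ^ 3 * (suc M ^ N * g W) ≡⟨ swap (2 * suc M ^ 3) (suc M ^ N) (g W) ⟩
  suc M ^ N * (2 * suc M ^ 3 * g W) ∎)
  where
    open ≤-Reasoning
    g : Subset N → ℕ
    g W = sum₂ (λ x y → a x y * bit (sat W (τ x y)))
    swap : ∀ x y z → x * (y * z) ≡ y * (x * z)
    swap = solve-∀
    r₂ : ∀ w u s → 2 * (w * u * s) ≡ 2 * w * u * s
    r₂ = solve-∀
    half : ∀ x y → suc M ^ N ≤ 2 * weight M (τ x y) * suc M ^ 3
    half x y = *-cancelʳ-≤ _ _ (suc M) (begin
      suc M ^ N * suc M ≤⟨ *-monoʳ-≤ (suc M ^ N) half′ ⟩
      suc M ^ N * (2 * (suc M ∸ z)) ≡⟨ swap (suc M ^ N) 2 (suc M ∸ z) ⟩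
      2 * (suc M ^ N * (suc M ∸ z)) ≤⟨ *-monoʳ-≤ 2 (weight-lower M (τ x y)) ⟩
      2 * (weight M (τ x y) * suc M ^ # (isMust ∘ τ x y) * suc M) ≡⟨ r₂ (weight M (τ x y)) (suc M ^ # (isMust ∘ τ x y)) (suc M) ⟩
      2 * weight M (τ x y) * suc M ^ # (isMust ∘ τ x y) * suc M ≤⟨ *-monoˡ-≤ (suc M) (*-monoʳ-≤ (2 * weight M (τ x y)) (^-monoʳ-≤ (suc M) (few-must x y))) ⟩
      2 * weight M (τ x y) * suc M ^ 3 * suc M ∎)
      where
        z = # (isForbid ∘ τ x y)
        half′ : suc M ≤ 2 * (suc M ∸ z)
        half′ = begin
          suc M ≡⟨ m+n∸n≡m (suc M) (suc M) ⟨
          suc M + suc M ∸ suc M ≤⟨ ∸-monoʳ-≤ (suc M + suc M) (few-forbid x y) ⟩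
          suc M + suc M ∸ 2 * z ≡⟨ cong (_∸ 2 * z) (cong (suc M +_) (sym (+-identityʳ (suc M)))) ⟩
          2 * suc M ∸ 2 * z ≡⟨ *-distribˡ-∸ 2 (suc M) z ⟨
          2 * (suc M ∸ z) ∎
    r₁ : ∀ a w s → a * (2 * w * s) ≡ 2 * s * (a * w)
    r₁ = solve-∀
    term : ∀ x y → suc M ^ N * a x y ≤ 2 * suc M ^ 3 * (a x y * weight M (τ x y))
    term x y = begin
      suc M ^ N * a x y ≡⟨ *-comm (suc M ^ N) (a x y) ⟩
      a x y * suc M ^ N ≤⟨ *-monoʳ-≤ (a x y) (half x y) ⟩
      a x y * (2 * weight M (τ x y) * suc M ^ 3) ≡⟨ r₁ (a x y) (weight M (τ x y)) (suc M ^ 3) ⟩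
      2 * suc M ^ 3 * (a x y * weight M (τ x y)) ∎

module Thin {N} (G : Graph N) (S Q B : Subset N) {d} (ori : Orientation G S d) (Q⊆S : Q ⊆ S) (B⊆S : B ⊆ S) (disjoint : ∀ v → v ∈ Q → v ∈ B → ⊥)
  (M : Matching B Q (λ b → Q ∩ adj G b) (adj G)) where
  open Orientation ori
  open Matching M

  corner : Triple N → Subset N
  corner (b , x , y) = δ b ∪ (δ x ∪ δ y)

  -- An edge between branch vertices, or between middle vertices, is an out-edge of one of its ends.
  -- It is therefore excluded by forbidding boundedly many vertices, although x and y may have huge
  -- degree. Middle vertices have bounded degree, so all neighbours of b in Q can be forbidden.
  hazard : Triple N → Subset N
  hazard (b , x , y) = (out b ∪ (out x ∪ out y)) ∪ (Q ∩ adj G b)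

  -- Corners take precedence, because x and y are themselves neighbours of b in Q and hence hazards.
  demand : Maybe (Triple N) → Fin N → Demand
  demand nothing  z = free
  demand (just t) z = if corner t z then must else (if hazard t z then forbid else free)

  demand-must : ∀ t z → isMust (demand (just t) z) ≡ true → z ∈ corner t
  demand-must t z p with corner t z | hazard t z
  ... | true  | _ = refl
  demand-must t z () | false | true
  demand-must t z () | false | false

  demand-forbid : ∀ t z → isForbid (demand (just t) z) ≡ true → z ∈ hazard t
  demand-forbid t z p with corner t z | hazard t z
  ... | false | true = refl

  must-few : ∀ m → # (isMust ∘ demand m) ≤ 3
  must-few nothing = ≤-trans (≤-reflexive (sum-0 {N} λ _ → refl)) z≤n
  must-few (just (b , x , y)) = begin
    # (isMust ∘ demand (just (b , x , y))) ≤⟨ #-mono (demand-must (b , x , y)) ⟩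
    # (δ b ∪ (δ x ∪ δ y)) ≤⟨ #-∪ (δ b) (δ x ∪ δ y) ⟩
    # (δ b) + # (δ x ∪ δ y) ≤⟨ +-monoʳ-≤ (# (δ b)) (#-∪ (δ x) (δ y)) ⟩
    # (δ b) + (# (δ x) + # (δ y)) ≡⟨ cong₂ _+_ (#-δ b) (cong₂ _+_ (#-δ x) (#-δ y)) ⟩
    3 ∎
    where open ≤-Reasoning

  forbid-few : ∀ h x y → (∀ b → b ∈ B → deg G S b ≤ h) → # (isForbid ∘ demand (pm x y)) ≤ d + (d + d) + h
  forbid-few h x y sparse with pm x y in eq
  ... | nothing = ≤-trans (≤-reflexive (sum-0 {N} λ _ → refl)) z≤n
  ... | just (b , x₀ , y₀) = begin
    # (isForbid ∘ demand (just (b , x₀ , y₀))) ≤⟨ #-mono (demand-forbid (b , x₀ , y₀)) ⟩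
    # ((out b ∪ (out x₀ ∪ out y₀)) ∪ (Q ∩ adj G b)) ≤⟨ #-∪ (out b ∪ (out x₀ ∪ out y₀)) (Q ∩ adj G b) ⟩
    # (out b ∪ (out x₀ ∪ out y₀)) + deg G Q b ≤⟨ +-mono-≤ (≤-trans (#-∪ (out b) (out x₀ ∪ out y₀)) (+-mono-≤ (outdegree b) (≤-trans (#-∪ (out x₀) (out y₀)) (+-mono-≤ (outdegree x₀) (outdegree y₀)))))
                                                                             (≤-trans (deg-mono G Q⊆S b) (sparse b (pm-B eq))) ⟩
    d + (d + d) + h ∎
    where open ≤-Reasoning

  module _ (T W : Subset N) where

    kept : Fin N → Fin N → Bool
    kept x y = (T x ∧ T y) ∧ (is-just (pm x y) ∧ sat W (demand (pm x y)))

    F′ : Graph N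
    F′ = record
      { adj = kept
      ; adj-sym = λ x y → cong₂ _∧_ (∧-comm (T x) (T y)) (cong (λ m → is-just m ∧ sat W (demand m)) (pm-sym x y))
      ; adj-irrefl = λ x → trans (cong ((T x ∧ T x) ∧_) (cong (_∧ sat W (demand (pm x x))) (pm-irrefl x))) (∧-comm (T x ∧ T x) false) }

    record Kept (t : Triple N) : Set where
      b = proj₁ t
      x = proj₁ (proj₂ t)
      y = proj₂ (proj₂ t)
      field
        {x̂ ŷ}     : Fin N
        is        : pm x̂ ŷ ≡ just t
        satisfied : sat W (demand (just t)) ≡ true
      b∈B = pm-B is
      x∈Q : x ∈ Q
      x∈Q = ∧-elimˡ (pm-x is)
      y∈Q : y ∈ Q
      y∈Q = ∧-elimˡ (pm-y is)
      corner-W : ∀ z → z ∈ corner t → z ∈ W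
      corner-W z p = sat-must W _ satisfied z (cong (λ q → if q then must else (if hazard t z then forbid else free)) p)
      hazard-W : ∀ z → z ∈ W → z ∈ hazard t → z ∈ corner t
      hazard-W z w h with z ∈? corner t
      ... | yes p = p
      ... | no ¬p = ⊥-elim (sat-forbid W _ satisfied z (cong₂ (λ p q → if p then must else (if q then forbid else free)) (¬true⇒false ¬p) h) w)

    get : ∀ {x y} → kept x y ≡ true → ∃ λ t → Kept t × pm x y ≡ just t
    get {x} {y} k with pm x y in eq
    ... | just t  = t , record { is = eq ; satisfied = ∧-elimʳ {T x ∧ T y} k } , refl
    ... | nothing = ⊥-elim (true≢false k (∧-comm (T x ∧ T y) false))

    corner-b : ∀ t → proj₁ t ∈ corner t
    corner-b (b , x , y) = ⊆-∪ˡ (δ b) (δ x ∪ δ y) b (∈δ b)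
    corner-x : ∀ t → proj₁ (proj₂ t) ∈ corner t
    corner-x (b , x , y) = ⊆-∪ʳ (δ b) (δ x ∪ δ y) x (⊆-∪ˡ (δ x) (δ y) x (∈δ x))
    corner-y : ∀ t → proj₂ (proj₂ t) ∈ corner t
    corner-y (b , x , y) = ⊆-∪ʳ (δ b) (δ x ∪ δ y) y (⊆-∪ʳ (δ x) (δ y) y (∈δ y))

    Q-corner : ∀ {t z} → Kept t → z ∈ Q → z ∈ corner t → z ≡ proj₁ (proj₂ t) ⊎ z ≡ proj₂ (proj₂ t)
    Q-corner {b , x , y} {z} k z∈Q p with ∪-elim (δ b) (δ x ∪ δ y) p
    ... | inj₁ q = ⊥-elim (disjoint z z∈Q (subst (_∈ B) (∈δ⇒≡ q) (Kept.b∈B k)))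
    ... | inj₂ q with ∪-elim (δ x) (δ y) q
    ...   | inj₁ r = inj₁ (sym (∈δ⇒≡ r))
    ...   | inj₂ r = inj₂ (sym (∈δ⇒≡ r))

    B-corner : ∀ {t z} → Kept t → z ∈ B → z ∈ corner t → z ≡ proj₁ t
    B-corner {b , x , y} {z} k z∈B p with ∪-elim (δ b) (δ x ∪ δ y) p
    ... | inj₁ q = sym (∈δ⇒≡ q)
    ... | inj₂ q with ∪-elim (δ x) (δ y) q
    ...   | inj₁ r = ⊥-elim (disjoint z (subst (_∈ Q) (∈δ⇒≡ r) (Kept.x∈Q k)) z∈B)
    ...   | inj₂ r = ⊥-elim (disjoint z (subst (_∈ Q) (∈δ⇒≡ r) (Kept.y∈Q k)) z∈B)

    hazard-b : ∀ t {z} → z ∈ out (proj₁ t) → z ∈ hazard t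
    hazard-b (b , x , y) {z} p = ⊆-∪ˡ (out b ∪ (out x ∪ out y)) (Q ∩ adj G b) z (⊆-∪ˡ (out b) (out x ∪ out y) z p)
    hazard-x : ∀ t {z} → z ∈ out (proj₁ (proj₂ t)) → z ∈ hazard t
    hazard-x (b , x , y) {z} p = ⊆-∪ˡ (out b ∪ (out x ∪ out y)) (Q ∩ adj G b) z (⊆-∪ʳ (out b) (out x ∪ out y) z (⊆-∪ˡ (out x) (out y) z p))
    hazard-y : ∀ t {z} → z ∈ out (proj₂ (proj₂ t)) → z ∈ hazard t
    hazard-y (b , x , y) {z} p = ⊆-∪ˡ (out b ∪ (out x ∪ out y)) (Q ∩ adj G b) z (⊆-∪ʳ (out b) (out x ∪ out y) z (⊆-∪ʳ (out x) (out y) z p))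
    hazard-Q : ∀ t {z} → z ∈ (Q ∩ adj G (proj₁ t)) → z ∈ hazard t
    hazard-Q (b , x , y) {z} p = ⊆-∪ʳ (out b ∪ (out x ∪ out y)) (Q ∩ adj G b) z p

    data End (t : Triple N) (u : Fin N) : Set where
      end-x : u ≡ proj₁ (proj₂ t) → End t u
      end-y : u ≡ proj₂ (proj₂ t) → End t u

    end-Q : ∀ {t u} → Kept t → End t u → u ∈ Q
    end-Q k (end-x refl) = Kept.x∈Q k
    end-Q k (end-y refl) = Kept.y∈Q k

    end-corner : ∀ {t u} → End t u → u ∈ corner t
    end-corner {t} (end-x refl) = corner-x t
    end-corner {t} (end-y refl) = corner-y t

    end-hazard : ∀ {t u z} → End t u → z ∈ out u → z ∈ hazard t
    end-hazard {t} (end-x refl) = hazard-x t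
    end-hazard {t} (end-y refl) = hazard-y t

    ends-apart : ∀ {t u w} → Kept t → End t u → w ≡ proj₁ (proj₂ t) ⊎ w ≡ proj₂ (proj₂ t) → adj G u w ≡ false
    ends-apart k (end-x refl) (inj₁ refl) = adj-irrefl G _
    ends-apart k (end-x refl) (inj₂ refl) = pm-bad (Kept.is k)
    ends-apart k (end-y refl) (inj₁ refl) = trans (adj-sym G _ _) (pm-bad (Kept.is k))
    ends-apart k (end-y refl) (inj₂ refl) = adj-irrefl G _

    -- A surviving out-neighbour of u is a hazard of t, hence a corner of t. As it lies in Q it is
    -- one of the two matched vertices, and these are non-adjacent.
    half-apart : ∀ {t t′ u w} → Kept t → Kept t′ → End t u → End t′ w → w ∈ out u → adj G u w ≡ false
    half-apart k k′ e e′ o = ends-apart k e (Q-corner k (end-Q k′ e′) (Kept.hazard-W k _ (Kept.corner-W k′ _ (end-corner e′)) (end-hazard e o)))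

    branches-apart : ∀ {t t′ u w} → Kept t → Kept t′ → End t u → End t′ w → adj G u w ≡ false
    branches-apart {u = u} {w} k k′ e e′ with w ∈? adj G u
    ... | no ¬a = ¬true⇒false ¬a
    ... | yes a with covers u w (Q⊆S u (end-Q k e)) (Q⊆S w (end-Q k′ e′)) a
    ...   | inj₁ o = half-apart k k′ e e′ o
    ...   | inj₂ o = trans (adj-sym G u w) (half-apart k′ k e′ e o)

    middles-apart : ∀ {t t′} → Kept t → Kept t′ → adj G (proj₁ t) (proj₁ t′) ≡ true → proj₁ t ≡ proj₁ t′
    middles-apart {t} {t′} k k′ a with covers _ _ (B⊆S _ (Kept.b∈B k)) (B⊆S _ (Kept.b∈B k′)) a
    ... | inj₁ o = sym (B-corner k (Kept.b∈B k′) (Kept.hazard-W k _ (Kept.corner-W k′ _ (corner-b t′)) (hazard-b t o)))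
    ... | inj₂ o = B-corner k′ (Kept.b∈B k) (Kept.hazard-W k′ _ (Kept.corner-W k _ (corner-b t)) (hazard-b t′ o))

    branch-middle : ∀ {t t′ u} → Kept t → Kept t′ → End t u → adj G u (proj₁ t′) ≡ true → u ≡ proj₁ (proj₂ t′) ⊎ u ≡ proj₂ (proj₂ t′)
    branch-middle {t} {t′} {u} k k′ e a = Q-corner k′ (end-Q k e)
      (Kept.hazard-W k′ u (Kept.corner-W k u (end-corner e)) (hazard-Q t′ (∧-intro (end-Q k e) (trans (adj-sym G _ _) a))))

    same-b : ∀ {t t′} → Kept t → Kept t′ → proj₁ t ≡ proj₁ t′ → t ≡ t′
    same-b k k′ refl with refl , refl ← pm-inj (Kept.is k) (Kept.is k′) = refl

    joined : ∀ {x y x′ y′ t t′} → pm x y ≡ just t → pm x′ y′ ≡ just t′ → t ≡ t′ → SamePair x y x′ y′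
    joined eq eq′ refl = SamePair-trans (pm-pair eq) (SamePair-sym (pm-pair eq′))

    end-of : ∀ {x y t} → pm x y ≡ just t → End t x
    end-of eq with pm-pair eq
    ... | inj₁ (refl , refl) = end-x refl
    ... | inj₂ (refl , refl) = end-y refl

    middle : Fin N → Fin N → Fin N
    middle x y with pm x y
    ... | just t  = proj₁ t
    ... | nothing = x

    middle-at : ∀ {x y t} → pm x y ≡ just t → middle x y ≡ proj₁ t
    middle-at {x} {y} eq rewrite eq = refl

    thin : Subdivision G 1
    thin = record
      { F = F′ ; ch = λ x y _ → middle x y ; ch-sym = λ x y _ k → sym′ x y k
      ; ch-inj = λ {x} {y} {x′} {y′} {l} {l′} k k′ eq → unique l l′ , inj′ x y x′ y′ k k′ eq
      ; ch-br = λ {x} {y} {x′} {y′} k k′ eq → ch-br′ x y x′ y′ k k′ eq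
      ; br-br = λ {x} {y} {x′} {y′} k k′ → let _ , K , e = get {x} {y} k ; _ , K′ , e′ = get {x′} {y′} k′ in branches-apart K K′ (end-of e) (end-of e′)
      ; ch-ch = λ {x} {y} {x′} {y′} k k′ a → ch-ch′ x y x′ y′ k k′ a
      ; br-ch = λ {x} {y} {x′} {y′} k k′ a → br-ch′ x y x′ y′ k k′ a
      ; end = λ {x} {y} k → zero , end′ x y k
      ; conn = λ _ g _ l l′ → cong g (unique l l′) }
      where
        unique : (l l′ : Fin 1) → l ≡ l′
        unique zero zero = refl
        sym′ : ∀ x y → kept x y ≡ true → middle x y ≡ middle y x
        sym′ x y k = let t , _ , e = get {x} {y} k in trans (middle-at e) (sym (middle-at (trans (pm-sym y x) e)))
        inj′ : ∀ x y x′ y′ → kept x y ≡ true → kept x′ y′ ≡ true → middle x y ≡ middle x′ y′ → SamePair x y x′ y′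
        inj′ x y x′ y′ k k′ eq = let _ , K , e = get {x} {y} k ; _ , K′ , e′ = get {x′} {y′} k′ in
          joined e e′ (same-b K K′ (trans (sym (middle-at e)) (trans eq (middle-at e′))))
        ch-br′ : ∀ x y x′ y′ → kept x y ≡ true → kept x′ y′ ≡ true → middle x y ≢ x′
        ch-br′ x y x′ y′ k k′ eq = let _ , K , e = get {x} {y} k ; _ , K′ , e′ = get {x′} {y′} k′ in
          disjoint x′ (end-Q K′ (end-of e′)) (subst (_∈ B) (trans (sym (middle-at e)) eq) (Kept.b∈B K))
        ch-ch′ : ∀ x y x′ y′ → kept x y ≡ true → kept x′ y′ ≡ true → adj G (middle x y) (middle x′ y′) ≡ true → SamePair x y x′ y′
        ch-ch′ x y x′ y′ k k′ a = let _ , K , e = get {x} {y} k ; _ , K′ , e′ = get {x′} {y′} k′ in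
          joined e e′ (same-b K K′ (middles-apart K K′ (trans (sym (cong₂ (adj G) (middle-at e) (middle-at e′))) a)))
        br-ch′ : ∀ x y x′ y′ → kept x y ≡ true → kept x′ y′ ≡ true → adj G x (middle x′ y′) ≡ true → x ≡ x′ ⊎ x ≡ y′
        br-ch′ x y x′ y′ k k′ a with get {x} {y} k | get {x′} {y′} k′
        ... | _ , K , e | _ , K′ , e′ with branch-middle K K′ (end-of e) (trans (sym (cong (adj G x) (middle-at e′))) a) | pm-pair e′
        ...   | inj₁ p | inj₁ (refl , refl) = inj₁ p
        ...   | inj₂ p | inj₁ (refl , refl) = inj₂ p
        ...   | inj₁ p | inj₂ (refl , refl) = inj₂ p
        ...   | inj₂ p | inj₂ (refl , refl) = inj₁ p
        end′ : ∀ x y → kept x y ≡ true → adj G x (middle x y) ≡ true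
        end′ x y k with get {x} {y} k
        ... | (b , x₀ , y₀) , K , e = trans (cong (adj G x) (middle-at e)) (trans (adj-sym G x b) (touches (end-of e)))
          where touches : ∀ {u} → End (b , x₀ , y₀) u → adj G b u ≡ true
                touches (end-x refl) = ∧-elimʳ {Q x₀} (pm-x e)
                touches (end-y refl) = ∧-elimʳ {Q y₀} (pm-y e)

  thinned : ∀ h Mₜ T → (∀ b → b ∈ B → deg G S b ≤ h) → 2 * (d + (d + d) + h) ≤ suc Mₜ →
    ∃ λ (Sd : Subdivision G 1) → E pairs T ≤ 2 * suc Mₜ ^ 3 * E (Subdivision.F Sd) T
  thinned h Mₜ T sparse large = found (thinning Mₜ weights (λ x y → demand (pm x y)) (λ x y → must-few (pm x y))
      (λ x y → ≤-trans (*-monoʳ-≤ 2 (forbid-few h x y sparse)) large))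
    where
      open ≤-Reasoning
      weights : Fin N → Fin N → ℕ
      weights x y = bit (T x) * bit (T y ∧ adj pairs x y)
      bool : ∀ a b c s → bit a * bit (b ∧ c) * bit s ≡ bit a * bit (b ∧ ((a ∧ b) ∧ (c ∧ s)))
      bool false b c s = refl
      bool true false c s = refl
      bool true true false s = refl
      bool true true true false = refl
      bool true true true true = refl
      row : ∀ W x → sum (λ y → weights x y * bit (sat W (demand (pm x y)))) ≡ bit (T x) * deg (F′ T W) T x
      row W x = trans (sum-cong-≗ λ y → bool (T x) (T y) (adj pairs x y) (sat W (demand (pm x y)))) (sum-*ˡ (bit (T x)) (λ y → bit (T y ∧ kept T W x y)))
      found : (∃ λ W → sum₂ weights ≤ 2 * suc Mₜ ^ 3 * sum₂ (λ x y → weights x y * bit (sat W (demand (pm x y))))) →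
        ∃ λ (Sd : Subdivision G 1) → E pairs T ≤ 2 * suc Mₜ ^ 3 * E (Subdivision.F Sd) T
      found (W , le) = thin T W , (begin
        E pairs T ≡⟨ sum-cong-≗ (λ x → sym (sum-*ˡ (bit (T x)) (λ y → bit (T y ∧ adj pairs x y)))) ⟩
        sum₂ weights ≤⟨ le ⟩
        2 * suc Mₜ ^ 3 * sum₂ (λ x y → weights x y * bit (sat W (demand (pm x y)))) ≡⟨ cong (2 * suc Mₜ ^ 3 *_) (sum-cong-≗ (row W)) ⟩
        2 * suc Mₜ ^ 3 * E (F′ T W) T ∎)

-- Graphs of bounded degree without large bicliques

module Dominate {N} (A : Graph N) (S : Subset N) (t w δ₀ : ℕ) (min-deg : ∀ v → v ∈ S → δ₀ ≤ deg A S v) where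

  need : Subset N → Fin N → ℕ
  need R u = t ∸ deg A R u

  needy : Subset N → Subset N
  needy R u = does (deg A R u <? t)

  total : Subset N → ℕ
  total R = sumOn S (need R)

  gain : Subset N → Fin N → ℕ
  gain R v = deg A (S ∩ needy R) v

  ins : Fin N → Subset N → Subset N
  ins v R = δ v ∪ R

  total-ins : ∀ R v → ¬ (v ∈ R) → total (ins v R) + gain R v ≤ total R
  total-ins R v v∉R = begin
    total (ins v R) + gain R v ≡⟨ cong (total (ins v R) +_) gain-sum ⟩
    sumOn S (need (ins v R)) + sumOn S (λ u → bit (needy R u) * bit (adj A v u)) ≡⟨ sumOn-+ S (need (ins v R)) _ ⟨
    sumOn S (λ u → need (ins v R) u + bit (needy R u) * bit (adj A v u)) ≤⟨ sumOn-mono S (λ u _ → drop u) ⟩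
    total R ∎
    where
      open ≤-Reasoning
      gain-sum : gain R v ≡ sumOn S (λ u → bit (needy R u) * bit (adj A v u))
      gain-sum = sum-cong-≗ λ u → trans (bit-∧ (S u ∧ needy R u) (adj A v u)) (trans (cong (_* bit (adj A v u)) (bit-∧ (S u) (needy R u))) (*-assoc (bit (S u)) _ _))
      grows : ∀ u → adj A v u ≡ true → suc (deg A R u) ≤ deg A (ins v R) u
      grows u a = #-mono-< {S = R ∩ adj A u} {ins v R ∩ adj A u} (λ z p → ∧-intro (⊆-∪ʳ (δ v) R z (∧-elimˡ p)) (∧-elimʳ {R z} p)) v
        (∧-intro (⊆-∪ˡ (δ v) R v (∈δ v)) (trans (adj-sym A u v) a)) λ p → v∉R (∧-elimˡ p)
      drop : ∀ u → need (ins v R) u + bit (needy R u) * bit (adj A v u) ≤ need R u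
      drop u = cases (needy R u) (adj A v u) refl refl
        where
          cases : ∀ b a → needy R u ≡ b → adj A v u ≡ a → need (ins v R) u + bit b * bit a ≤ need R u
          cases false a     _ _ = ≤-trans (≤-reflexive (+-identityʳ _)) (∸-monoʳ-≤ t (deg-mono A (⊆-∪ʳ (δ v) R) u))
          cases true  false _ _ = ≤-trans (≤-reflexive (+-identityʳ _)) (∸-monoʳ-≤ t (deg-mono A (⊆-∪ʳ (δ v) R) u))
          cases true  true  n a = begin
            t ∸ deg A (ins v R) u + 1 ≤⟨ +-monoˡ-≤ 1 (∸-monoʳ-≤ t (grows u a)) ⟩
            t ∸ suc (deg A R u) + 1 ≡⟨ +-comm _ 1 ⟩
            1 + (t ∸ suc (deg A R u)) ≡⟨ +-∸-assoc 1 (does-elim (deg A R u <? t) n) ⟨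
            t ∸ deg A R u ∎

  -- `count` is a potential: the total need starts at no more than t * # S, and every inserted
  -- vertex lowers it by at least t * w.
  record Stuck : Set where
    field
      R     : Subset N
      R⊆S   : R ⊆ S
      count : # R * (t * w) + total R ≤ t * # S
      stuck : ∀ v → v ∈ (S ∖ R) → gain R v < t * w

  search : Stuck
  search = go (suc (# (S ∖ none))) none (λ _ ()) start ≤-refl
    where
      none : Subset N
      none _ = false
      start : # none * (t * w) + total none ≤ t * # S
      start = ≤-trans (+-mono-≤ (≤-reflexive (cong (_* (t * w)) (sum-0 {N} λ _ → refl))) (sumOn-upper S t λ v _ → m∸n≤m t (deg A none v))) (≤-reflexive (*-comm (# S) t))
      go : ∀ n R → R ⊆ S → # R * (t * w) + total R ≤ t * # S → # (S ∖ R) < n → Stuck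
      go (suc n) R R⊆S count (s≤s lt) with any? (λ v → dec v)
        where
          open import Relation.Nullary.Decidable using (_×-dec_)
          dec : ∀ v → Dec (v ∈ (S ∖ R) × t * w ≤ gain R v)
          dec v = (v ∈? (S ∖ R)) ×-dec (t * w ≤? gain R v)
      ... | no none = record { R = R ; R⊆S = R⊆S ; count = count ; stuck = λ v v∈ → ≰⇒> λ q → none (v , v∈ , q) }
      ... | yes (v , v∈ , big) = go n (ins v R) ins⊆S (begin
          # (ins v R) * (t * w) + total (ins v R) ≤⟨ +-monoˡ-≤ _ (*-monoˡ-≤ (t * w) (≤-trans (#-∪ (δ v) R) (≤-reflexive (cong (_+ # R) (#-δ v))))) ⟩
          (t * w + # R * (t * w)) + total (ins v R) ≤⟨ +-monoˡ-≤ _ (+-monoˡ-≤ _ big) ⟩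
          (gain R v + # R * (t * w)) + total (ins v R) ≡⟨ arrange (gain R v) (# R * (t * w)) (total (ins v R)) ⟩
          # R * (t * w) + (total (ins v R) + gain R v) ≤⟨ +-monoʳ-≤ _ (total-ins R v (not-elim (∧-elimʳ {S v} v∈))) ⟩
          # R * (t * w) + total R ≤⟨ count ⟩
          t * # S ∎)
          (≤-trans (#-mono-< {S = S ∖ ins v R} {S ∖ R} (λ u p → ∧-intro (∧-elimˡ p) (not-intro λ q → not-elim (∧-elimʳ {S u} p) (⊆-∪ʳ (δ v) R u q)))
            v v∈ λ p → not-elim (∧-elimʳ {S v} p) (⊆-∪ˡ (δ v) R v (∈δ v))) lt)
        where
          open ≤-Reasoning
          arrange : ∀ g r t → (g + r) + t ≡ r + (t + g)
          arrange = solve-∀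
          ins⊆S : ins v R ⊆ S
          ins⊆S u p with ∪-elim (δ v) R p
          ... | inj₁ q = subst (_∈ S) (∈δ⇒≡ q) (∧-elimˡ v∈)
          ... | inj₂ q = R⊆S u q

  record Dominating : Set where
    field
      R         : Subset N
      R⊆S       : R ⊆ S
      R-small   : # R * w ≤ 2 * # S
      dominates : ∀ u → u ∈ (S ∖ R) → t ≤ deg A R u

  -- The vertices still needy when the greedy search is stuck are few, by double counting their
  -- links to S ∖ R: each sends at least t * w * w, while each vertex of S ∖ R receives fewer than t
  -- * w. They are added to R.
  dominating : 0 < t → 0 < w → t + t * w * w ≤ δ₀ → Dominating
  dominating 0<t 0<w large = record
    { R = R ∪ rest ; R⊆S = λ u p → [ R⊆S u , ∧-elimˡ ]′ (∪-elim R rest p)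
    ; R-small = begin
        # (R ∪ rest) * w ≤⟨ *-monoˡ-≤ w (#-∪ R rest) ⟩
        (# R + # rest) * w ≡⟨ *-distribʳ-+ w (# R) (# rest) ⟩
        # R * w + # rest * w ≤⟨ +-mono-≤ R-few rest-few ⟩
        # S + # S ≡⟨ cong (# S +_) (sym (+-identityʳ (# S))) ⟩
        2 * # S ∎
    ; dominates = λ u u∈ → ≤-trans (≮⇒≥ λ lt → not-elim (∧-elimʳ {S u} u∈) (⊆-∪ʳ R rest u (∧-intro (∧-elimˡ u∈) (does-true (deg A R u <? t) lt))))
        (deg-mono A (⊆-∪ˡ R rest) u) }
    where
      open ≤-Reasoning
      open Stuck search
      rest = S ∩ needy R
      R-few : # R * w ≤ # S
      R-few = *-cancelˡ-≤ t ⦃ >-nonZero 0<t ⦄ (begin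
        t * (# R * w) ≡⟨ arrange t (# R) w ⟩
        # R * (t * w) ≤⟨ m≤m+n _ (total R) ⟩
        # R * (t * w) + total R ≤⟨ count ⟩
        t * # S ∎)
        where arrange : ∀ t r w → t * (r * w) ≡ r * (t * w)
              arrange = solve-∀
      free-degree : ∀ u → u ∈ rest → t * w * w ≤ deg A (S ∖ R) u
      free-degree u u∈ = +-cancelˡ-≤ t _ _ (begin
        t + t * w * w ≤⟨ large ⟩
        δ₀ ≤⟨ min-deg u (∧-elimˡ u∈) ⟩
        deg A S u ≡⟨ deg-split A S R u ⟩
        deg A (S ∩ R) u + deg A (S ∖ R) u ≤⟨ +-monoˡ-≤ _ (≤-trans (deg-mono A (λ v p → ∧-elimʳ {S v} p) u) (<⇒≤ (does-elim (deg A R u <? t) (∧-elimʳ {S u} u∈)))) ⟩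
        t + deg A (S ∖ R) u ∎)
      rest-few : # rest * w ≤ # S
      rest-few = *-cancelʳ-≤ (# rest * w) (# S) (t * w) ⦃ m*n≢0 t w ⦃ >-nonZero 0<t ⦄ ⦃ >-nonZero 0<w ⦄ ⦄ (begin
        # rest * w * (t * w) ≡⟨ arrange (# rest) t w ⟩
        # rest * (t * w * w) ≤⟨ sumOn-lower rest (t * w * w) free-degree ⟩
        links A rest (S ∖ R) ≡⟨ links-sym A rest (S ∖ R) ⟩
        links A (S ∖ R) rest ≤⟨ sumOn-upper (S ∖ R) (t * w) (λ v v∈ → <⇒≤ (stuck v v∈)) ⟩
        # (S ∖ R) * (t * w) ≤⟨ *-monoˡ-≤ (t * w) (#-mono (⊆-∖ S R)) ⟩
        # S * (t * w) ∎)
        where arrange : ∀ r t w → r * w * (t * w) ≡ r * (t * w * w)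
              arrange = solve-∀

-- Connecting a dominating set by a small tree

record Subtree {N} (A : Graph N) (S : Subset N) : Set where
  field
    {size} : ℕ
    vs     : Vec (Fin N) (suc size)
    tree   : Tree A vs
    inside : ∀ i → lookup vs i ∈ S
  span : Subset N
  span = image (lookup vs)

module Connect {N} (A : Graph N) (S : Subset N) (cross : Crossing A S) (R : Subset N) (R⊆S : R ⊆ S)
  (dominates : ∀ u → u ∈ (S ∖ R) → 1 ≤ deg A R u) where
  open Subtree

  record Extension (T : Subtree A S) (k : ℕ) (v : Fin N) : Set where
    field
      bigger : Subtree A S
      larger : size bigger ≤ k + size T
      keeps  : span T ⊆ span bigger
      has    : v ∈ span bigger

  extend : ∀ T u v → u ∈ span T → v ∈ S → adj A u v ≡ true → Extension T 1 v
  extend T u v u∈ v∈S a with v ∈? span T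
  ... | yes v∈ = record { bigger = T ; larger = n≤1+n _ ; keeps = λ _ p → p ; has = v∈ }
  ... | no v∉ with i , refl ← image-∈⁻¹ (lookup (vs T)) u∈ = record
    { bigger = record { vs = v ∷ vs T ; tree = grow (tree T) v i (λ j eq → v∉ (subst (_∈ span T) eq (image-∈ (lookup (vs T)) j))) a
                      ; inside = λ { zero → v∈S ; (suc j) → inside T j } }
    ; larger = ≤-refl
    ; keeps = λ x p → let j , eq = image-∈⁻¹ (lookup (vs T)) p in subst (_∈ image (lookup (v ∷ vs T))) eq (image-∈ (lookup (v ∷ vs T)) (suc j))
    ; has = image-∈ (lookup (v ∷ vs T)) zero }

  compose : ∀ {T j k u v} (e : Extension T j u) → Extension (Extension.bigger e) k v → Extension T (k + j) v
  compose {T} {j} {k} e f = record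
    { bigger = Extension.bigger f
    ; larger = ≤-trans (Extension.larger f) (≤-trans (+-monoʳ-≤ k (Extension.larger e)) (≤-reflexive (sym (+-assoc k j (size T)))))
    ; keeps = λ x p → Extension.keeps f x (Extension.keeps e x p) ; has = Extension.has f }

  weaken : ∀ {T j k v} → j ≤ k → Extension T j v → Extension T k v
  weaken {T} le e = record { Extension e ; larger = ≤-trans (Extension.larger e) (+-monoˡ-≤ (size T) le) }

  Touched : Subtree A S → Subset N
  Touched T v = does (1 ≤? deg A (R ∩ span T) v)

  Near : Subtree A S → Subset N
  Near T = span T ∪ Touched T

  near-elim : ∀ T v → v ∈ Near T → v ∈ span T ⊎ ∃ λ r → r ∈ (R ∩ span T) × adj A r v ≡ true
  near-elim T v p with ∪-elim (span T) (Touched T) {v} p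
  ... | inj₁ q = inj₁ q
  ... | inj₂ q = let r , r∈ = #-pos⁻¹ ((R ∩ span T) ∩ adj A v) (does-elim (1 ≤? deg A (R ∩ span T) v) q) in
    inj₂ (r , ∧-elimˡ r∈ , trans (adj-sym A r v) (∧-elimʳ {(R ∩ span T) r} r∈))

  not-near : ∀ T v → ¬ (v ∈ Near T) → ¬ (v ∈ span T) × (∀ r → r ∈ R → r ∈ span T → adj A v r ≡ true → ⊥)
  not-near T v ¬p = (λ q → ¬p (⊆-∪ˡ (span T) (Touched T) v q)) , λ r r∈R r∈ a →
    ¬p (⊆-∪ʳ (span T) (Touched T) v (does-true (1 ≤? deg A (R ∩ span T) v) (#-pos ((R ∩ span T) ∩ adj A v) r (∧-intro (∧-intro r∈R r∈) a))))

  reach : ∀ T u → u ∈ S → u ∈ Near T → Extension T 1 u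
  reach T u u∈S p with near-elim T u p
  ... | inj₁ q = record { bigger = T ; larger = n≤1+n _ ; keeps = λ _ p → p ; has = q }
  ... | inj₂ (r , r∈ , a) = extend T r u (∧-elimʳ {R r} r∈) u∈S a

  -- If r is far from the tree, some edge u v leaves the near set. Then u is at most one step from
  -- the tree, and v is in R or has a neighbour s in R, which is off the tree because v is not near.
  -- So u, v and s suffice: three new vertices for one more vertex of R.
  capture : ∀ T → (∃ λ r → r ∈ (R ∖ span T)) → ∃ λ r → r ∈ (R ∖ span T) × Extension T 3 r
  capture T (r , r∈) with r ∈? Near T
  ... | yes near = r , r∈ , weaken (s≤s z≤n) (reach T r (R⊆S r (∧-elimˡ r∈)) near)
  ... | no far with cross (Near T) (lookup (vs T) zero , ∧-intro (inside T zero) (⊆-∪ˡ (span T) (Touched T) (lookup (vs T) zero) (image-∈ (lookup (vs T)) zero)))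
                    (r , ∧-intro (R⊆S r (∧-elimˡ r∈)) (not-intro far))
  ...   | u , v , u∈ , v∈ , a = final (v ∈? R)
    where
      v∈S = ∧-elimˡ v∈
      v-far = not-near T v (not-elim (∧-elimʳ {S v} v∈))
      to-v : Extension T 2 v
      to-v = let e = reach T u (∧-elimˡ u∈) (∧-elimʳ {S u} u∈) in compose e (extend (Extension.bigger e) u v (Extension.has e) v∈S a)
      final : Dec (v ∈ R) → ∃ λ r → r ∈ (R ∖ span T) × Extension T 3 r
      final (yes v∈R) = v , ∧-intro v∈R (not-intro (proj₁ v-far)) , weaken (s≤s (s≤s z≤n)) to-v
      final (no v∉R) with s , s∈ ← #-pos⁻¹ (R ∩ adj A v) (dominates v (∧-intro v∈S (not-intro v∉R))) =
        s , ∧-intro (∧-elimˡ s∈) (not-intro λ q → proj₂ v-far s (∧-elimˡ s∈) q (∧-elimʳ {R s} s∈)) ,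
        compose to-v (extend (Extension.bigger to-v) v s (Extension.has to-v) (R⊆S s (∧-elimˡ s∈)) (∧-elimʳ {R s} s∈))

  connect : 0 < # R → ∃ λ (T : Subtree A S) → R ⊆ span T × suc (size T) ≤ 3 * # R
  connect pos = go (suc (# (R ∖ span T₀))) T₀ (≤-trans (s≤s z≤n) (*-monoʳ-≤ 3 start)) ≤-refl
    where
      r₀ = proj₁ (#-pos⁻¹ R pos)
      r₀∈R = proj₂ (#-pos⁻¹ R pos)
      T₀ : Subtree A S
      T₀ = record { vs = r₀ ∷ [] ; tree = root r₀ ; inside = λ { zero → R⊆S r₀ r₀∈R } }
      start : 1 ≤ # (R ∩ span T₀)
      start = #-pos (R ∩ span T₀) r₀ (∧-intro r₀∈R (image-∈ (lookup (r₀ ∷ [])) zero))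
      go : ∀ n (T : Subtree A S) → suc (size T) ≤ 3 * # (R ∩ span T) → # (R ∖ span T) < n → ∃ λ (T : Subtree A S) → R ⊆ span T × suc (size T) ≤ 3 * # R
      go (suc n) T le (s≤s lt) with any? (λ r → r ∈? (R ∖ span T))
      ... | no none = T , (λ r r∈R → covered r r∈R (r ∈? span T)) , ≤-trans le (*-monoʳ-≤ 3 (#-mono (⊆-∩ˡ R (span T))))
        where
          covered : ∀ r → r ∈ R → Dec (r ∈ span T) → r ∈ span T
          covered r r∈R (yes p) = p
          covered r r∈R (no ¬p) = ⊥-elim (none (r , ∧-intro r∈R (not-intro ¬p)))
      ... | yes missing with r , r∈ , e ← capture T missing = go n T′ (begin
          suc (size T′) ≤⟨ s≤s larger ⟩
          suc (3 + size T) ≡⟨ +-suc 3 (size T) ⟨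
          3 + suc (size T) ≤⟨ +-monoʳ-≤ 3 le ⟩
          3 + 3 * # (R ∩ span T) ≡⟨ *-suc 3 (# (R ∩ span T)) ⟨
          3 * suc (# (R ∩ span T)) ≤⟨ *-monoʳ-≤ 3 (#-mono-< {S = R ∩ span T} {R ∩ span T′} (λ x p → ∧-intro (∧-elimˡ p) (keeps x (∧-elimʳ {R x} p)))
                                            r (∧-intro (∧-elimˡ r∈) has) λ p → not-elim (∧-elimʳ {R r} r∈) (∧-elimʳ {R r} p)) ⟩
          3 * # (R ∩ span T′) ∎)
          (≤-trans (#-mono-< {S = R ∖ span T′} {R ∖ span T} (λ x p → ∧-intro (∧-elimˡ p) (not-intro λ q → not-elim (∧-elimʳ {R x} p) (keeps x q)))
            r r∈ λ p → not-elim (∧-elimʳ {R r} p) has) lt)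
        where
          open ≤-Reasoning
          open Extension e renaming (bigger to T′)

-- Counting the subgraphs attached to a small tree

rank-cong : ∀ {N} {S T : Subset N} → (∀ v → S v ≡ T v) → ∀ v → rank S v ≡ rank T v
rank-cong p zero    = refl
rank-cong p (suc v) = cong₂ _+_ (cong bit (p zero)) (rank-cong (p ∘ suc) v)

common : ∀ {N s} → Graph N → (Fin s → Fin N) → Subset N
common G f z = does (all? (λ i → z ∈? adj G (f i)))

common-∈ : ∀ {N s} (G : Graph N) (f : Fin s → Fin N) z → (∀ i → adj G (f i) z ≡ true) → z ∈ common G f
common-∈ G f z p = does-true (all? (λ i → z ∈? adj G (f i))) p

common-∈⁻¹ : ∀ {N s} (G : Graph N) (f : Fin s → Fin N) z → z ∈ common G f → ∀ i → adj G (f i) z ≡ true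
common-∈⁻¹ G f z p = does-elim (all? (λ i → z ∈? adj G (f i))) p

Bool-ext : ∀ {a b} → (a ≡ true → b ≡ true) → (b ≡ true → a ≡ true) → a ≡ b
Bool-ext {true}  {b}     f g = sym (f refl)
Bool-ext {false} {false} f g = refl
Bool-ext {false} {true}  f g = g refl

common-cong : ∀ {N s} (G : Graph N) {f g : Fin s → Fin N} → (∀ i → f i ≡ g i) → ∀ z → common G f z ≡ common G g z
common-cong G {f} {g} p z = Bool-ext
  (λ q → common-∈ G g z λ i → subst (λ x → adj G x z ≡ true) (p i) (common-∈⁻¹ G f z q i))
  (λ q → common-∈ G f z λ i → subst (λ x → adj G x z ≡ true) (sym (p i)) (common-∈⁻¹ G g z q i))

common-few : ∀ {N t} (G : Graph N) → ¬ ContainsKtt t G → ∀ (f : Fin t → Fin N) → Injective _≡_ _≡_ f → # (common G f) < t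
common-few {N} {t} G noK f f-inj with t ≤? # (common G f)
... | no ¬p = ≰⇒> ¬p
... | yes p = ⊥-elim (noK (f , (λ i → enum (common G f) (inject≤ i p)) , f-inj ,
  (λ eq → inject≤-injective p p _ _ (enum-injective (common G f) eq)) , λ i j → common-∈⁻¹ G f _ (enum-∈ (common G f) _) i))

-- One more than the cost per chosen vertex: with M ≤ 2 m, smallness and two colours cost (2 (c +
-- 1)) ^ 2, the position of the root 4, the tree code 2, and the position in a common neighbourhood
-- t.
options : ℕ → ℕ → ℕ
options c t = suc (8 * t * (2 * suc c) ^ 2)

module NearRegular (X : GraphFamily) (her : Hereditary X) (c : ℕ) (small : ∀ n → CardX≤ X n (n ! * c ^ n))
  {N} (G : Graph N) (G∈X : X N G) (t′ : ℕ) (noK : ¬ ContainsKtt (suc t′) G) where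

  t = suc t′

  module Core (S : Subset N) (D q : ℕ) (D<2^q : suc D ≤ 2 ^ q) (0<q : 0 < q) (max-deg : ∀ v → v ∈ S → deg G S v ≤ D)
    {p} (vs : Vec (Fin N) (suc p)) (tree : Tree G vs) (vs∈S : ∀ i → lookup vs i ∈ S)
    (k m : ℕ) (m≡ : m ≡ suc p * q) (pool : Fin m → Fin k → Fin N) (pool-inj : ∀ j i j′ i′ → pool j i ≡ pool j′ i′ → j ≡ j′ × i ≡ i′)
    (pool-vs : ∀ j i l → pool j i ≢ lookup vs l) (nbr : Fin m → Fin k → Fin t → Fin (suc p)) (nbr-inj : ∀ j i → Injective _≡_ _≡_ (nbr j i))
    (nbr-adj : ∀ j i s → adj G (lookup vs (nbr j i s)) (pool j i) ≡ true) where

    I : Set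
    I = Fin (suc p) ⊎ Fin m

    M = suc p + m

    dec : Fin M → I
    dec = splitAt (suc p)

    enc : I → Fin M
    enc = join (suc p) m

    dec-enc : ∀ x → dec (enc x) ≡ x
    dec-enc = splitAt-join (suc p) m

    enc-dec : ∀ a → enc (dec a) ≡ a
    enc-dec = join-splitAt (suc p) m

    vs-inj : Injective _≡_ _≡_ (lookup vs)
    vs-inj = tree-injective tree

    vI : (Fin m → Fin k) → I → Fin N
    vI χ (inj₁ i) = lookup vs i
    vI χ (inj₂ j) = pool j (χ j)

    v : (Fin m → Fin k) → Fin M → Fin N
    v χ a = vI χ (dec a)

    vI-inj : ∀ χ χ′ x x′ → vI χ x ≡ vI χ′ x′ → x ≡ x′
    vI-inj χ χ′ (inj₁ i) (inj₁ i′) eq = cong inj₁ (vs-inj eq)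
    vI-inj χ χ′ (inj₁ i) (inj₂ j)  eq = ⊥-elim (pool-vs j (χ′ j) i (sym eq))
    vI-inj χ χ′ (inj₂ j) (inj₁ i)  eq = ⊥-elim (pool-vs j (χ j) i eq)
    vI-inj χ χ′ (inj₂ j) (inj₂ j′) eq = cong inj₂ (proj₁ (pool-inj j (χ j) j′ (χ′ j′) eq))

    v-inj : ∀ χ χ′ a a′ → v χ a ≡ v χ′ a′ → a ≡ a′
    v-inj χ χ′ a a′ eq = trans (sym (enc-dec a)) (trans (cong enc (vI-inj χ χ′ (dec a) (dec a′) eq)) (enc-dec a′))

    v-χ : ∀ χ χ′ → (∀ a → v χ a ≡ v χ′ a) → ∀ j → χ j ≡ χ′ j
    v-χ χ χ′ eq j = proj₂ (pool-inj j (χ j) j (χ′ j) (subst (λ x → vI χ x ≡ vI χ′ x) (dec-enc (inj₂ j)) (eq (enc (inj₂ j)))))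

    colI : I → Fin 2
    colI (inj₁ _) = zero
    colI (inj₂ _) = suc zero

    col : Fin M → Fin 2
    col a = colI (dec a)

    colI-zero : ∀ x → colI x ≡ zero → ∃ λ i → x ≡ inj₁ i
    colI-zero (inj₁ i) _ = i , refl

    φ : (Fin m → Fin k) → (Fin M → Fin M) → Fin (suc p) → Fin N
    φ χ ψ i = v χ (ψ (enc (inj₁ i)))

    -- The t tree neighbours are those of the vertex chosen by the reference χ₀. The code may refer
    -- to χ₀, because codes are compared only within one fibre.
    hood : (χ₀ χ₁ : Fin m → Fin k) → (Fin M → Fin M) → Fin m → Subset N
    hood χ₀ χ₁ ψ j = common G (φ χ₁ ψ ∘ nbr j (χ₀ j))

    hoodCode : (χ₀ χ₁ : Fin m → Fin k) → (Fin M → Fin M) → Fin m → ℕ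
    hoodCode χ₀ χ₁ ψ j = rank (hood χ₀ χ₁ ψ j) (v χ₁ (ψ (enc (inj₂ j))))

    code₁ : (χ₁ : Fin m → Fin k) → (Fin M → Fin M) → Fin (suc D ^ p)
    code₁ χ₁ ψ = funToFin (λ e → clamp D (treeCode tree G S (φ χ₁ ψ) e))

    code₂ : (χ₀ χ₁ : Fin m → Fin k) → (Fin M → Fin M) → Fin (suc t′ ^ m)
    code₂ χ₀ χ₁ ψ = funToFin (λ j → clamp t′ (hoodCode χ₀ χ₁ ψ j))

    code : (χ₀ χ₁ : Fin m → Fin k) → (Fin M → Fin M) → Fin (M * (suc D ^ p * suc t′ ^ m))
    code χ₀ χ₁ ψ = combine (ψ (enc (inj₁ (fromℕ p)))) (combine (code₁ χ₁ ψ) (code₂ χ₀ χ₁ ψ))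

    module Embedding (χ₀ χ₁ : Fin m → Fin k) (ψ : Fin M → Fin M) (iso : ColourIso G col (v χ₀) (v χ₁) ψ) where
      open ColourIso iso renaming (inj to ψ-inj)

      ψI : I → I
      ψI x = dec (ψ (enc x))

      ψI-inj : ∀ {x y} → ψI x ≡ ψI y → x ≡ y
      ψI-inj {x} {y} eq = trans (sym (dec-enc x)) (trans (cong dec (ψ-inj (trans (sym (enc-dec _)) (trans (cong enc eq) (enc-dec _))))) (dec-enc y))

      ψI-adj : ∀ x y → adj G (vI χ₀ x) (vI χ₀ y) ≡ true → adj G (vI χ₁ (ψI x)) (vI χ₁ (ψI y)) ≡ true
      ψI-adj x y a = trans (sym (edges (enc x) (enc y))) (trans (cong₂ (λ x y → adj G (vI χ₀ x) (vI χ₀ y)) (dec-enc x) (dec-enc y)) a)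

      br-image : ∀ i → ∃ λ i′ → ψI (inj₁ i) ≡ inj₁ i′
      br-image i = colI-zero (ψI (inj₁ i)) (trans (colours (enc (inj₁ i))) (cong colI (dec-enc (inj₁ i))))

      φ-∈ : ∀ i → φ χ₁ ψ i ∈ S
      φ-∈ i = let i′ , eq = br-image i in subst (_∈ S) (cong (vI χ₁) (sym eq)) (vs∈S i′)

      φ-inj : ∀ {i j} → φ χ₁ ψ i ≡ φ χ₁ ψ j → i ≡ j
      φ-inj {i} {j} eq = inj₁-injective (ψI-inj (vI-inj χ₁ χ₁ _ _ eq))
        where open import Data.Sum.Properties using (inj₁-injective)

      tree-adj : ∀ e → adj G (φ χ₁ ψ (parent tree e)) (φ χ₁ ψ (inject₁ e)) ≡ true
      tree-adj e = ψI-adj (inj₁ (parent tree e)) (inj₁ (inject₁ e)) (parent-adj tree e)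

      code≤D : ∀ e → treeCode tree G S (φ χ₁ ψ) e ≤ D
      code≤D e = ≤-trans (<⇒≤ (rank< (S ∩ adj G (φ χ₁ ψ (parent tree e))) (φ χ₁ ψ (inject₁ e)) (∧-intro (φ-∈ (inject₁ e)) (tree-adj e)))) (max-deg _ (φ-∈ (parent tree e)))

      in-hood : ∀ j → v χ₁ (ψ (enc (inj₂ j))) ∈ hood χ₀ χ₁ ψ j
      in-hood j = common-∈ G (φ χ₁ ψ ∘ nbr j (χ₀ j)) _ λ s → ψI-adj (inj₁ (nbr j (χ₀ j) s)) (inj₂ j) (nbr-adj j (χ₀ j) s)

      hood≤ : ∀ j → hoodCode χ₀ χ₁ ψ j ≤ t′
      hood≤ j = ≤-pred (<-trans (rank< (hood χ₀ χ₁ ψ j) _ (in-hood j)) (common-few G noK (φ χ₁ ψ ∘ nbr j (χ₀ j)) λ eq → nbr-inj j (χ₀ j) (φ-inj eq)))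

    rigid : ∀ χ₀ χ₁ ψ₁ χ₂ ψ₂ → ColourIso G col (v χ₀) (v χ₁) ψ₁ → ColourIso G col (v χ₀) (v χ₂) ψ₂ →
      code χ₀ χ₁ ψ₁ ≡ code χ₀ χ₂ ψ₂ → ∀ a → v χ₁ (ψ₁ a) ≡ v χ₂ (ψ₂ a)
    rigid χ₀ χ₁ ψ₁ χ₂ ψ₂ iso₁ iso₂ eq a = subst (λ a → v χ₁ (ψ₁ a) ≡ v χ₂ (ψ₂ a)) (enc-dec a) (onI (dec a))
      where
        module I₁ = Embedding χ₀ χ₁ ψ₁ iso₁
        module I₂ = Embedding χ₀ χ₂ ψ₂ iso₂
        eqs = combine-injective (ψ₁ (enc (inj₁ (fromℕ p)))) (combine (code₁ χ₁ ψ₁) (code₂ χ₀ χ₁ ψ₁)) (ψ₂ (enc (inj₁ (fromℕ p)))) (combine (code₁ χ₂ ψ₂) (code₂ χ₀ χ₂ ψ₂)) eq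
        eqs′ = combine-injective (code₁ χ₁ ψ₁) (code₂ χ₀ χ₁ ψ₁) (code₁ χ₂ ψ₂) (code₂ χ₀ χ₂ ψ₂) (proj₂ eqs)
        root-≡ : φ χ₁ ψ₁ (fromℕ p) ≡ φ χ₂ ψ₂ (fromℕ p)
        root-≡ with i , e₁ ← I₁.br-image (fromℕ p) | j , e₂ ← I₂.br-image (fromℕ p)
          with refl ← trans (sym e₁) (trans (cong dec (proj₁ eqs)) e₂) = trans (cong (vI χ₁) e₁) (cong (vI χ₂) (sym e₂))
        φ≡ : ∀ i → φ χ₁ ψ₁ i ≡ φ χ₂ ψ₂ i
        φ≡ = tree-decode tree G S (φ χ₁ ψ₁) (φ χ₂ ψ₂) I₁.φ-∈ I₂.φ-∈ I₁.tree-adj I₂.tree-adj root-≡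
          λ e → clamp-injective D (I₁.code≤D e) (I₂.code≤D e) (funToFin-injective (proj₁ eqs′) e)
        hood≡ : ∀ j z → hood χ₀ χ₁ ψ₁ j z ≡ hood χ₀ χ₂ ψ₂ j z
        hood≡ j = common-cong G λ s → φ≡ (nbr j (χ₀ j) s)
        onI : ∀ x → v χ₁ (ψ₁ (enc x)) ≡ v χ₂ (ψ₂ (enc x))
        onI (inj₁ i) = φ≡ i
        onI (inj₂ j) = rank-injective (hood χ₀ χ₁ ψ₁ j) _ _ (I₁.in-hood j) (trans (hood≡ j _) (I₂.in-hood j))
          (trans (clamp-injective t′ (I₁.hood≤ j) (I₂.hood≤ j) (funToFin-injective (proj₂ eqs′) j)) (sym (rank-cong (hood≡ j) (v χ₂ (ψ₂ (enc (inj₂ j)))))))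

    counted : k ^ m ≤ (c * 2) ^ M * (M * (suc D ^ p * t ^ m))
    counted = counting X her c small G G∈X v v-inj v-χ col code rigid

    p<m : suc p ≤ m
    p<m = ≤-trans (m≤m*n (suc p) q ⦃ >-nonZero 0<q ⦄) (≤-reflexive (sym m≡))

    impossible : k ≡ options c t → ⊥
    impossible refl = <⇒≱ (^-mono-< (8 * t * (2 * suc c) ^ 2) m (≤-trans (s≤s z≤n) p<m)) (begin
      k ^ m ≤⟨ counted ⟩
      (c * 2) ^ M * (M * (suc D ^ p * t ^ m)) ≤⟨ *-mono-≤ (^-monoˡ-≤ M (≤-trans (*-monoˡ-≤ 2 (n≤1+n c)) (≤-reflexive (*-comm (suc c) 2)))) (*-mono-≤ (<⇒≤ (n<2^n M)) (*-monoˡ-≤ (t ^ m) tree-factor)) ⟩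
      (2 * suc c) ^ M * (2 ^ M * (2 ^ m * t ^ m)) ≤⟨ *-mono-≤ (^-monoʳ-≤ (2 * suc c) M≤) (*-monoˡ-≤ (2 ^ m * t ^ m) (^-monoʳ-≤ 2 M≤)) ⟩
      (2 * suc c) ^ (2 * m) * (2 ^ (2 * m) * (2 ^ m * t ^ m)) ≡⟨ cong₂ (λ x y → x * (y * (2 ^ m * t ^ m))) (sym (^-*-assoc (2 * suc c) 2 m)) (sym (^-*-assoc 2 2 m)) ⟩
      ((2 * suc c) ^ 2) ^ m * (4 ^ m * (2 ^ m * t ^ m)) ≡⟨ arrange (((2 * suc c) ^ 2) ^ m) (4 ^ m) (2 ^ m) (t ^ m) ⟩
      4 ^ m * 2 ^ m * t ^ m * ((2 * suc c) ^ 2) ^ m ≡⟨ cong (λ x → x * t ^ m * ((2 * suc c) ^ 2) ^ m) (sym (^-distribʳ-* m 4 2)) ⟩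
      8 ^ m * t ^ m * ((2 * suc c) ^ 2) ^ m ≡⟨ cong (_* ((2 * suc c) ^ 2) ^ m) (sym (^-distribʳ-* m 8 t)) ⟩
      (8 * t) ^ m * ((2 * suc c) ^ 2) ^ m ≡⟨ sym (^-distribʳ-* m (8 * t) ((2 * suc c) ^ 2)) ⟩
      (8 * t * (2 * suc c) ^ 2) ^ m ∎)
      where
        open ≤-Reasoning
        arrange : ∀ a b c d → a * (b * (c * d)) ≡ b * c * d * a
        arrange = solve-∀
        M≤ : M ≤ 2 * m
        M≤ = ≤-trans (+-monoˡ-≤ m p<m) (≤-reflexive (cong (m +_) (sym (+-identityʳ m))))
        tree-factor : suc D ^ p ≤ 2 ^ m
        tree-factor = begin
          suc D ^ p ≤⟨ ^-monoʳ-≤ (suc D) (n≤1+n p) ⟩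
          suc D ^ suc p ≤⟨ ^-monoˡ-≤ (suc p) D<2^q ⟩
          (2 ^ q) ^ suc p ≡⟨ ^-*-assoc 2 q (suc p) ⟩
          2 ^ (q * suc p) ≡⟨ cong (2 ^_) (trans (*-comm q (suc p)) (sym m≡)) ⟩
          2 ^ m ∎

  module Finish (S : Subset N) (D q : ℕ) (D<2^q : suc D ≤ 2 ^ q) (0<q : 0 < q) (max-deg : ∀ v → v ∈ S → deg G S v ≤ D) {k : ℕ} (k≡ : k ≡ options c t)
    (R : Subset N) (R-small : # R * (6 * (q * k + 1)) ≤ 2 * # S) (dominates : ∀ u → u ∈ (S ∖ R) → t ≤ deg G R u)
    (T : Subtree G S) (R⊆span : R ⊆ Subtree.span T) (short : suc (Subtree.size T) ≤ 3 * # R) where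
      open Subtree T renaming (size to p)
      m = suc p * q
      U = S ∖ span
      -- The factor 6 in w is 2 * 3: the tree has at most 3 * # R vertices, and # R * w ≤ 2 * # S.
      -- The summand 1 leaves room for the tree itself.
      room : suc p * (q * k + 1) ≤ # S
      room = *-cancelˡ-≤ 2 (begin
        2 * (suc p * (q * k + 1)) ≤⟨ *-monoʳ-≤ 2 (*-monoˡ-≤ (q * k + 1) short) ⟩
        2 * (3 * # R * (q * k + 1)) ≡⟨ r (# R) (q * k + 1) ⟩
        # R * (6 * (q * k + 1)) ≤⟨ R-small ⟩
        2 * # S ∎)
        where
          open ≤-Reasoning
          r : ∀ x y → 2 * (3 * x * y) ≡ x * (6 * y)
          r = solve-∀
      U-large : m * k ≤ # U
      U-large = +-cancelˡ-≤ (suc p) _ _ (begin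
        suc p + m * k ≡⟨ r (suc p) q k ⟩
        suc p * (q * k + 1) ≤⟨ room ⟩
        # S ≡⟨ #-split S span ⟩
        # (S ∩ span) + # U ≤⟨ +-monoˡ-≤ (# U) (≤-trans (#-mono λ v q → ∧-elimʳ {S v} q) (#-image (lookup vs))) ⟩
        suc p + # U ∎)
        where
          open ≤-Reasoning
          r : ∀ p q k → p + p * q * k ≡ p * (q * k + 1)
          r = solve-∀
      pool : Fin m → Fin k → Fin N
      pool j i = enum U (inject≤ (combine j i) U-large)
      pool-∈ : ∀ j i → pool j i ∈ U
      pool-∈ j i = enum-∈ U _
      pool-inj : ∀ j i j′ i′ → pool j i ≡ pool j′ i′ → j ≡ j′ × i ≡ i′
      pool-inj j i j′ i′ eq = combine-injective j i j′ i′ (inject≤-injective U-large U-large _ _ (enum-injective U eq))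
      pool-vs : ∀ j i l → pool j i ≢ lookup vs l
      pool-vs j i l eq = not-elim (∧-elimʳ {S (pool j i)} (pool-∈ j i)) (subst (_∈ span) (sym eq) (image-∈ (lookup vs) l))
      helpers : Fin N → Subset N
      helpers u = R ∩ adj G u
      many : ∀ j i → t ≤ # (helpers (pool j i))
      many j i = dominates (pool j i) (∧-intro (∧-elimˡ (pool-∈ j i)) (not-intro λ q → not-elim (∧-elimʳ {S (pool j i)} (pool-∈ j i)) (R⊆span _ q)))
      helper : ∀ j i → Fin t → Fin N
      helper j i s = enum (helpers (pool j i)) (inject≤ s (many j i))
      helper-∈ : ∀ j i s → helper j i s ∈ helpers (pool j i)
      helper-∈ j i s = enum-∈ (helpers (pool j i)) _
      index : ∀ j i s → ∃ λ l → lookup vs l ≡ helper j i s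
      index j i s = image-∈⁻¹ (lookup vs) (R⊆span _ (∧-elimˡ (helper-∈ j i s)))
      nbr : Fin m → Fin k → Fin t → Fin (suc p)
      nbr j i s = proj₁ (index j i s)
      nbr-inj : ∀ j i → Injective _≡_ _≡_ (nbr j i)
      nbr-inj j i {s} {s′} eq = inject≤-injective (many j i) (many j i) _ _ (enum-injective (helpers (pool j i))
        (trans (sym (proj₂ (index j i s))) (trans (cong (lookup vs) eq) (proj₂ (index j i s′)))))
      nbr-adj : ∀ j i s → adj G (lookup vs (nbr j i s)) (pool j i) ≡ true
      nbr-adj j i s = trans (cong (λ z → adj G z (pool j i)) (proj₂ (index j i s)))
        (trans (adj-sym G _ _) (∧-elimʳ {R (helper j i s)} (helper-∈ j i s)))
      impossible : ⊥
      impossible = Core.impossible S D q D<2^q 0<q max-deg vs tree inside k m refl pool pool-inj pool-vs nbr nbr-inj nbr-adj k≡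

  -- A minimal set of density 8 a has minimum degree 4 a. Domination asks for about t * w * w of it
  -- with w proportional to q, so the density needed is quadratic in log D.
  near-regular-sparse : ∀ D q a → suc D ≤ 2 ^ q → 0 < q → (∀ w → w ≡ 6 * (q * options c t + 1) → t + t * w * w ≤ 4 * a) →
    ∀ S → (∀ v → v ∈ S → deg G S v ≤ D) → 0 < # S → E G S < 8 * a * # S
  near-regular-sparse D q a D<2^q 0<q large = no-dense G (8 * a) (λ S → ∀ v → v ∈ S → deg G S v ≤ D)
    (λ T⊆S P v v∈T → ≤-trans (deg-mono G T⊆S v) (P v (T⊆S v v∈T))) λ S P pos dense sparser → refute S P pos dense sparser (options c t) refl
    where
      refute : ∀ S → (∀ v → v ∈ S → deg G S v ≤ D) → 0 < # S → 8 * a * # S ≤ E G S →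
        (∀ T → T ⊆ S → # T < # S → 0 < # T → E G T < 8 * a * # T) → ∀ k → k ≡ options c t → ⊥
      refute S max-deg pos dense sparser k k≡ = connected (Dominate.dominating G S t w (4 * a) min-deg (s≤s z≤n) 0<w (large w (cong (λ k → 6 * (q * k + 1)) k≡)))
        where
          open MinimalDense G (8 * a) S dense sparser
          w = 6 * (q * k + 1)
          min-deg : ∀ v → v ∈ S → 4 * a ≤ deg G S v
          min-deg v v∈ = *-cancelˡ-≤ 2 (≤-trans (≤-reflexive (r a)) (min-degree v v∈))
            where r : ∀ a → 2 * (4 * a) ≡ 8 * a
                  r = solve-∀
          0<w : 0 < w
          0<w = *-mono-≤ {1} {6} {1} {q * k + 1} (s≤s z≤n) (m≤n+m 1 (q * k))
          connected : Dominate.Dominating G S t w (4 * a) min-deg → ⊥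
          connected dom = finish (Connect.connect G S crossing R R⊆S (λ u u∈ → ≤-trans (s≤s z≤n) (dominates u u∈)) R-pos)
            where
              open Dominate.Dominating dom
              R-pos : 0 < # R
              R-pos = let v , v∈S = #-pos⁻¹ S pos in cases v v∈S (v ∈? R)
                where
                  cases : ∀ v → v ∈ S → Dec (v ∈ R) → 0 < # R
                  cases v v∈S (yes v∈R) = #-pos R v v∈R
                  cases v v∈S (no v∉R)  = ≤-trans (s≤s z≤n) (≤-trans (dominates v (∧-intro v∈S (not-intro v∉R))) (deg≤# G R v))
              finish : (∃ λ (T : Subtree G S) → R ⊆ Subtree.span T × suc (Subtree.size T) ≤ 3 * # R) → ⊥
              finish (T , R⊆span , short) = Finish.impossible S D q D<2^q 0<q max-deg k≡ R R-small dominates T R⊆span short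

-- Constants

2^-+ : ∀ x y → 2 ^ (x + y) ≡ 2 ^ x * 2 ^ y
2^-+ = ^-distribˡ-+-* 2

2^-mono : ∀ {x y} → x ≤ y → 2 ^ x ≤ 2 ^ y
2^-mono = ^-monoʳ-≤ 2

+≤2^suc : ∀ {a b} x → a ≤ 2 ^ x → b ≤ 2 ^ x → a + b ≤ 2 ^ suc x
+≤2^suc x p q = ≤-trans (+-mono-≤ p q) (≤-reflexive (cong (2 ^ x +_) (sym (+-identityʳ (2 ^ x)))))

*≤2^+ : ∀ {a b} x y → a ≤ 2 ^ x → b ≤ 2 ^ y → a * b ≤ 2 ^ (x + y)
*≤2^+ x y p q = ≤-trans (*-mono-≤ p q) (≤-reflexive (sym (2^-+ x y)))

^≤2^* : ∀ {a} x n → a ≤ 2 ^ x → a ^ n ≤ 2 ^ (x * n)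
^≤2^* x n p = ≤-trans (^-monoˡ-≤ n p) (≤-reflexive (^-*-assoc 2 x n))

suc≤2^suc : ∀ {a} x → a ≤ 2 ^ x → suc a ≤ 2 ^ suc x
suc≤2^suc x p = +≤2^suc x (m^n>0 2 x) p

module _ (c : ℕ) where

  -- The exponent of a power of two above `blocks c L`, quadratic in L.
  κ : ℕ → ℕ
  κ L = (1 + c + L) * (2 * L) + 2

  -- The logarithms of `s` and `a`, chosen so that 8 * (2 + σ) * 2 ^ κ ≤ 2 ^ σ and q * 2 ^ κ ≤ 2 ^
  -- α.
  σ α : ℕ → ℕ
  σ L = κ L + (κ L + 6)
  α L = 5 * κ L + 20

  -- The logarithm of `y`, which has to exceed a power of the threshold for 2 L + 1 with exponent s
  -- = 2 ^ σ.
  η : ℕ → ℕ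
  η L = (α (L + suc L) + 5) * 2 ^ σ L + (σ L + 8)

  blocks≤ : ∀ L → blocks c L ≤ 2 ^ κ L
  blocks≤ L = begin
    suc (2 * base c L ^ (2 * L)) ≤⟨ suc≤2^suc (1 + (1 + c + L) * (2 * L)) (*≤2^+ 1 ((1 + c + L) * (2 * L)) ≤-refl (^≤2^* (1 + c + L) (2 * L) base≤)) ⟩
    2 ^ (2 + (1 + c + L) * (2 * L)) ≡⟨ cong (2 ^_) (+-comm 2 ((1 + c + L) * (2 * L))) ⟩
    2 ^ κ L ∎
    where
      open ≤-Reasoning
      base≤ : base c L ≤ 2 ^ (1 + c + L)
      base≤ = *≤2^+ (1 + c) L (*≤2^+ 1 c ≤-refl (n<2^n c)) (n<2^n L)

  κ-next : ∀ L → 0 < L → κ (L + suc L) ≤ 6 * κ L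
  κ-next L 0<L = begin
    (1 + c + (L + suc L)) * (2 * (L + suc L)) + 2 ≤⟨ +-mono-≤ (*-mono-≤ left (*-monoʳ-≤ 2 right)) (m≤m+n 2 10) ⟩
    (2 * (1 + c + L)) * (2 * (3 * L)) + 12 ≡⟨ r (1 + c + L) L ⟩
    6 * κ L ∎
    where
      open ≤-Reasoning
      r : ∀ x L → (2 * x) * (2 * (3 * L)) + 12 ≡ 6 * (x * (2 * L) + 2)
      r = solve-∀
      left : 1 + c + (L + suc L) ≤ 2 * (1 + c + L)
      left = ≤-trans (m≤m+n _ c) (≤-reflexive (l c L))
        where l : ∀ c L → 1 + c + (L + suc L) + c ≡ 2 * (1 + c + L)
              l = solve-∀
      right : L + suc L ≤ 3 * L
      right = ≤-trans (+-monoʳ-≤ L (+-monoˡ-≤ L 0<L)) (≤-reflexive (cong (λ z → L + (L + z)) (sym (+-identityʳ L))))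

  -- The recursion between thresholds closes here: the exponent for 2 L + 1 is still linear in κ L,
  -- because κ is quadratic, and so it is far below 2 ^ κ L up to a constant factor.
  α-next : ∀ L → 0 < L → α (L + suc L) + 5 ≤ 2 ^ (κ L + 6)
  α-next L 0<L = begin
    5 * κ (L + suc L) + 20 + 5 ≤⟨ +-monoˡ-≤ 5 (+-monoˡ-≤ 20 (*-monoʳ-≤ 5 (κ-next L 0<L))) ⟩
    5 * (6 * κ L) + 20 + 5 ≤⟨ m≤m+n _ (34 * κ L + 39) ⟩
    5 * (6 * κ L) + 20 + 5 + (34 * κ L + 39) ≡⟨ r (κ L) ⟩
    suc (κ L) * 64 ≤⟨ *≤2^+ (κ L) 6 (n<2^n (κ L)) ≤-refl ⟩
    2 ^ (κ L + 6) ∎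
    where
      open ≤-Reasoning
      r : ∀ k → 5 * (6 * k) + 20 + 5 + (34 * k + 39) ≡ suc k * 64
      r = solve-∀

  blocks-density : ∀ L q → 0 < q → 2 * (q * blocks c L + 1) ≤ 4 * (q * 2 ^ κ L)
  blocks-density L q 0<q = begin
    2 * (q * blocks c L + 1) ≤⟨ *-monoʳ-≤ 2 (+-mono-≤ (*-monoʳ-≤ q (blocks≤ L)) (*-mono-≤ 0<q (m^n>0 2 (κ L)))) ⟩
    2 * (q * 2 ^ κ L + q * 2 ^ κ L) ≡⟨ r (q * 2 ^ κ L) ⟩
    4 * (q * 2 ^ κ L) ∎
    where
      open ≤-Reasoning
      r : ∀ x → 2 * (x + x) ≡ 4 * x
      r = solve-∀

  constants : Constants c
  constants = record
    { a = λ L → 2 ^ α L ; y = λ L → 2 ^ η L ; s = λ L → 2 ^ σ L ; q = λ L → 6 + α L + η L ; r = λ L → 2 + σ L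
    ; a>0 = λ L _ → m^n>0 2 (α L) ; s>0 = λ L _ → m^n>0 2 (σ L) ; s≤a = λ L _ → 2^-mono (σ≤α L)
    ; y≥32 = λ L _ → 2^-mono {5} {η L} (≤-trans (m≤m+n 5 3) (≤-trans (m≤n+m 8 (σ L)) (m≤n+m (σ L + 8) ((α (L + suc L) + 5) * 2 ^ σ L))))
    ; q≥2 = λ L _ → s≤s (s≤s z≤n) ; r≥2 = λ L _ → s≤s (s≤s z≤n)
    ; q-degree = λ L _ → suc≤2^suc (5 + α L + η L) (*≤2^+ (5 + α L) (η L) (*≤2^+ 5 (α L) ≤-refl ≤-refl) ≤-refl)
    ; q-density = q-density ; r-degree = λ L _ → suc≤2^suc (1 + σ L) ≤-refl ; r-density = r-density ; y-large = y-large }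
    where
      open ≤-Reasoning
      σ≤α : ∀ L → σ L ≤ α L
      σ≤α L = ≤-trans (m≤m+n (σ L) (3 * κ L + 14)) (≤-reflexive (r (κ L)))
        where r : ∀ k → k + (k + 6) + (3 * k + 14) ≡ 5 * k + 20
              r = solve-∀
      q≤ : ∀ L → 0 < L → 6 + α L + η L ≤ 2 ^ (κ L + σ L + 7)
      q≤ L 0<L = begin
        6 + α L + (X + (σ L + 8)) ≡⟨ r (κ L) X ⟩
        X + (7 * κ L + 40) ≤⟨ +≤2^suc (κ L + 6 + σ L) (*≤2^+ (κ L + 6) (σ L) (α-next L 0<L) ≤-refl) small ⟩
        2 ^ suc (κ L + 6 + σ L) ≡⟨ cong (2 ^_) (r′ (κ L) (σ L)) ⟩
        2 ^ (κ L + σ L + 7) ∎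
        where
          X = (α (L + suc L) + 5) * 2 ^ σ L
          r : ∀ k X → 6 + (5 * k + 20) + (X + (k + (k + 6) + 8)) ≡ X + (7 * k + 40)
          r = solve-∀
          r′ : ∀ k s → suc (k + 6 + s) ≡ k + s + 7
          r′ = solve-∀
          r″ : ∀ k → 7 * k + 40 + (57 * k + 24) ≡ suc k * 64
          r″ = solve-∀
          small : 7 * κ L + 40 ≤ 2 ^ (κ L + 6 + σ L)
          small = begin
            7 * κ L + 40 ≤⟨ m≤m+n _ (57 * κ L + 24) ⟩
            7 * κ L + 40 + (57 * κ L + 24) ≡⟨ r″ (κ L) ⟩
            suc (κ L) * 64 ≤⟨ *≤2^+ (κ L) 6 (n<2^n (κ L)) ≤-refl ⟩
            2 ^ (κ L + 6) ≤⟨ 2^-mono (m≤m+n (κ L + 6) (σ L)) ⟩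
            2 ^ (κ L + 6 + σ L) ∎
      q-density : ∀ L → 0 < L → 2 * ((6 + α L + η L) * blocks c L + 1) ≤ 8 * 2 ^ α L
      q-density L 0<L = begin
        2 * ((6 + α L + η L) * blocks c L + 1) ≤⟨ blocks-density L (6 + α L + η L) (s≤s z≤n) ⟩
        4 * ((6 + α L + η L) * 2 ^ κ L) ≤⟨ *-monoʳ-≤ 4 (*≤2^+ (κ L + σ L + 7) (κ L) (q≤ L 0<L) ≤-refl) ⟩
        4 * 2 ^ (κ L + σ L + 7 + κ L) ≤⟨ *-mono-≤ {4} {8} (m≤m+n 4 4) (2^-mono {κ L + σ L + 7 + κ L} {α L} (≤-trans (m≤m+n (κ L + σ L + 7 + κ L) (κ L + 7)) (≤-reflexive (r (κ L))))) ⟩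
        8 * 2 ^ α L ∎
        where r : ∀ k → k + (k + (k + 6)) + 7 + k + (k + 7) ≡ 5 * k + 20
              r = solve-∀
      r-density : ∀ L → 0 < L → 2 * ((2 + σ L) * blocks c L + 1) * (2 * 2 ^ σ L) ≤ 2 ^ σ L * 2 ^ σ L
      r-density L 0<L = begin
        2 * ((2 + σ L) * blocks c L + 1) * (2 * 2 ^ σ L) ≤⟨ *-monoˡ-≤ (2 * 2 ^ σ L) (blocks-density L (2 + σ L) (s≤s z≤n)) ⟩
        4 * ((2 + σ L) * 2 ^ κ L) * (2 * 2 ^ σ L) ≡⟨ r (2 + σ L) (2 ^ κ L) (2 ^ σ L) ⟩
        2 ^ κ L * (8 * (2 + σ L)) * 2 ^ σ L ≤⟨ *-monoˡ-≤ (2 ^ σ L) (*≤2^+ (κ L) (κ L + 6) ≤-refl small) ⟩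
        2 ^ σ L * 2 ^ σ L ∎
        where
          r : ∀ x k s → 4 * (x * k) * (2 * s) ≡ k * (8 * x) * s
          r = solve-∀
          r′ : ∀ k → 8 * (2 + (k + (k + 6))) + 48 * k ≡ suc k * 64
          r′ = solve-∀
          small : 8 * (2 + σ L) ≤ 2 ^ (κ L + 6)
          small = begin
            8 * (2 + σ L) ≤⟨ m≤m+n _ (48 * κ L) ⟩
            8 * (2 + σ L) + 48 * κ L ≡⟨ r′ (κ L) ⟩
            suc (κ L) * 64 ≤⟨ *≤2^+ (κ L) 6 (n<2^n (κ L)) ≤-refl ⟩
            2 ^ (κ L + 6) ∎
      y-large : ∀ L → 0 < L → 64 * (16 * 2 ^ α (L + suc L) + 2 ^ σ L * suc (16 * 2 ^ α (L + suc L)) ^ 2 ^ σ L) < 2 ^ η L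
      y-large L 0<L = begin-strict
        64 * (K′ + s * suc K′ ^ s) ≤⟨ *-monoʳ-≤ 64 (+≤2^suc (σ L + B * s) K′≤ (*≤2^+ (σ L) (B * s) ≤-refl (^≤2^* B s sucK′≤))) ⟩
        2 ^ 6 * 2 ^ suc (σ L + B * s) ≡⟨ 2^-+ 6 (suc (σ L + B * s)) ⟨
        2 ^ (6 + suc (σ L + B * s)) <⟨ ^-monoʳ-< 2 ≤-refl (n<1+n (6 + suc (σ L + B * s))) ⟩
        2 ^ suc (6 + suc (σ L + B * s)) ≡⟨ cong (2 ^_) (e B s (σ L)) ⟩
        2 ^ η L ∎
        where
          s = 2 ^ σ L
          B = α (L + suc L) + 5
          K′ = 16 * 2 ^ α (L + suc L)
          sucK′≤ : suc K′ ≤ 2 ^ B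
          sucK′≤ = ≤-trans (suc≤2^suc (4 + α (L + suc L)) (*≤2^+ 4 (α (L + suc L)) ≤-refl ≤-refl)) (≤-reflexive (cong (2 ^_) (+-comm 5 (α (L + suc L)))))
          K′≤ : K′ ≤ 2 ^ (σ L + B * s)
          K′≤ = ≤-trans (<⇒≤ sucK′≤) (2^-mono (≤-trans (m≤m*n B s ⦃ m^n≢0 2 (σ L) ⦄) (m≤n+m (B * s) (σ L))))
          e : ∀ B s σ → suc (6 + suc (σ + B * s)) ≡ B * s + (σ + 8)
          e = solve-∀

exponential-beats-square : ∀ H → ∃ λ z → H * (suc z * suc z) ≤ 2 ^ z
exponential-beats-square H = 4 * u , (begin
  H * (suc (4 * u) * suc (4 * u)) ≤⟨ *-mono-≤ (<⇒≤ (n<2^n H)) (*-mono-≤ lin lin) ⟩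
  2 ^ H * (2 ^ (u + 2) * 2 ^ (u + 2)) ≤⟨ *≤2^+ H (u + 2 + (u + 2)) ≤-refl (*≤2^+ (u + 2) (u + 2) ≤-refl ≤-refl) ⟩
  2 ^ (H + (u + 2 + (u + 2))) ≤⟨ 2^-mono (≤-trans (m≤m+n (H + (u + 2 + (u + 2))) (H + 4)) (≤-reflexive (r H))) ⟩
  2 ^ (4 * u) ∎)
  where
    open ≤-Reasoning
    u = H + 4
    lin : suc (4 * u) ≤ 2 ^ (u + 2)
    lin = begin
      suc (4 * u) ≤⟨ m≤m+n (suc (4 * u)) 3 ⟩
      suc (4 * u) + 3 ≡⟨ r₁ u ⟩
      suc u * 4 ≤⟨ *≤2^+ u 2 (n<2^n u) ≤-refl ⟩
      2 ^ (u + 2) ∎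
      where r₁ : ∀ u → suc (4 * u) + 3 ≡ suc u * 4
            r₁ = solve-∀
    r : ∀ H → H + (H + 4 + 2 + (H + 4 + 2)) + (H + 4) ≡ 4 * (H + 4)
    r = solve-∀

-- 16 a will be the density threshold of the class, k is that of the graphs with 1-subdivisions, and o the number
-- of options for each vertex chosen when degrees are bounded.
record Threshold (k t o : ℕ) : Set where
  field
    a y q M K″ : ℕ
  d = 16 * a + 2
  Δ = K″ + 16 * a
  field
    a>0      : 0 < a
    t≤a      : t ≤ a
    y≥32     : 32 ≤ y
    q>0      : 0 < q
    q-degree : suc (32 * a * y) ≤ 2 ^ q
    density  : ∀ w → w ≡ 6 * (q * o + 1) → t + t * w * w ≤ 4 * a
    M-large  : 2 * (d + (d + d) + a * 2048) ≤ suc M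
    K-large  : 2 * suc M ^ 3 * k ≤ K″
    y-large  : 64 * (K″ + t * suc Δ ^ t) < y

-- Everything is expressed through z = log a. The number q₁ of bits is linear in z, so the density
-- condition asks 2 ^ z to beat a quadratic polynomial in z.
threshold : ∀ k t o → 0 < t → 0 < o → Threshold k t o
threshold k t o 0<t 0<o = record
  { a = 2 ^ z ; y = 2 ^ η₁ ; q = q₁ ; M = M₁ ; K″ = K₁ ; M-large = M-large ; K-large = K-large ; a>0 = m^n>0 2 z ; t≤a = t≤a
  ; y≥32 = 2^-mono {5} {η₁} (≤-trans (m≤m+n 5 3) (m≤n+m 8 (B * t + t))) ; q>0 = s≤s z≤n
  ; q-degree = suc≤2^suc (5 + z + η₁) (*≤2^+ (5 + z) η₁ (*≤2^+ 5 z ≤-refl ≤-refl) ≤-refl)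
  ; density = λ { w refl → density } ; y-large = y-large }
  where
    open ≤-Reasoning
    W₁ = 12 * ((14 + 1 + t + (3 + 45 + k) * t) * o)
    z₁ = exponential-beats-square (t * (W₁ * W₁))
    z = proj₁ z₁
    B = 3 * z + 45 + k
    η₁ = B * t + t + 8
    q₁ = 6 + z + η₁
    W = 6 * (q₁ * o + 1)
    q≤ : q₁ ≤ (14 + 1 + t + (3 + 45 + k) * t) * suc z
    q≤ = ≤-trans (m≤m+n q₁ (14 * z + t * z + (45 + k) * t * z + (3 * t + 1))) (≤-reflexive (r z t k))
      where r : ∀ z t k → 6 + z + ((3 * z + 45 + k) * t + t + 8) + (14 * z + t * z + (45 + k) * t * z + (3 * t + 1)) ≡ (14 + 1 + t + (3 + 45 + k) * t) * suc z
            r = solve-∀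
    W≤ : W ≤ W₁ * suc z
    W≤ = begin
      6 * (q₁ * o + 1) ≤⟨ *-monoʳ-≤ 6 (+-monoʳ-≤ (q₁ * o) (*-mono-≤ {1} {q₁} (s≤s z≤n) 0<o)) ⟩
      6 * (q₁ * o + q₁ * o) ≡⟨ r₁ (q₁ * o) ⟩
      12 * (q₁ * o) ≤⟨ *-monoʳ-≤ 12 (*-monoˡ-≤ o q≤) ⟩
      12 * ((14 + 1 + t + (3 + 45 + k) * t) * suc z * o) ≡⟨ r₂ (14 + 1 + t + (3 + 45 + k) * t) (suc z) o ⟩
      W₁ * suc z ∎
      where r₁ : ∀ x → 6 * (x + x) ≡ 12 * x
            r₁ = solve-∀
            r₂ : ∀ x z o → 12 * (x * z * o) ≡ 12 * (x * o) * z
            r₂ = solve-∀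
    core : t * (W * W) ≤ 2 ^ z
    core = begin
      t * (W * W) ≤⟨ *-monoʳ-≤ t (*-mono-≤ W≤ W≤) ⟩
      t * ((W₁ * suc z) * (W₁ * suc z)) ≡⟨ r t W₁ (suc z) ⟩
      t * (W₁ * W₁) * (suc z * suc z) ≤⟨ proj₂ z₁ ⟩
      2 ^ z ∎
      where r : ∀ t w z → t * ((w * z) * (w * z)) ≡ t * (w * w) * (z * z)
            r = solve-∀
    1≤W : 1 ≤ W
    1≤W = *-mono-≤ {1} {6} {1} (s≤s z≤n) (m≤n+m 1 (q₁ * o))
    t≤a : t ≤ 2 ^ z
    t≤a = ≤-trans (≤-trans (≤-reflexive (sym (*-identityʳ t))) (*-monoʳ-≤ t (*-mono-≤ 1≤W 1≤W))) core
    density : t + t * W * W ≤ 4 * 2 ^ z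
    density = begin
      t + t * W * W ≤⟨ +-mono-≤ t≤a (≤-trans (≤-reflexive (*-assoc t W W)) core) ⟩
      2 ^ z + 2 ^ z ≤⟨ m≤m+n (2 ^ z + 2 ^ z) (2 * 2 ^ z) ⟩
      2 ^ z + 2 ^ z + 2 * 2 ^ z ≡⟨ r (2 ^ z) ⟩
      4 * 2 ^ z ∎
      where r : ∀ x → x + x + 2 * x ≡ 4 * x
            r = solve-∀
    -- Three out-neighbourhoods of size 16 a + 2 and the degree 2048 a, doubled, add up to at most
    -- 4204 a, which 2 ^ 13 absorbs.
    M₁ = 2 ^ (z + 13)
    K₁ = 2 ^ (3 * z + 43 + k)
    M-large : 2 * ((16 * 2 ^ z + 2) + ((16 * 2 ^ z + 2) + (16 * 2 ^ z + 2)) + 2 ^ z * 2048) ≤ suc M₁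
    M-large = begin
      2 * ((16 * 2 ^ z + 2) + ((16 * 2 ^ z + 2) + (16 * 2 ^ z + 2)) + 2 ^ z * 2048) ≡⟨ r (2 ^ z) ⟩
      4192 * 2 ^ z + 12 * 1 ≤⟨ +-monoʳ-≤ (4192 * 2 ^ z) (*-monoʳ-≤ 12 (m^n>0 2 z)) ⟩
      4192 * 2 ^ z + 12 * 2 ^ z ≡⟨ *-distribʳ-+ (2 ^ z) 4192 12 ⟨
      4204 * 2 ^ z ≤⟨ *-monoˡ-≤ (2 ^ z) {4204} {2 ^ 13} (m≤m+n 4204 3988) ⟩
      2 ^ 13 * 2 ^ z ≡⟨ trans (*-comm (2 ^ 13) (2 ^ z)) (sym (2^-+ z 13)) ⟩
      2 ^ (z + 13) ≤⟨ n≤1+n M₁ ⟩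
      suc M₁ ∎
      where r : ∀ x → 2 * ((16 * x + 2) + ((16 * x + 2) + (16 * x + 2)) + x * 2048) ≡ 4192 * x + 12 * 1
            r = solve-∀
    M≤ : suc M₁ ≤ 2 ^ (z + 14)
    M≤ = ≤-trans (suc≤2^suc (z + 13) ≤-refl) (≤-reflexive (cong (2 ^_) (sym (+-suc z 13))))
    K-large : 2 * suc M₁ ^ 3 * k ≤ K₁
    K-large = ≤-trans (*≤2^+ (1 + (z + 14) * 3) k (*≤2^+ 1 ((z + 14) * 3) ≤-refl (^≤2^* (z + 14) 3 M≤)) (<⇒≤ (n<2^n k))) (≤-reflexive (cong (2 ^_) (r z k)))
      where r : ∀ z k → 1 + (z + 14) * 3 + k ≡ 3 * z + 43 + k
            r = solve-∀
    Δ≤ : suc (K₁ + 16 * 2 ^ z) ≤ 2 ^ B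
    Δ≤ = begin
      suc (K₁ + 16 * 2 ^ z) ≤⟨ suc≤2^suc (suc (3 * z + 43 + k)) (+≤2^suc (3 * z + 43 + k) ≤-refl
                                                 (≤-trans (*≤2^+ 4 z ≤-refl ≤-refl) (2^-mono (≤-trans (m≤m+n (4 + z) (2 * z + 39 + k)) (≤-reflexive (r₁ z k)))))) ⟩
      2 ^ (2 + (3 * z + 43 + k)) ≡⟨ cong (2 ^_) (r₂ z k) ⟩
      2 ^ B ∎
      where r₁ : ∀ z k → 4 + z + (2 * z + 39 + k) ≡ 3 * z + 43 + k
            r₁ = solve-∀
            r₂ : ∀ z k → 2 + (3 * z + 43 + k) ≡ 3 * z + 45 + k
            r₂ = solve-∀
    y-large : 64 * (K₁ + t * suc (K₁ + 16 * 2 ^ z) ^ t) < 2 ^ η₁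
    y-large = begin-strict
      64 * (K₁ + t * suc (K₁ + 16 * 2 ^ z) ^ t) ≤⟨ *-monoʳ-≤ 64 (+≤2^suc (t + B * t) K₁≤ (*≤2^+ t (B * t) (<⇒≤ (n<2^n t)) (^≤2^* B t Δ≤))) ⟩
      2 ^ 6 * 2 ^ suc (t + B * t) ≡⟨ 2^-+ 6 (suc (t + B * t)) ⟨
      2 ^ (6 + suc (t + B * t)) <⟨ ^-monoʳ-< 2 ≤-refl (n<1+n (6 + suc (t + B * t))) ⟩
      2 ^ suc (6 + suc (t + B * t)) ≡⟨ cong (2 ^_) (r B t) ⟩
      2 ^ η₁ ∎
      where
        r : ∀ B t → suc (6 + suc (t + B * t)) ≡ B * t + t + 8
        r = solve-∀
        K₁≤ : K₁ ≤ 2 ^ (t + B * t)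
        K₁≤ = ≤-trans (≤-trans (m≤m+n K₁ (16 * 2 ^ z)) (<⇒≤ Δ≤)) (2^-mono (≤-trans (m≤m*n B t ⦃ >-nonZero 0<t ⦄) (m≤n+m (B * t) t)))

-- Sparsity of the class

union : ∀ {N} → Graph N → Graph N → Graph N
union A B = record
  { adj = λ u v → adj A u v ∨ adj B u v ; adj-sym = λ u v → cong₂ _∨_ (adj-sym A u v) (adj-sym B u v)
  ; adj-irrefl = λ u → cong₂ _∨_ (adj-irrefl A u) (adj-irrefl B u) }

E-union : ∀ {N} (A B : Graph N) (T : Subset N) → E (union A B) T ≤ E A T + E B T
E-union A B T = ≤-trans (sumOn-mono T λ v _ → ≤-trans (#-mono (split v)) (#-∪ (T ∩ adj A v) (T ∩ adj B v))) (≤-reflexive (sumOn-+ T (deg A T) (deg B T)))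
  where
    split : ∀ v → (T ∩ adj (union A B) v) ⊆ ((T ∩ adj A v) ∪ (T ∩ adj B v))
    split v u p with ∪-elim (adj A v) (adj B v) {u} (∧-elimʳ {T u} p)
    ... | inj₁ q = ⊆-∪ˡ (T ∩ adj A v) (T ∩ adj B v) u (∧-intro (∧-elimˡ p) q)
    ... | inj₂ q = ⊆-∪ʳ (T ∩ adj A v) (T ∩ adj B v) u (∧-intro (∧-elimˡ p) q)

module ClassSparse (X : GraphFamily) (her : Hereditary X) (c : ℕ) (small : ∀ n → CardX≤ X n (n ! * c ^ n)) (const : Constants c)
  (t′ : ℕ) (thr : Threshold (Constants.K const 1) (suc t′) (options c (suc t′)))
  {N} (G : Graph N) (G∈X : X N G) (noK : ¬ ContainsKtt (suc t′) G) where
  open Threshold thr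
  t = suc t′
  D = 32 * a * y

  module Refute (S : Subset N) (pos : 0 < # S) (dense : 16 * a * # S ≤ E G S)
    (sparser : ∀ T → T ⊆ S → # T < # S → 0 < # T → E G T < 16 * a * # T) where
    open MinimalDense G (16 * a) S dense sparser using (upper; sparser≤)

    light : E G (S ∖ heavy G S D) ≤ 8 * a * # S
    light = ≤-trans (sparse-≤ G (8 * a) (S ∖ heavy G S D) (NearRegular.near-regular-sparse X her c small G G∈X t′ noK D q a q-degree q>0 density (S ∖ heavy G S D) (light-degree G S D)))
      (*-monoʳ-≤ (8 * a) (#-mono (⊆-∖ S (heavy G S D))))

    -- S itself may exceed the threshold, but by at most 2 on average; this is the origin of d = 16
    -- a + 2.
    low : ∀ T → T ⊆ S → 0 < # T → ∃ λ v → v ∈ T × deg G T v ≤ d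
    low T T⊆S posT = let v , v∈ , lt = low-degree G (suc d) T posT (bound (# T <? # S)) in v , v∈ , ≤-pred lt
      where
        bound : Dec (# T < # S) → E G T < suc d * # T
        bound (yes lt) = <-≤-trans (sparser T T⊆S lt posT) (*-monoˡ-≤ (# T) (≤-trans (m≤m+n (16 * a) 2) (n≤1+n d)))
        bound (no ¬lt) = begin-strict
          E G T ≤⟨ links-mono G T⊆S T⊆S ⟩
          E G S ≤⟨ upper pos ⟩
          d * # S ≤⟨ *-monoʳ-≤ d (≮⇒≥ ¬lt) ⟩
          d * # T <⟨ m<n+m (d * # T) posT ⟩
          suc d * # T ∎
          where open ≤-Reasoning

    module Split (U : Unbalanced G S a y t) (ori : Orientation G S d) where
      open Unbalanced U

      rel : Fin N → Subset N
      rel b = Q ∩ adj G b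

      module Matched (M₁ : Matching B Q rel (adj G)) (max : Maximal M₁) where
        open Matching M₁

        no-biclique : ¬ Biclique t (B ∖ used) rel
        no-biclique J = noK (left , right , left-inj , right-inj , λ i j → ∧-elimʳ {Q (right j)} (complete i j))
          where open Biclique J

        -- Thinning turns a fixed fraction of the pairs inside T into an induced 1-subdivision,
        -- whose density the case L = 1 bounds.
        pairs-sparse : ∀ T → 0 < # T → E pairs T < K″ * # T
        pairs-sparse T posT = bound (Thin.thinned G S Q B ori Q⊆S B⊆S disjoint M₁ (a * 2048) M T B-sparse M-large)
          where
            open ≤-Reasoning
            bound : (∃ λ (Sd : Subdivision G 1) → E pairs T ≤ 2 * suc M ^ 3 * E (Subdivision.F Sd) T) → E pairs T < K″ * # T
            bound (Sd , le) = begin-strict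
              E pairs T ≤⟨ le ⟩
              2 * suc M ^ 3 * E (Subdivision.F Sd) T <⟨ *-monoʳ-< (2 * suc M ^ 3) ⦃ m*n≢0 2 (suc M ^ 3) ⦃ _ ⦄ ⦃ m^n≢0 (suc M) 3 ⦄ ⦄
                                                                       (SubdivisionSparse.subdivision-sparse X her c small const G G∈X (suc (# T)) (s≤s z≤n) Sd T ≤-refl posT) ⟩
              2 * suc M ^ 3 * (Constants.K const 1 * # T) ≡⟨ *-assoc (2 * suc M ^ 3) (Constants.K const 1) (# T) ⟨
              2 * suc M ^ 3 * Constants.K const 1 * # T ≤⟨ *-monoˡ-≤ (# T) K-large ⟩
              K″ * # T ∎

        -- Two vertices seen by an unmatched b are matched to each other or adjacent in G. So the
        -- cliques live in the union of both graphs, which is sparse on Q: the first by thinning,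
        -- the second by minimality of S.
        both-low : ∀ T → T ⊆ Q → 0 < # T → ∃ λ v → v ∈ T × deg (union pairs G) T v ≤ Δ
        both-low T T⊆Q posT = let v , v∈ , lt = low-degree (union pairs G) Δ T posT lt₀ in v , v∈ , <⇒≤ lt
          where
            open ≤-Reasoning
            lt₀ : E (union pairs G) T < Δ * # T
            lt₀ = begin-strict
              E (union pairs G) T ≤⟨ E-union pairs G T ⟩
              E pairs T + E G T <⟨ +-mono-<-≤ (pairs-sparse T posT) (sparser≤ T (λ v p → Q⊆S v (T⊆Q v p)) (≤-<-trans (#-mono T⊆Q) Q<S)) ⟩
              K″ * # T + 16 * a * # T ≡⟨ *-distribʳ-+ (# T) K″ (16 * a) ⟨
              Δ * # T ∎

        impossible : ⊥
        impossible = crowded G U max (union pairs G) K″ Δ (s≤s z≤n) pos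
          (λ x w → [ ⊆-∪ˡ (adj pairs x) (adj G x) w , ⊆-∪ʳ (adj pairs x) (adj G x) w ]′)
          (sparse-≤ pairs K″ Q (pairs-sparse Q)) both-low no-biclique y-large

      impossible : ⊥
      impossible = let M₁ , max = greedy B Q rel (adj G) (λ b _ → ⊆-∩ˡ Q (adj G b)) in Matched.impossible M₁ max

    impossible : ⊥
    impossible = Split.impossible (unbalanced G S a y t ⦃ >-nonZero a>0 ⦄ y≥32 t≤a pos dense sparser light) (orient G d S low)

  class-sparse : ∀ S → 0 < # S → E G S < 16 * a * # S
  class-sparse S = no-dense G (16 * a) (λ _ → ⊤) (λ _ _ → tt) (λ S _ pos dense sparser → Refute.impossible S pos dense sparser) S tt

-- Labels

n≤2^⌈log₂n⌉ : ∀ n → n ≤ 2 ^ ⌈log₂ n ⌉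
n≤2^⌈log₂n⌉ = <-rec (λ n → n ≤ 2 ^ ⌈log₂ n ⌉) step
  where
    open ≤-Reasoning
    step : ∀ n → (∀ {m} → m < n → m ≤ 2 ^ ⌈log₂ m ⌉) → n ≤ 2 ^ ⌈log₂ n ⌉
    step zero          rec = z≤n
    step (suc zero)    rec = m^n>0 2 ⌈log₂ 1 ⌉
    step n@(suc (suc k)) rec = begin
      n ≤⟨ n≤2*half n ⟩
      2 * ⌈ n /2⌉ ≤⟨ *-monoʳ-≤ 2 (rec (⌈n/2⌉<n k)) ⟩
      2 ^ suc ⌈log₂ ⌈ n /2⌉ ⌉ ≡⟨ cong (λ z → 2 ^ suc z) (⌈log₂⌈n/2⌉⌉≡⌈log₂n⌉∸1 n) ⟩
      2 ^ suc (⌈log₂ n ⌉ ∸ 1) ≡⟨ cong (2 ^_) (m+[n∸m]≡n {1} positive) ⟩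
      2 ^ ⌈log₂ n ⌉ ∎
      where
        positive : 1 ≤ ⌈log₂ n ⌉
        positive = ≤-trans (≤-reflexive (sym (⌈log₂2^n⌉≡n 1))) (⌈log₂⌉-mono-≤ {2} {n} (s≤s (s≤s z≤n)))
        n≤2*half : ∀ n → n ≤ 2 * ⌈ n /2⌉
        n≤2*half n = begin
          n ≡⟨ ⌊n/2⌋+⌈n/2⌉≡n n ⟨
          _ + ⌈ n /2⌉ ≤⟨ +-monoˡ-≤ ⌈ n /2⌉ (⌊n/2⌋≤⌈n/2⌉ n) ⟩
          ⌈ n /2⌉ + ⌈ n /2⌉ ≡⟨ cong (⌈ n /2⌉ +_) (sym (+-identityʳ ⌈ n /2⌉)) ⟩
          2 * ⌈ n /2⌉ ∎

concat-injective : ∀ {L k} (xs ys : Vec (Vec Bool L) k) → concat xs ≡ concat ys → xs ≡ ys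
concat-injective []       []       _  = refl
concat-injective (x ∷ xs) (y ∷ ys) eq with p , q ← ++-injective x y eq = cong₂ _∷_ p (concat-injective xs ys q)

-- A label consists of suc d blocks of equal length, the first of which identifies the vertex.
Label : ℕ → ℕ → Set
Label d L = Vec (Vec Bool L) (suc d)

flat : ∀ {d L} → Label d L → List Bool
flat x = toList (concat x)

length-flat : ∀ {d L} (x : Label d L) → length (flat x) ≡ suc d * L
length-flat {d} {L} x = trans (length-toList (concat x)) (length-concat (concat x))
  where length-concat : ∀ {n} (v : Vec Bool n) → Data.Vec.length v ≡ n
        length-concat []      = refl
        length-concat (_ ∷ v) = cong suc (length-concat v)
        import Data.Vec

flat-injective : ∀ {d L} (x y : Label d L) → flat x ≡ flat y → x ≡ y
flat-injective x y eq = concat-injective x y (trans (sym (cast-is-id refl (concat x))) (toList-injective refl (concat x) (concat y) eq))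
  where open import Data.Vec.Properties using (cast-is-id)

flat-length : ∀ {d L L′} (x : Label d L) (y : Label d L′) → flat x ≡ flat y → L ≡ L′
flat-length {d} {L} {L′} x y eq = *-cancelˡ-≡ L L′ (suc d) (trans (sym (length-flat x)) (trans (cong length eq) (length-flat y)))

Points : ∀ {d L} → Label d L → Label d L → Set
Points x y = ∃ λ i → lookup x (suc i) ≡ lookup y zero

-- The decoder does not know n. The block length is recovered from the length of the strings, as the
-- number of blocks is fixed. `distinct` prevents a vertex from pointing at itself through a padding
-- block.
record Decoded (d : ℕ) (p q : List Bool) : Set where
  field
    {L}      : ℕ
    x y      : Label d L
    is-x     : flat x ≡ p
    is-y     : flat y ≡ q
    distinct : lookup x zero ≢ lookup y zero
    points   : Points x y ⊎ Points y x

isOne : Fin 2 → Bool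
isOne zero       = false
isOne (suc zero) = true

isOne-injective : ∀ {i j} → isOne i ≡ isOne j → i ≡ j
isOne-injective {zero}     {zero}     _ = refl
isOne-injective {zero}     {suc zero} ()
isOne-injective {suc zero} {zero}     ()
isOne-injective {suc zero} {suc zero} _ = refl

bits : ∀ {n} L → n ≤ 2 ^ L → Fin n → Vec Bool L
bits L le u = tabulate (λ i → isOne (finToFun {2} {L} (inject≤ u le) i))

bits-injective : ∀ {n} L (le : n ≤ 2 ^ L) → Injective _≡_ _≡_ (bits L le)
bits-injective L le {u} {v} eq = inject≤-injective le le u v (finToFun-injective {L} {2} λ i → isOne-injective
  (trans (sym (lookup∘tabulate (λ i → isOne (finToFun {2} {L} (inject≤ u le) i)) i))
    (trans (cong (λ w → lookup w i) eq) (lookup∘tabulate (λ i → isOne (finToFun {2} {L} (inject≤ v le) i)) i))))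

-- If v were missed, `enum S` would inject its # S indices into a smaller set.
enum-surjective : ∀ {N} (S : Subset N) v → v ∈ S → ∃ λ i → enum S i ≡ v
enum-surjective S v v∈S with any? (λ i → enum S i ≟ᶠ v)
... | yes r = r
... | no ¬r = ⊥-elim (<⇒≱ (≤-reflexive (sym (#-remove S v v∈S))) (injective⇒≤ {f = f} f-inj))
  where
    S′ = S ∖ δ v
    in′ : ∀ i → enum S i ∈ S′
    in′ i = ∧-intro (enum-∈ S i) (not-intro λ q → ¬r (i , sym (∈δ⇒≡ q)))
    f : Fin (# S) → Fin (# S′)
    f i = fromℕ< (rank< S′ (enum S i) (in′ i))
    f-inj : Injective _≡_ _≡_ f
    f-inj {i} {j} eq = enum-injective S (rank-injective S′ _ _ (in′ i) (in′ j)
      (trans (sym (toℕ-fromℕ< _)) (trans (cong toℕ eq) (toℕ-fromℕ< _))))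

module Encode {n} (G : Graph n) {d} (ori : Orientation G (λ _ → true) d) where
  open Orientation ori
  L = ⌈log₂ n ⌉

  name : Fin n → Vec Bool L
  name = bits L (n≤2^⌈log₂n⌉ n)

  -- Unused blocks repeat the name of the vertex itself.
  entry : Fin n → Fin d → Fin n
  entry u i with toℕ i <? # (out u)
  ... | yes p = enum (out u) (fromℕ< p)
  ... | no _  = u

  entry-sound : ∀ u i → entry u i ∈ out u ⊎ entry u i ≡ u
  entry-sound u i with toℕ i <? # (out u)
  ... | yes p = inj₁ (enum-∈ (out u) _)
  ... | no _  = inj₂ refl

  entry-complete : ∀ u v → v ∈ out u → ∃ λ i → entry u i ≡ v
  entry-complete u v v∈ with j , refl ← enum-surjective (out u) v v∈ = i , at
    where
      i : Fin d
      i = inject≤ j (outdegree u)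
      i≡j : toℕ i ≡ toℕ j
      i≡j = toℕ-inject≤ j (outdegree u)
        where open import Data.Fin.Properties using (toℕ-inject≤)
      at : entry u i ≡ enum (out u) j
      at with toℕ i <? # (out u)
      ... | yes p = cong (enum (out u)) (toℕ-injective (trans (toℕ-fromℕ< p) i≡j))
      ... | no ¬p = ⊥-elim (¬p (subst (_< # (out u)) (sym i≡j) (toℕ<n j)))

  label : Fin n → Label d L
  label u = name u ∷ tabulate (name ∘ entry u)

  label-entry : ∀ u i → lookup (label u) (suc i) ≡ name (entry u i)
  label-entry u i = lookup∘tabulate (name ∘ entry u) i

  points-to : ∀ u v → v ∈ out u → Points (label u) (label v)
  points-to u v v∈ = let i , eq = entry-complete u v v∈ in i , trans (label-entry u i) (cong name eq)

  points-adj : ∀ u v → u ≢ v → Points (label u) (label v) → adj G u v ≡ true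
  points-adj u v u≢v (i , eq) with entry-sound u i | bits-injective L (n≤2^⌈log₂n⌉ n) (trans (sym (label-entry u i)) eq)
  ... | inj₁ e∈ | refl = out-adj u _ e∈
  ... | inj₂ e≡ | refl = ⊥-elim (u≢v (sym e≡))

  adjacent⇔ : ∀ u v → adj G u v ≡ true ⇔ Decoded d (flat (label u)) (flat (label v))
  adjacent⇔ u v = mk⇔ to from
    where
      to : adj G u v ≡ true → Decoded d (flat (label u)) (flat (label v))
      to a = record
        { x = label u ; y = label v ; is-x = refl ; is-y = refl
        ; distinct = λ eq → true≢false a (subst (λ w → adj G u w ≡ false) (bits-injective L (n≤2^⌈log₂n⌉ n) eq) (adj-irrefl G u))
        ; points = [ inj₁ ∘ points-to u v , inj₂ ∘ points-to v u ]′ (covers u v refl refl a) }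
      from : Decoded d (flat (label u)) (flat (label v)) → adj G u v ≡ true
      from dec with refl ← flat-length (Decoded.x dec) (label u) (Decoded.is-x dec) = conclude
        (flat-injective (Decoded.x dec) (label u) (Decoded.is-x dec)) (flat-injective (Decoded.y dec) (label v) (Decoded.is-y dec)) (Decoded.distinct dec) (Decoded.points dec)
        where
          conclude : ∀ {x y : Label d L} → x ≡ label u → y ≡ label v → lookup x zero ≢ lookup y zero → Points x y ⊎ Points y x → adj G u v ≡ true
          conclude refl refl names≢ (inj₁ p) = points-adj u v (names≢ ∘ cong name) p
          conclude refl refl names≢ (inj₂ p) = trans (adj-sym G u v) (points-adj v u (names≢ ∘ cong name ∘ sym) p)

theorem1p2 : (X : GraphFamily) → IsoClosed X → Hereditary X →
    Small X → WeaklySparse X → HasLogLabeling X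
theorem1p2 X _ her (c , small) (zero , noK) =
  -- Every graph contains K_{0,0}, so for t = 0 the class is empty.
  (λ _ → 0) , (0 , 0 , λ _ _ → z≤n) , (λ _ _ → ⊥) , λ n G G∈X → ⊥-elim (noK n G G∈X ((λ ()) , (λ ()) , (λ { {()} }) , (λ { {()} }) , λ ()))
theorem1p2 X _ her (c , small) (suc t′ , noK) =
  (λ n → suc d * ⌈log₂ n ⌉) , (suc d , 0 , λ _ _ → ≤-refl) , Decoded d , λ n G G∈X →
    let open Encode G (orientation n G G∈X) in (flat ∘ label) , (λ u → length-flat (label u)) , adjacent⇔
  where
    thr = threshold (Constants.K (constants c) 1) (suc t′) (options c (suc t′)) (s≤s z≤n) (s≤s z≤n)
    d = 16 * Threshold.a thr
    orientation : ∀ n (G : Graph n) → X n G → Orientation G (λ _ → true) d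
    orientation n G G∈X = orient G d (λ _ → true) λ T _ pos →
      let v , v∈ , lt = low-degree G d T pos (ClassSparse.class-sparse X her c small (constants c) t′ thr G G∈X (noK n G G∈X) T pos) in v , v∈ , <⇒≤ lt
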